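{- Let $\lambda$ be a positive real number and let $\Omega$ be an alphabet with $b\geq 2$ symbols. Let $(p_i)_{i\in\mathbb{N}_0}$ be a sequence of non-negative real numbers such that $\sum_{i\geq 0}p_i=1$ and $\sum_{i\geq 0} i\,p_i=\lambda$, and, in the case $b=2$, assume in addition that $p_0\geq 1/2$. Then there is an explicit construction of an infinite sequence $x\in\Omega^{\mathbb{N}}$ such that for every $i\in\mathbb{N}_0$, \[ \lim_{k\to\infty} Z^\lambda_{i,k}(x)=p_i . \]
   Context: $\mathbb{N}_0$ denotes the non-negative integers and $\mathbb{N}$ the positive integers. $\Omega^{\mathbb{N}}$ is the set of infinite sequences over $\Omega$, and positions are numbered starting at $1$; $x[i\dots j]$ denotes the subword of $x$ from position $i$ to position $j$. For words $v,w$, $|v|_w=\#\{1\leq i\leq |v|-|w|+1 : v[i\dots i+|w|-1]=w\}$ is the number of (possibly overlapping) occurrences of $w$ in $v$. For $x\in\Omega^{\mathbb{N}}$, $\lambda>0$, $i\in\mathbb{N}_0$, $k\in\mathbb{N}$, \[ Z^\lambda_{i,k}(x)=\frac{\#\{w\in\Omega^k : |x[1\dots\lfloor\lambda b^k\rfloor+k-1]|_w=i\}}{b^k}. \] -}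

module Defs where

open import Data.Fin.Base using (Fin)
import Data.Fin.Properties as Fin
open import Data.Integer.Base as ℤ using (+_)
import Data.Integer.Properties as ℤ
open import Data.List.Base
  using (List; []; _∷_; length; take; drop; filter; upTo; applyUpTo; allFin; cartesianProductWith)
open import Data.List.Properties using (≡-dec)
open import Data.Nat.Base as ℕ using (ℕ; zero; suc; NonTrivial; NonZero; nonTrivial⇒nonZero)
import Data.Nat.Properties as ℕ
open import Data.Product.Base using (Σ-syntax; ∃-syntax; _×_; _,_; proj₁; proj₂)
open import Data.Rational.Base as ℚ using (ℚ; 0ℚ; 1ℚ; ½; mkℚ)
import Data.Rational.Properties as ℚ
open import Data.Rational.Solver using (module +-*-Solver)
import Data.Rational.Unnormalised.Base as ℚᵘ
import Data.Rational.Unnormalised.Properties as ℚᵘ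
open import Data.Sum.Base using (inj₁; inj₂)
open import Data.Vec.Base as Vec using (Vec; toList)
open import Relation.Binary.PropositionalEquality
open import Relation.Nullary using (¬_; yes; no; contradiction)

-- A real number is a Cauchy sequence of rationals; since ∃ is a Σ-type, the
-- field cauchy carries a modulus.  No quotient is taken: x and y denote the
-- same real when x ≤ y and y ≤ x.

Cauchy : (ℕ → ℚ) → Set
Cauchy u = ∀ ε → 0ℚ ℚ.< ε →
  ∃[ N ] (∀ m n → N ℕ.≤ m → N ℕ.≤ n → ℚ.∣ u m ℚ.- u n ∣ ℚ.< ε)

record ℝ : Set where
  constructor mkℝ
  field
    seq    : ℕ → ℚ
    cauchy : Cauchy seq

open ℝ public

infix 4 _<_ _≤_

_<_ : ℝ → ℝ → Set
x < y = Σ[ ε ∈ ℚ ] (0ℚ ℚ.< ε × ∃[ N ] (∀ n → N ℕ.≤ n → seq x n ℚ.+ ε ℚ.≤ seq y n))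

_≤_ : ℝ → ℝ → Set
x ≤ y = ∀ ε → 0ℚ ℚ.< ε → ∃[ N ] (∀ n → N ℕ.≤ n → seq x n ℚ.≤ seq y n ℚ.+ ε)

module ℚ-Lemmas where
  open +-*-Solver using (solve; _:=_; _:+_; _:*_; _:-_; :-_; con)

  ring₁ : ∀ p q → q ℚ.+ (p ℚ.- q) ≡ p
  ring₁ = solve 2 (λ p q → q :+ (p :- q) := p) refl

  ring₂ : ∀ p q → ℚ.- (p ℚ.- q) ≡ q ℚ.- p
  ring₂ = solve 2 (λ p q → :- (p :- q) := q :- p) refl

  ring₃ : ∀ a d → (a ℚ.+ d) ℚ.- a ≡ d
  ring₃ = solve 2 (λ a d → (a :+ d) :- a := d) refl

  ring₄ : ∀ a b → b ℚ.- a ≡ (ℚ.- a) ℚ.- (ℚ.- b)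
  ring₄ = solve 2 (λ a b → b :- a := (:- a) :- (:- b)) refl

  ring₅ : ∀ a b c d → (a ℚ.- b) ℚ.+ (c ℚ.- d) ≡ (a ℚ.+ c) ℚ.- (b ℚ.+ d)
  ring₅ = solve 4 (λ a b c d → (a :- b) :+ (c :- d) := (a :+ c) :- (b :+ d)) refl

  ring₆ : ∀ a b c d → a ℚ.* (b ℚ.- d) ℚ.+ d ℚ.* (a ℚ.- c) ≡ a ℚ.* b ℚ.- c ℚ.* d
  ring₆ = solve 4 (λ a b c d → a :* (b :- d) :+ d :* (a :- c) := a :* b :- c :* d) refl

  ring₇ : ∀ x d e → x ℚ.+ d ℚ.+ e ≡ x ℚ.+ (e ℚ.+ (d ℚ.+ d)) ℚ.- d
  ring₇ = solve 3 (λ x d e → x :+ d :+ e := x :+ (e :+ (d :+ d)) :- d) refl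

  ring₈ : ∀ y d → y ℚ.+ d ℚ.- d ≡ y
  ring₈ = solve 2 (λ y d → y :+ d :- d := y) refl

  <-respˡ : ∀ {p q r} → p ≡ q → p ℚ.< r → q ℚ.< r
  <-respˡ refl p<r = p<r

  ≤-respˡ : ∀ {p q r} → p ≡ q → p ℚ.≤ r → q ℚ.≤ r
  ≤-respˡ refl p≤r = p≤r

  ≤-respʳ : ∀ {p q r} → q ≡ r → p ℚ.≤ q → p ℚ.≤ r
  ≤-respʳ refl p≤q = p≤q

  half : ℚ → ℚ
  half ε = ½ ℚ.* ε

  half-pos : ∀ {ε} → 0ℚ ℚ.< ε → 0ℚ ℚ.< half ε
  half-pos {ε} 0<ε = <-respˡ (ℚ.*-zeroʳ ½) (ℚ.*-monoʳ-<-pos ½ 0<ε)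

  half+half : ∀ ε → half ε ℚ.+ half ε ≡ ε
  half+half ε = trans (sym (ℚ.*-distribʳ-+ ε ½ ½)) (ℚ.*-identityˡ ε)

  half<self : ∀ {ε} → 0ℚ ℚ.< ε → half ε ℚ.< ε
  half<self {ε} 0<ε = subst₂ ℚ._<_ (ℚ.+-identityʳ _) (half+half ε)
    (ℚ.+-monoʳ-< (half ε) (half-pos 0<ε))

  p≤∣p∣ : ∀ p → p ℚ.≤ ℚ.∣ p ∣
  p≤∣p∣ p with ℚ.≤-total 0ℚ p
  ... | inj₁ 0≤p = ℚ.≤-reflexive (sym (ℚ.0≤p⇒∣p∣≡p 0≤p))
  ... | inj₂ p≤0 = ℚ.≤-trans p≤0 (ℚ.0≤∣p∣ p)

  ∣p-q∣<ε⇒p<q+ε : ∀ p q {ε} → ℚ.∣ p ℚ.- q ∣ ℚ.< ε → p ℚ.< q ℚ.+ ε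
  ∣p-q∣<ε⇒p<q+ε p q d = <-respˡ (ring₁ p q)
    (ℚ.+-monoʳ-< q (ℚ.≤-<-trans (p≤∣p∣ _) d))

  ∣p-q∣≡∣q-p∣ : ∀ p q → ℚ.∣ p ℚ.- q ∣ ≡ ℚ.∣ q ℚ.- p ∣
  ∣p-q∣≡∣q-p∣ p q = trans (sym (ℚ.∣-p∣≡∣p∣ (p ℚ.- q)))
    (cong ℚ.∣_∣ (ring₂ p q))

  ∣p∣≤∣q∣+∣p-q∣ : ∀ p q → ℚ.∣ p ∣ ℚ.≤ ℚ.∣ q ∣ ℚ.+ ℚ.∣ p ℚ.- q ∣
  ∣p∣≤∣q∣+∣p-q∣ p q = ≤-respˡ (cong ℚ.∣_∣ (ring₁ p q))
    (ℚ.∣p+q∣≤∣p∣+∣q∣ q (p ℚ.- q))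

  ∣p∣-∣q∣≤∣p-q∣ : ∀ p q → ℚ.∣ p ∣ ℚ.- ℚ.∣ q ∣ ℚ.≤ ℚ.∣ p ℚ.- q ∣
  ∣p∣-∣q∣≤∣p-q∣ p q = ≤-respʳ (ring₃ ℚ.∣ q ∣ ℚ.∣ p ℚ.- q ∣)
    (ℚ.+-monoˡ-≤ (ℚ.- ℚ.∣ q ∣) (∣p∣≤∣q∣+∣p-q∣ p q))

  ∣∣p∣-∣q∣∣≤∣p-q∣ : ∀ p q → ℚ.∣ ℚ.∣ p ∣ ℚ.- ℚ.∣ q ∣ ∣ ℚ.≤ ℚ.∣ p ℚ.- q ∣
  ∣∣p∣-∣q∣∣≤∣p-q∣ p q with ℚ.∣p∣≡p∨∣p∣≡-p (ℚ.∣ p ∣ ℚ.- ℚ.∣ q ∣)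
  ... | inj₁ eq = ≤-respˡ (sym eq) (∣p∣-∣q∣≤∣p-q∣ p q)
  ... | inj₂ eq = ≤-respˡ (sym (trans eq (ring₂ ℚ.∣ p ∣ ℚ.∣ q ∣)))
    (≤-respʳ (∣p-q∣≡∣q-p∣ q p) (∣p∣-∣q∣≤∣p-q∣ q p))

  Bounded : (ℕ → ℚ) → Set
  Bounded u = Σ[ B ∈ ℚ ] (0ℚ ℚ.< B × ∃[ N ] (∀ n → N ℕ.≤ n → ℚ.∣ u n ∣ ℚ.< B))

  eventually-bounded : ∀ {u} → Cauchy u → Bounded u
  eventually-bounded {u} c with c 1ℚ (ℚ.positive⁻¹ 1ℚ)
  ... | N , close = ℚ.∣ u N ∣ ℚ.+ 1ℚ
    , ℚ.+-mono-≤-< (ℚ.0≤∣p∣ (u N)) (ℚ.positive⁻¹ 1ℚ)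
    , N , λ n N≤n → ℚ.≤-<-trans (∣p∣≤∣q∣+∣p-q∣ (u n) (u N))
        (ℚ.+-monoʳ-< ℚ.∣ u N ∣ (close n N N≤n ℕ.≤-refl))

  ∣p*q∣≤ : ∀ p q {a b} → ℚ.∣ p ∣ ℚ.< a → ℚ.∣ q ∣ ℚ.< b → ℚ.∣ p ℚ.* q ∣ ℚ.≤ a ℚ.* b
  ∣p*q∣≤ p q {a} {b} p<a q<b = ≤-respˡ (sym (ℚ.∣p*q∣≡∣p∣*∣q∣ p q))
    (ℚ.≤-trans
      (ℚ.*-monoˡ-≤-nonNeg ℚ.∣ p ∣ {{ℚ.∣-∣-nonNeg p}} (ℚ.<⇒≤ q<b))
      (ℚ.*-monoʳ-≤-nonNeg b {{ℚ.nonNegative (ℚ.≤-trans (ℚ.0≤∣p∣ q) (ℚ.<⇒≤ q<b))}} (ℚ.<⇒≤ p<a)))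

  const-cauchy : ∀ q → Cauchy (λ _ → q)
  const-cauchy q ε 0<ε = 0 , λ _ _ _ _ → <-respˡ (sym (cong ℚ.∣_∣ (ℚ.+-inverseʳ q))) 0<ε

  neg-cauchy : ∀ {u} → Cauchy u → Cauchy (λ n → ℚ.- u n)
  neg-cauchy {u} c ε 0<ε with c ε 0<ε
  ... | N , close = N , λ m n N≤m N≤n → <-respˡ
    (trans (∣p-q∣≡∣q-p∣ (u m) (u n)) (cong ℚ.∣_∣ (ring₄ (u m) (u n))))
    (close m n N≤m N≤n)

  abs-cauchy : ∀ {u} → Cauchy u → Cauchy (λ n → ℚ.∣ u n ∣)
  abs-cauchy {u} c ε 0<ε with c ε 0<ε
  ... | N , close = N , λ m n N≤m N≤n →
    ℚ.≤-<-trans (∣∣p∣-∣q∣∣≤∣p-q∣ (u m) (u n)) (close m n N≤m N≤n)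

  +-cauchy : ∀ {u v} → Cauchy u → Cauchy v → Cauchy (λ n → u n ℚ.+ v n)
  +-cauchy {u} {v} c d ε 0<ε with c (half ε) (half-pos 0<ε) | d (half ε) (half-pos 0<ε)
  ... | M , closeᵤ | N , closeᵥ = M ℕ.⊔ N , λ m n h k →
    subst (ℚ.∣ (u m ℚ.+ v m) ℚ.- (u n ℚ.+ v n) ∣ ℚ.<_) (half+half ε)
      (ℚ.≤-<-trans
        (≤-respˡ (cong ℚ.∣_∣ (ring₅ (u m) (u n) (v m) (v n)))
          (ℚ.∣p+q∣≤∣p∣+∣q∣ (u m ℚ.- u n) (v m ℚ.- v n)))
        (ℚ.+-mono-<
          (closeᵤ m n (ℕ.m⊔n≤o⇒m≤o M N h) (ℕ.m⊔n≤o⇒m≤o M N k))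
          (closeᵥ m n (ℕ.m⊔n≤o⇒n≤o M N h) (ℕ.m⊔n≤o⇒n≤o M N k))))

  has-reciprocal : ∀ S T → ℚ.Positive T → S ℚ.* T ≡ 1ℚ →
    Σ[ T ∈ ℚ ] (ℚ.Positive T × S ℚ.* T ≡ 1ℚ)
  has-reciprocal S T T-pos ST≡1 = T , T-pos , ST≡1

  reciprocal : ∀ S → .(p : ℚ.Positive S) → Σ[ T ∈ ℚ ] (ℚ.Positive T × S ℚ.* T ≡ 1ℚ)
  reciprocal S p = has-reciprocal S ((ℚ.1/ S) {{ℚ.pos⇒nonZero S {{p}}}})
    (ℚ.1/pos⇒pos S {{p}}) (ℚ.*-inverseʳ S {{ℚ.pos⇒nonZero S {{p}}}})

  divide : ∀ S η → 0ℚ ℚ.< S → 0ℚ ℚ.< η → Σ[ δ ∈ ℚ ] (0ℚ ℚ.< δ × S ℚ.* δ ≡ η)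
  divide S η 0<S 0<η with reciprocal S (ℚ.positive 0<S)
  ... | T , 0<T , ST≡1 = T ℚ.* η
    , <-respˡ (ℚ.*-zeroʳ T) (ℚ.*-monoʳ-<-pos T {{0<T}} 0<η)
    , trans (sym (ℚ.*-assoc S T η)) (trans (cong (ℚ._* η) ST≡1) (ℚ.*-identityˡ η))

  product-close : ∀ a b c d {A B δ} →
    ℚ.∣ a ∣ ℚ.< A → ℚ.∣ d ∣ ℚ.< B → ℚ.∣ a ℚ.- c ∣ ℚ.< δ → ℚ.∣ b ℚ.- d ∣ ℚ.< δ →
    ℚ.∣ a ℚ.* b ℚ.- c ℚ.* d ∣ ℚ.≤ (A ℚ.+ B) ℚ.* δ
  product-close a b c d {A} {B} {δ} a<A d<B ac bd = begin
    ℚ.∣ a ℚ.* b ℚ.- c ℚ.* d ∣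
      ≡⟨ cong ℚ.∣_∣ (ring₆ a b c d) ⟨
    ℚ.∣ a ℚ.* (b ℚ.- d) ℚ.+ d ℚ.* (a ℚ.- c) ∣
      ≤⟨ ℚ.∣p+q∣≤∣p∣+∣q∣ (a ℚ.* (b ℚ.- d)) (d ℚ.* (a ℚ.- c)) ⟩
    ℚ.∣ a ℚ.* (b ℚ.- d) ∣ ℚ.+ ℚ.∣ d ℚ.* (a ℚ.- c) ∣
      ≤⟨ ℚ.+-mono-≤ (∣p*q∣≤ a (b ℚ.- d) a<A bd) (∣p*q∣≤ d (a ℚ.- c) d<B ac) ⟩
    A ℚ.* δ ℚ.+ B ℚ.* δ
      ≡⟨ ℚ.*-distribʳ-+ δ A B ⟨
    (A ℚ.+ B) ℚ.* δ ∎
    where open ℚ.≤-Reasoning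

  Close : (ℕ → ℚ) → ℚ → Set
  Close u ε = ∃[ N ] (∀ m n → N ℕ.≤ m → N ℕ.≤ n → ℚ.∣ u m ℚ.- u n ∣ ℚ.< ε)

  *-close : ∀ {u v A B δ η ε K L} →
    (∀ n → K ℕ.≤ n → ℚ.∣ u n ∣ ℚ.< A) → (∀ n → L ℕ.≤ n → ℚ.∣ v n ∣ ℚ.< B) →
    Close u δ → Close v δ → (A ℚ.+ B) ℚ.* δ ≡ η → η ℚ.< ε →
    Close (λ n → u n ℚ.* v n) ε
  *-close {u} {v} {K = K} {L} boundᵤ boundᵥ (M , closeᵤ) (N , closeᵥ) eq η<ε =
    (K ℕ.⊔ L) ℕ.⊔ (M ℕ.⊔ N) , λ m n h k →
    let KL≤m = ℕ.m⊔n≤o⇒m≤o (K ℕ.⊔ L) (M ℕ.⊔ N) h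
        KL≤n = ℕ.m⊔n≤o⇒m≤o (K ℕ.⊔ L) (M ℕ.⊔ N) k
        MN≤m = ℕ.m⊔n≤o⇒n≤o (K ℕ.⊔ L) (M ℕ.⊔ N) h
        MN≤n = ℕ.m⊔n≤o⇒n≤o (K ℕ.⊔ L) (M ℕ.⊔ N) k
    in ℚ.≤-<-trans
      (≤-respʳ eq (product-close (u m) (v m) (u n) (v n)
        (boundᵤ m (ℕ.m⊔n≤o⇒m≤o K L KL≤m))
        (boundᵥ n (ℕ.m⊔n≤o⇒n≤o K L KL≤n))
        (closeᵤ m n (ℕ.m⊔n≤o⇒m≤o M N MN≤m) (ℕ.m⊔n≤o⇒m≤o M N MN≤n))
        (closeᵥ m n (ℕ.m⊔n≤o⇒n≤o M N MN≤m) (ℕ.m⊔n≤o⇒n≤o M N MN≤n))))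
      η<ε

  *-cauchy : ∀ {u v} → Cauchy u → Cauchy v → Cauchy (λ n → u n ℚ.* v n)
  *-cauchy {u} {v} c d ε 0<ε = step₁ (eventually-bounded c) (eventually-bounded d)
    where
    step₂ : ∀ {A B K L} →
      (∀ n → K ℕ.≤ n → ℚ.∣ u n ∣ ℚ.< A) → (∀ n → L ℕ.≤ n → ℚ.∣ v n ∣ ℚ.< B) →
      Σ[ δ ∈ ℚ ] (0ℚ ℚ.< δ × (A ℚ.+ B) ℚ.* δ ≡ half ε) →
      Close (λ n → u n ℚ.* v n) ε
    step₂ boundᵤ boundᵥ (δ , 0<δ , eq) =
      *-close {u = u} {v = v} boundᵤ boundᵥ (c δ 0<δ) (d δ 0<δ) eq (half<self 0<ε)

    step₁ : Bounded u → Bounded v → Close (λ n → u n ℚ.* v n) ε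
    step₁ (A , 0<A , K , boundᵤ) (B , 0<B , L , boundᵥ) =
      step₂ boundᵤ boundᵥ (divide (A ℚ.+ B) (half ε) (ℚ.+-mono-< 0<A 0<B) (half-pos 0<ε))

open ℚ-Lemmas

infix  8 -_
infixl 7 _*_
infixl 6 _+_ _-_

fromℚ : ℚ → ℝ
fromℚ q = mkℝ (λ _ → q) (const-cauchy q)

fromℕ : ℕ → ℝ
fromℕ n = fromℚ (+ n ℚ./ 1)

0ℝ 1ℝ : ℝ
0ℝ = fromℚ 0ℚ
1ℝ = fromℚ 1ℚ

-_ : ℝ → ℝ
- x = mkℝ (λ n → ℚ.- seq x n) (neg-cauchy {seq x} (cauchy x))

_+_ _-_ _*_ : ℝ → ℝ → ℝ
x + y = mkℝ (λ n → seq x n ℚ.+ seq y n) (+-cauchy {seq x} {seq y} (cauchy x) (cauchy y))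
x - y = x + (- y)
x * y = mkℝ (λ n → seq x n ℚ.* seq y n) (*-cauchy {seq x} {seq y} (cauchy x) (cauchy y))

∣_∣ : ℝ → ℝ
∣ x ∣ = mkℝ (λ n → ℚ.∣ seq x n ∣) (abs-cauchy {seq x} (cauchy x))

infix 4 _⟶_ _⇀_

_⟶_ : (ℕ → ℝ) → ℝ → Set
s ⟶ l = ∀ ε → 0ℚ ℚ.< ε → ∃[ N ] (∀ n → N ℕ.≤ n → ∣ s n - l ∣ < fromℚ ε)

-- Limit of a sequence whose n-th term is computed from auxiliary data D n;
-- it is uniform in the choice of these data.
_⇀_ : {D : ℕ → Set} → (∀ n → D n → ℝ) → ℝ → Set
_⇀_ {D} s l = ∀ ε → 0ℚ ℚ.< ε → ∃[ N ] (∀ n → N ℕ.≤ n → (d : D n) → ∣ s n d - l ∣ < fromℚ ε)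

-- ∑< n f = f 0 + ⋯ + f (n - 1)
∑< : ℕ → (ℕ → ℝ) → ℝ
∑< zero    f = 0ℝ
∑< (suc n) f = ∑< n f + f n

HasSum : (ℕ → ℝ) → ℝ → Set
HasSum f s = (λ n → ∑< n f) ⟶ s

-- The integer part of a non-negative real exists and is unique classically
-- (see ¬¬-floor and floor-unique), but is not a computable function ℝ → ℕ.
-- It is therefore passed around as a value together with its defining property.
record Floor (x : ℝ) : Set where
  field
    value : ℕ
    lower : fromℕ value ≤ x
    upper : x < fromℕ (suc value)

open Floor public

module ℝ-Lemmas where
  ≤⇒≯ : ∀ x y → x ≤ y → ¬ (y < x)
  ≤⇒≯ x y x≤y (ε , 0<ε , N , y+ε≤x) with x≤y (half ε) (half-pos 0<ε)
  ... | M , x≤y+ε/2 = ℚ.<-irrefl refl (begin-strict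
      seq y k ℚ.+ half ε  <⟨ ℚ.+-monoʳ-< (seq y k) (half<self 0<ε) ⟩
      seq y k ℚ.+ ε       ≤⟨ y+ε≤x k (ℕ.m≤m⊔n N M) ⟩
      seq x k             ≤⟨ x≤y+ε/2 k (ℕ.m≤n⊔m N M) ⟩
      seq y k ℚ.+ half ε  ∎)
    where
    open ℚ.≤-Reasoning
    k = N ℕ.⊔ M

  ≮⇒≥ : ∀ x y → ¬ (x < y) → y ≤ x
  ≮⇒≥ x y x≮y ε 0<ε = K ℕ.⊔ L , bound
    where
    open ℚ.≤-Reasoning
    η = half ε
    δ = half η
    0<η = half-pos 0<ε
    0<δ = half-pos 0<η
    K = proj₁ (cauchy x δ 0<δ)
    L = proj₁ (cauchy y δ 0<δ)
    closeₓ = proj₂ (cauchy x δ 0<δ)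
    closeᵧ = proj₂ (cauchy y δ 0<δ)
    bound : ∀ n → K ℕ.⊔ L ℕ.≤ n → seq y n ℚ.≤ seq x n ℚ.+ ε
    bound n KL≤n with seq y n ℚ.≤? seq x n ℚ.+ ε
    ... | yes y≤x+ε = y≤x+ε
    ... | no  y≰x+ε = contradiction (η , 0<η , K ℕ.⊔ L , gap) x≮y
      where
      gap : ∀ m → K ℕ.⊔ L ℕ.≤ m → seq x m ℚ.+ η ℚ.≤ seq y m
      gap m KL≤m = begin
        seq x m ℚ.+ η
          ≤⟨ ℚ.+-monoˡ-≤ η (ℚ.<⇒≤ (∣p-q∣<ε⇒p<q+ε (seq x m) (seq x n)
               (closeₓ m n (ℕ.m⊔n≤o⇒m≤o K L KL≤m) (ℕ.m⊔n≤o⇒m≤o K L KL≤n)))) ⟩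
        seq x n ℚ.+ δ ℚ.+ η
          ≡⟨ ring₇ (seq x n) δ η ⟩
        seq x n ℚ.+ (η ℚ.+ (δ ℚ.+ δ)) ℚ.- δ
          ≡⟨ cong (λ r → seq x n ℚ.+ r ℚ.- δ) (trans (cong (η ℚ.+_) (half+half η)) (half+half ε)) ⟩
        seq x n ℚ.+ ε ℚ.- δ
          ≤⟨ ℚ.+-monoˡ-≤ (ℚ.- δ) (ℚ.<⇒≤ (ℚ.≰⇒> y≰x+ε)) ⟩
        seq y n ℚ.- δ
          ≤⟨ ℚ.+-monoˡ-≤ (ℚ.- δ) (ℚ.<⇒≤ (∣p-q∣<ε⇒p<q+ε (seq y n) (seq y m)
               (closeᵧ n m (ℕ.m⊔n≤o⇒n≤o K L KL≤n) (ℕ.m⊔n≤o⇒n≤o K L KL≤m)))) ⟩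
        seq y m ℚ.+ δ ℚ.- δ
          ≡⟨ ring₈ (seq y m) δ ⟩
        seq y m ∎

  /1-mono-≤ : ∀ {m n} → m ℕ.≤ n → (+ m ℚ./ 1) ℚ.≤ (+ n ℚ./ 1)
  /1-mono-≤ {m} {n} m≤n = ℚ.toℚᵘ-cancel-≤
    (ℚᵘ.≤-trans (ℚᵘ.≤-reflexive (ℚ.toℚᵘ-fromℚᵘ (+ m ℚᵘ./ 1)))
    (ℚᵘ.≤-trans (ℚᵘ.*≤* (ℤ.*-monoʳ-≤-nonNeg (+ 1) (ℤ.+≤+ m≤n)))
                (ℚᵘ.≤-reflexive (ℚᵘ.≃-sym (ℚ.toℚᵘ-fromℚᵘ (+ n ℚᵘ./ 1))))))

  archimedean : ∀ q → ∃[ n ] q ℚ.≤ (+ n ℚ./ 1)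
  archimedean q@(mkℚ z d-1 _) = ℤ.∣ z ∣ , ℚ.toℚᵘ-cancel-≤
    (ℚᵘ.≤-trans (ℚᵘ.*≤* (bound z))
                (ℚᵘ.≤-reflexive (ℚᵘ.≃-sym (ℚ.toℚᵘ-fromℚᵘ (+ ℤ.∣ z ∣ ℚᵘ./ 1)))))
    where
    bound : ∀ z → z ℤ.* + 1 ℤ.≤ + ℤ.∣ z ∣ ℤ.* + suc d-1
    bound (+ n)      = subst₂ ℤ._≤_ (ℤ.pos-* n 1) (ℤ.pos-* n (suc d-1))
      (ℤ.+≤+ (ℕ.*-monoʳ-≤ n (ℕ.s≤s ℕ.z≤n)))
    bound ℤ.-[1+ n ] = ℤ.-≤+

  fromℕ-mono-≤ : ∀ {m n} → m ℕ.≤ n → fromℕ m ≤ fromℕ n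
  fromℕ-mono-≤ {m} {n} m≤n ε 0<ε = 0 , λ _ _ → ℚ.≤-trans (/1-mono-≤ m≤n)
    (≤-respˡ (ℚ.+-identityʳ (+ n ℚ./ 1)) (ℚ.+-monoʳ-≤ (+ n ℚ./ 1) (ℚ.<⇒≤ 0<ε)))

  ≤-<-trans : ∀ x y z → x ≤ y → y < z → x < z
  ≤-<-trans x y z x≤y (ε , 0<ε , N , y+ε≤z) with x≤y (half ε) (half-pos 0<ε)
  ... | M , x≤y+ε/2 = half ε , half-pos 0<ε , N ℕ.⊔ M , λ n h → begin
      seq x n ℚ.+ half ε
        ≤⟨ ℚ.+-monoˡ-≤ (half ε) (x≤y+ε/2 n (ℕ.m⊔n≤o⇒n≤o N M h)) ⟩
      seq y n ℚ.+ half ε ℚ.+ half ε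
        ≡⟨ trans (ℚ.+-assoc (seq y n) (half ε) (half ε)) (cong (seq y n ℚ.+_) (half+half ε)) ⟩
      seq y n ℚ.+ ε
        ≤⟨ y+ε≤z n (ℕ.m⊔n≤o⇒m≤o N M h) ⟩
      seq z n ∎
    where open ℚ.≤-Reasoning

  below-some-ℕ : ∀ x → ∃[ n ] x < fromℕ n
  below-some-ℕ x = from-bound (eventually-bounded (cauchy x))
    where
    from-ℕ-bound : ∀ {B N} → (∀ n → N ℕ.≤ n → ℚ.∣ seq x n ∣ ℚ.< B) →
      ∃[ n ] B ℚ.+ 1ℚ ℚ.≤ (+ n ℚ./ 1) → ∃[ n ] x < fromℕ n
    from-ℕ-bound {B} {N} bound (n , B+1≤n) = n , 1ℚ , ℚ.positive⁻¹ 1ℚ , N , λ k N≤k →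
      ℚ.≤-trans
        (ℚ.+-monoˡ-≤ 1ℚ (ℚ.≤-trans (p≤∣p∣ (seq x k)) (ℚ.<⇒≤ (bound k N≤k)))) B+1≤n
    from-bound : Bounded (seq x) → ∃[ n ] x < fromℕ n
    from-bound (B , _ , N , bound) = from-ℕ-bound bound (archimedean (B ℚ.+ 1ℚ))

open ℝ-Lemmas

floor-unique : ∀ x (⌊x⌋ ⌊x⌋′ : Floor x) → value ⌊x⌋ ≡ value ⌊x⌋′
floor-unique x f g = ℕ.≤-antisym (below f g) (below g f)
  where
  below : ∀ (f g : Floor x) → value f ℕ.≤ value g
  below f g with value f ℕ.≤? value g
  ... | yes f≤g = f≤g
  ... | no  f≰g = contradiction
    (≤-<-trans (fromℕ (value f)) x (fromℕ (suc (value g))) (lower f) (upper g))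
    (≤⇒≯ (fromℕ (suc (value g))) (fromℕ (value f)) (fromℕ-mono-≤ (ℕ.≰⇒> f≰g)))

¬¬-floor : ∀ x → 0ℝ ≤ x → ¬ ¬ Floor x
¬¬-floor x 0≤x no-floor = impossible (below-some-ℕ x)
  where
  all-below : ∀ n → fromℕ n ≤ x
  all-below zero    = 0≤x
  all-below (suc n) = ≮⇒≥ x (fromℕ (suc n)) λ x<1+n →
    no-floor record { value = n ; lower = all-below n ; upper = x<1+n }
  impossible : ¬ (∃[ n ] x < fromℕ n)
  impossible (n , x<n) = ≤⇒≯ (fromℕ n) x (all-below n) x<n

-- |v|_w, the number of i with 0 ≤ i < |v| + 1 - |w| such that w occurs in v
-- immediately after the first i letters.
occurrences : ∀ {b} → List (Fin b) → List (Fin b) → ℕ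
occurrences v w = length
  (filter (λ i → ≡-dec Fin._≟_ (take (length w) (drop i v)) w)
          (upTo (suc (length v) ℕ.∸ length w)))

words : ∀ b k → List (Vec (Fin b) k)
words b zero    = Vec.[] ∷ []
words b (suc k) = cartesianProductWith Vec._∷_ (allFin b) (words b k)

-- #{w ∈ Ω^k : |v|_w = i}
wordsOccurring : ∀ {b} (i k : ℕ) → List (Fin b) → ℕ
wordsOccurring {b} i k v =
  length (filter (λ w → occurrences v (toList w) ℕ.≟ i) (words b k))

-- An infinite sequence is a function x whose value x n is the letter at
-- position n + 1, so that x[1…L] is applyUpTo x L.  The value at k = 0 has no
-- meaning; it does not affect the limit k → ∞.
Z : ∀ {b} .{{_ : NonTrivial b}} (lam : ℝ) (i : ℕ) (x : ℕ → Fin b) (k : ℕ) →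
    Floor (lam * fromℕ (b ℕ.^ k)) → ℝ
Z {b} lam i x k ⌊λbᵏ⌋ =
  fromℚ (+ wordsOccurring i k (applyUpTo x (value ⌊λbᵏ⌋ ℕ.+ k ℕ.∸ 1)) ℚ./ (b ℕ.^ k))
  where
  instance
    bᵏ-nonZero : NonZero (b ℕ.^ k)
    bᵏ-nonZero = ℕ.m^n≢0 b k {{nonTrivial⇒nonZero b}}

{-# OPTIONS --safe #-}
module Submission where

-- There is an infinite word y whose prefix of length b^k (of length b^k / 2 if
-- b = 2) contains every word of length k at most once, for all k ≥ 1: a cyclic
-- de Bruijn word of order k is extended to one of order k + 1 (of order k + 2
-- if b = 2) by an Eulerian circuit of the complementary edges of the de Bruijn
-- graph.  These edges are connected: any two vertices c w and c′ w share an
-- unused successor w a, and every vertex w a has an unused predecessor.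
--
-- Stage k of x takes the next letters of y, for each multiplicity r ≤ k so many
-- that about p_r b^k letters of y have been taken with multiplicity r in all,
-- and appends the segment of y found in this way r times.  This is possible
-- since the p_r with r ≥ 1 add up to 1 - p_0, which is at most 1/2 if b = 2.
-- After stage k the length of x is about b^k ∑ r p_r = λ b^k, and apart from
-- O(k^4) windows across the ends of segments a word of length k occurs in x as
-- often as the multiplicity of the segment that contains it.

-- At a skipped order only the order below controls repetitions, which is the origin of the factor
-- 1/2. Nothing is placed for multiplicity 0: its words are those left over, and their share is
-- found as a complement. Reals have no computable integer part, so the numbers of letters are known
-- only up to 3 and are made monotone in k by maxima. Counts are compared through totals: if one
-- function on words lies below another and their totals differ by at most e, they agree outside at
-- most e words. With at most k^2 segments, at most k copies of each and at most k windows lost per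
-- copy, the error is negligible against b^k.

module Combinatorics where

  import Data.Fin.Properties as Fin
  open import Data.Bool.Base using (if_then_else_; _∧_)
  open import Data.Fin.Base using (Fin; zero; suc)
  open import Data.List.Base hiding (sum)
  open import Data.List.Properties hiding (sum-++)
  open import Data.List.Membership.Propositional using (_∈_)
  open import Data.List.Membership.Propositional.Properties using (∈-allFin)
  open import Data.List.Relation.Unary.Any using (here; there)
  open import Data.Nat.Base hiding (_/_; _%_)
  open import Data.Nat.Properties
  open import Data.Nat.DivMod using (_/_; _%_; m/n*n≤m; m≡m%n+[m/n]*n; m%n<n)
  open import Data.Nat.Tactic.RingSolver using (solve-∀)
  open import Data.Product.Base using (Σ-syntax; ∃-syntax; _×_; _,_; proj₁; proj₂)
  open import Data.Sum.Base using (_⊎_; inj₁; inj₂)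
  open import Data.Vec.Base as Vec using (toList)
  open import Data.Vec.Properties using (length-toList)
  open import Defs using (words; occurrences; wordsOccurring)
  open import Function.Base using (_∘_; id)
  open import Relation.Binary.PropositionalEquality
  open import Relation.Nullary using (¬_; Dec; yes; no; does; contradiction)
  open import Relation.Nullary.Decidable using (dec-true; dec-false; _×-dec_)

  -- Finite sums of natural numbers and indicators

  ∑ : ∀ {A : Set} → List A → (A → ℕ) → ℕ
  ∑ []       f = 0
  ∑ (x ∷ xs) f = f x + ∑ xs f

  module _ {A : Set} where

    ∑-cong : ∀ (xs : List A) {f g : A → ℕ} → (∀ x → f x ≡ g x) → ∑ xs f ≡ ∑ xs g
    ∑-cong []       f≗g = refl
    ∑-cong (x ∷ xs) f≗g = cong₂ _+_ (f≗g x) (∑-cong xs f≗g)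

    ∑-mono : ∀ (xs : List A) {f g : A → ℕ} → (∀ x → f x ≤ g x) → ∑ xs f ≤ ∑ xs g
    ∑-mono []       f≤g = z≤n
    ∑-mono (x ∷ xs) f≤g = +-mono-≤ (f≤g x) (∑-mono xs f≤g)

    ∑-+ : ∀ (xs : List A) (f g : A → ℕ) → ∑ xs (λ x → f x + g x) ≡ ∑ xs f + ∑ xs g
    ∑-+ []       f g = refl
    ∑-+ (x ∷ xs) f g = trans (cong (f x + g x +_) (∑-+ xs f g)) (lemma (f x) (g x) _ _)
      where
      lemma : ∀ a b c d → a + b + (c + d) ≡ a + c + (b + d)
      lemma = solve-∀

    ∑-*ˡ : ∀ (xs : List A) c (f : A → ℕ) → ∑ xs (λ x → c * f x) ≡ c * ∑ xs f
    ∑-*ˡ []       c f = sym (*-zeroʳ c)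
    ∑-*ˡ (x ∷ xs) c f = trans (cong (c * f x +_) (∑-*ˡ xs c f)) (sym (*-distribˡ-+ c (f x) _))

    ∑-const : ∀ (xs : List A) c → ∑ xs (λ _ → c) ≡ length xs * c
    ∑-const []       c = refl
    ∑-const (x ∷ xs) c = cong (c +_) (∑-const xs c)

    ∑-++ : ∀ (xs ys : List A) (f : A → ℕ) → ∑ (xs ++ ys) f ≡ ∑ xs f + ∑ ys f
    ∑-++ []       ys f = refl
    ∑-++ (x ∷ xs) ys f = trans (cong (f x +_) (∑-++ xs ys f)) (sym (+-assoc (f x) _ _))

    ∑-∈ : ∀ {xs : List A} {x} (f : A → ℕ) → x ∈ xs → f x ≤ ∑ xs f
    ∑-∈ f (here refl) = m≤m+n _ _
    ∑-∈ f (there x∈xs) = ≤-trans (∑-∈ f x∈xs) (m≤n+m _ _)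

    -- A pigeonhole with a witness: too few units to reach every entry. It produces the free letters
    -- in `sibling` and `source`.
    ∑<length⇒∃≡0 : ∀ (xs : List A) (f : A → ℕ) → ∑ xs f < length xs → ∃[ x ] f x ≡ 0
    ∑<length⇒∃≡0 (x ∷ xs) f lt with f x in eq
    ... | zero  = x , eq
    ... | suc n = ∑<length⇒∃≡0 xs f (≤-trans (s≤s (m≤n+m _ n)) (s≤s⁻¹ lt))

    ∑≤length : ∀ (xs : List A) {f : A → ℕ} → (∀ x → f x ≤ 1) → ∑ xs f ≤ length xs
    ∑≤length xs f≤1 = ≤-trans (∑-mono xs f≤1) (≤-reflexive (trans (∑-const xs 1) (*-identityʳ _)))

    length≤∑ : ∀ (xs : List A) {f : A → ℕ} → (∀ x → 1 ≤ f x) → length xs ≤ ∑ xs f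
    length≤∑ xs 1≤f = ≤-trans (≤-reflexive (sym (trans (∑-const xs 1) (*-identityʳ _)))) (∑-mono xs 1≤f)

    length≤∑⇒1≤ : ∀ {xs : List A} {x} {f : A → ℕ} → (∀ y → f y ≤ 1) → length xs ≤ ∑ xs f → x ∈ xs → 1 ≤ f x
    length≤∑⇒1≤ {f = f} f≤1 h (here {x = y} {xs} refl) with f y in eq
    ... | zero  = contradiction (≤-trans h (∑≤length xs f≤1)) (<⇒≱ (n<1+n _))
    ... | suc _ = s≤s z≤n
    length≤∑⇒1≤ {f = f} f≤1 h (there {x = y} {xs} x∈xs) =
      length≤∑⇒1≤ f≤1 (s≤s⁻¹ (≤-trans h (+-monoˡ-≤ (∑ xs f) (f≤1 y)))) x∈xs

  ∑-map : ∀ {A B : Set} (g : A → B) (xs : List A) (f : B → ℕ) → ∑ (map g xs) f ≡ ∑ xs (f ∘ g)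
  ∑-map g []       f = refl
  ∑-map g (x ∷ xs) f = cong (f (g x) +_) (∑-map g xs f)

  ∑-swap : ∀ {A B : Set} (xs : List A) (ys : List B) (f : A → B → ℕ) →
    ∑ xs (λ x → ∑ ys (f x)) ≡ ∑ ys (λ y → ∑ xs (λ x → f x y))
  ∑-swap []       ys f = sym (trans (∑-const ys 0) (*-zeroʳ (length ys)))
  ∑-swap (x ∷ xs) ys f = trans (cong (∑ ys (f x) +_) (∑-swap xs ys f)) (sym (∑-+ ys (f x) _))

  ∑-cartesian : ∀ {A B C : Set} (g : A → B → C) xs ys (f : C → ℕ) →
    ∑ (cartesianProductWith g xs ys) f ≡ ∑ xs (λ x → ∑ ys (λ y → f (g x y)))
  ∑-cartesian g []       ys f = refl
  ∑-cartesian g (x ∷ xs) ys f = trans (∑-++ (map (g x) ys) _ f)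
    (cong₂ _+_ (∑-map (g x) ys f) (∑-cartesian g xs ys f))

  ⟦_⟧ : ∀ {P : Set} → Dec P → ℕ
  ⟦ d ⟧ = if does d then 1 else 0

  ⟦⟧-yes : ∀ {P : Set} (d : Dec P) → P → ⟦ d ⟧ ≡ 1
  ⟦⟧-yes d p = cong (if_then 1 else 0) (dec-true d p)

  ⟦⟧-no : ∀ {P : Set} (d : Dec P) → ¬ P → ⟦ d ⟧ ≡ 0
  ⟦⟧-no d ¬p = cong (if_then 1 else 0) (dec-false d ¬p)

  ⟦⟧≤1 : ∀ {P : Set} (d : Dec P) → ⟦ d ⟧ ≤ 1
  ⟦⟧≤1 (yes _) = s≤s z≤n
  ⟦⟧≤1 (no _)  = z≤n

  length-filter≡∑ : ∀ {A : Set} {P : A → Set} (P? : ∀ x → Dec (P x)) xs →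
    length (filter P? xs) ≡ ∑ xs (λ x → ⟦ P? x ⟧)
  length-filter≡∑ P? []       = refl
  length-filter≡∑ P? (x ∷ xs) with P? x
  ... | yes _ = cong suc (length-filter≡∑ P? xs)
  ... | no  _ = length-filter≡∑ P? xs

  ∑-allFin : ∀ n (f : Fin (suc n) → ℕ) → ∑ (allFin (suc n)) f ≡ f zero + ∑ (allFin n) (f ∘ suc)
  ∑-allFin n f = cong (f zero +_)
    (trans (cong (λ xs → ∑ xs f) (sym (map-tabulate id suc))) (∑-map suc (allFin n) f))

  ∑-≟ : ∀ {n} (c : Fin n) → ∑ (allFin n) (λ a → ⟦ a Fin.≟ c ⟧) ≡ 1
  ∑-≟ {suc n} zero    = trans (∑-allFin n (λ a → ⟦ a Fin.≟ zero ⟧)) (cong suc (trans (∑-const (allFin n) 0) (*-zeroʳ (length (allFin n)))))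
  ∑-≟ {suc n} (suc c) = trans (∑-allFin n (λ a → ⟦ a Fin.≟ suc c ⟧)) (∑-≟ c)

  length-allFin : ∀ n → length (allFin n) ≡ n
  length-allFin n = length-tabulate id

  -- Occurrences of words

  Word : ℕ → Set
  Word b = List (Fin b)

  module _ {b : ℕ} where

    letters : List (Fin b)
    letters = allFin b

    -- Indicators with values in ℕ, for being a prefix and for equality. Numbers instead of
    -- decisions turn the degree conditions of the de Bruijn graph into identities between sums.
    pre eqʷ : Word b → Word b → ℕ
    pre []      u       = 1
    pre (a ∷ w) []      = 0
    pre (a ∷ w) (c ∷ u) = ⟦ a Fin.≟ c ⟧ * pre w u

    eqʷ []      []      = 1
    eqʷ []      (c ∷ u) = 0
    eqʷ (a ∷ w) []      = 0
    eqʷ (a ∷ w) (c ∷ u) = ⟦ a Fin.≟ c ⟧ * eqʷ w u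

    -- Both run over all tails of the text, the empty one included. At most one tail has the length
    -- of the word sought, so `suf` is again an indicator, that of a suffix.
    suf occ : Word b → Word b → ℕ
    suf w []      = eqʷ w []
    suf w (c ∷ u) = eqʷ w (c ∷ u) + suf w u

    occ w []      = pre w []
    occ w (c ∷ u) = pre w (c ∷ u) + occ w u

    Σʷ : ℕ → (Word b → ℕ) → ℕ
    Σʷ k f = ∑ (words b k) (f ∘ toList)

    length-∷ʳ : ∀ (u : Word b) a → length (u ∷ʳ a) ≡ suc (length u)
    length-∷ʳ u a = trans (length-++ u) (+-comm (length u) 1)

    private
      δ*⁻¹ : ∀ (a c : Fin b) {n} → 1 ≤ ⟦ a Fin.≟ c ⟧ * n → a ≡ c × 1 ≤ n
      δ*⁻¹ a c {n} h with a Fin.≟ c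
      ... | yes a≡c = a≡c , ≤-trans h (≤-reflexive (+-identityʳ n))

      δ-refl* : ∀ (a : Fin b) n → ⟦ a Fin.≟ a ⟧ * n ≡ n
      δ-refl* a n = trans (cong (_* n) (⟦⟧-yes (a Fin.≟ a) refl)) (*-identityˡ n)

    ∑-δ* : ∀ (c : Fin b) n → ∑ letters (λ a → ⟦ a Fin.≟ c ⟧ * n) ≡ n
    ∑-δ* c n = begin
      ∑ letters (λ a → ⟦ a Fin.≟ c ⟧ * n)   ≡⟨ ∑-cong letters (λ a → *-comm _ n) ⟩
      ∑ letters (λ a → n * ⟦ a Fin.≟ c ⟧)   ≡⟨ ∑-*ˡ letters n _ ⟩
      n * ∑ letters (λ a → ⟦ a Fin.≟ c ⟧)   ≡⟨ cong (n *_) (∑-≟ c) ⟩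
      n * 1                                 ≡⟨ *-identityʳ n ⟩
      n                                     ∎
      where open ≡-Reasoning

    eqʷ-refl : ∀ u → eqʷ u u ≡ 1
    eqʷ-refl []      = refl
    eqʷ-refl (a ∷ u) = trans (δ-refl* a _) (eqʷ-refl u)

    eqʷ⁻¹ : ∀ u v → 1 ≤ eqʷ u v → u ≡ v
    eqʷ⁻¹ []      []      _ = refl
    eqʷ⁻¹ (a ∷ u) (c ∷ v) h with δ*⁻¹ a c {eqʷ u v} h
    ... | refl , h′ = cong (a ∷_) (eqʷ⁻¹ u v h′)

    eqʷ-short : ∀ u v → length v < length u → eqʷ u v ≡ 0
    eqʷ-short (a ∷ u) []      _ = refl
    eqʷ-short (a ∷ u) (c ∷ v) h = trans (cong (⟦ a Fin.≟ c ⟧ *_) (eqʷ-short u v (s≤s⁻¹ h))) (*-zeroʳ ⟦ a Fin.≟ c ⟧)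

    eqʷ-long : ∀ u v → length u < length v → eqʷ u v ≡ 0
    eqʷ-long []      (c ∷ v) h = refl
    eqʷ-long (a ∷ u) (c ∷ v) h = trans (cong (⟦ a Fin.≟ c ⟧ *_) (eqʷ-long u v (s≤s⁻¹ h))) (*-zeroʳ ⟦ a Fin.≟ c ⟧)

    pre≡eqʷ : ∀ u v → length u ≡ length v → pre u v ≡ eqʷ u v
    pre≡eqʷ []      []      _ = refl
    pre≡eqʷ (a ∷ u) (c ∷ v) h = cong (⟦ a Fin.≟ c ⟧ *_) (pre≡eqʷ u v (suc-injective h))

    pre-++ : ∀ w s t → length w ≤ length s → pre w (s ++ t) ≡ pre w s
    pre-++ []      s       t h = refl
    pre-++ (a ∷ w) (c ∷ s) t h = cong (⟦ a Fin.≟ c ⟧ *_) (pre-++ w s t (s≤s⁻¹ h))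

    pre-++-≤ : ∀ w s t → pre w s ≤ pre w (s ++ t)
    pre-++-≤ []      s       t = ≤-refl
    pre-++-≤ (a ∷ w) []      t = z≤n
    pre-++-≤ (a ∷ w) (c ∷ s) t = *-monoʳ-≤ ⟦ a Fin.≟ c ⟧ (pre-++-≤ w s t)

    pre-short : ∀ w s → length s < length w → pre w s ≡ 0
    pre-short (a ∷ w) []      h = refl
    pre-short (a ∷ w) (c ∷ s) h = trans (cong (⟦ a Fin.≟ c ⟧ *_) (pre-short w s (s≤s⁻¹ h))) (*-zeroʳ ⟦ a Fin.≟ c ⟧)

    pre-self : ∀ w t → pre w (w ++ t) ≡ 1
    pre-self []      t = refl
    pre-self (a ∷ w) t = trans (δ-refl* a _) (pre-self w t)

    pre⁻¹ : ∀ w s → 1 ≤ pre w s → ∃[ t ] s ≡ w ++ t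
    pre⁻¹ []      s       _ = s , refl
    pre⁻¹ (a ∷ w) (c ∷ s) h with δ*⁻¹ a c {pre w s} h
    ... | refl , h′ with pre⁻¹ w s h′
    ... | t , eq = t , cong (a ∷_) eq

    suf-short : ∀ u v → length v < length u → suf u v ≡ 0
    suf-short u []      h = eqʷ-short u [] h
    suf-short u (c ∷ v) h = cong₂ _+_ (eqʷ-short u (c ∷ v) h) (suf-short u v (<-trans (n<1+n _) h))

    suf≡eqʷ : ∀ u v → length u ≡ length v → suf u v ≡ eqʷ u v
    suf≡eqʷ u []      h = refl
    suf≡eqʷ u (c ∷ v) h = trans (cong (eqʷ u (c ∷ v) +_) (suf-short u v (≤-reflexive (sym h)))) (+-identityʳ _)

    suf-++ : ∀ u s t → length u ≤ length t → suf u (s ++ t) ≡ suf u t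
    suf-++ u []      t h = refl
    suf-++ u (c ∷ s) t h = cong₂ _+_
      (eqʷ-long u (c ∷ s ++ t) (s≤s (≤-trans h (≤-trans (m≤n+m _ (length s)) (≤-reflexive (sym (length-++ s)))))))
      (suf-++ u s t h)

    suf-self : ∀ s u → suf u (s ++ u) ≡ 1
    suf-self s u = trans (suf-++ u s u ≤-refl) (trans (suf≡eqʷ u u refl) (eqʷ-refl u))

    suf⁻¹ : ∀ u v → 1 ≤ suf u v → ∃[ s ] v ≡ s ++ u
    suf⁻¹ u [] h = [] , sym (eqʷ⁻¹ u [] h)
    suf⁻¹ u (c ∷ v) h with eqʷ u (c ∷ v) in eq
    ... | suc _ = [] , sym (eqʷ⁻¹ u (c ∷ v) (≤-trans (s≤s z≤n) (≤-reflexive (sym eq))))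
    ... | zero with suf⁻¹ u v h
    ... | s , refl = c ∷ s , refl

    occ⁻¹ : ∀ w u → 1 ≤ occ w u → ∃[ s ] ∃[ t ] u ≡ s ++ w ++ t
    occ⁻¹ w [] h with pre⁻¹ w [] h
    ... | t , eq = [] , t , eq
    occ⁻¹ w (c ∷ u) h with pre w (c ∷ u) in eq
    ... | suc _ with pre⁻¹ w (c ∷ u) (≤-trans (s≤s z≤n) (≤-reflexive (sym eq)))
    ... | t , eq′ = [] , t , eq′
    occ⁻¹ w (c ∷ u) h | zero with occ⁻¹ w u h
    ... | s , t , refl = c ∷ s , t , refl

    pre≤occ : ∀ w u → pre w u ≤ occ w u
    pre≤occ w []      = ≤-refl
    pre≤occ w (c ∷ u) = m≤m+n _ _

    occ-short : ∀ w u → length u < length w → occ w u ≡ 0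
    occ-short w []      h = pre-short w [] h
    occ-short w (c ∷ u) h = cong₂ _+_ (pre-short w (c ∷ u) h) (occ-short w u (<-trans (n<1+n _) h))

    -- Across the seam occurrences can only be gained. The empty word is excluded because the seam
    -- would count it twice on the left.
    occ-superadditive : ∀ w s t → 1 ≤ length w → occ w s + occ w t ≤ occ w (s ++ t)
    occ-superadditive (a ∷ w) []      t h = ≤-refl
    occ-superadditive w       (c ∷ s) t h = begin
      pre w (c ∷ s) + occ w s + occ w t          ≡⟨ +-assoc (pre w (c ∷ s)) _ _ ⟩
      pre w (c ∷ s) + (occ w s + occ w t)        ≤⟨ +-mono-≤ (pre-++-≤ w (c ∷ s) t) (occ-superadditive w s t h) ⟩
      pre w (c ∷ s ++ t) + occ w (s ++ t)        ∎
      where open ≤-Reasoning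

    -- The overlap `v` is one letter shorter than `w`, so a window of length |w| lies in `s ++ v` or
    -- in `v ++ t`, never in both. In graph terms, the edges of a walk through the vertex `v` are
    -- those before it and those after it.
    occ-join : ∀ w s v t → length w ≡ suc (length v) →
      occ w (s ++ v ++ t) ≡ occ w (s ++ v) + occ w (v ++ t)
    occ-join w []      v t h = cong (_+ occ w (v ++ t)) (sym (occ-short w v (≤-reflexive (sym h))))
    occ-join w (c ∷ s) v t h = begin
      pre w (c ∷ s ++ v ++ t) + occ w (s ++ v ++ t)
        ≡⟨ cong₂ _+_ (cong (pre w ∘ (c ∷_)) (sym (++-assoc s v t))) (occ-join w s v t h) ⟩
      pre w (c ∷ (s ++ v) ++ t) + (occ w (s ++ v) + occ w (v ++ t))
        ≡⟨ cong (_+ (occ w (s ++ v) + occ w (v ++ t))) (pre-++ w (c ∷ s ++ v) t bound) ⟩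
      pre w (c ∷ s ++ v) + (occ w (s ++ v) + occ w (v ++ t))
        ≡⟨ +-assoc (pre w (c ∷ s ++ v)) _ _ ⟨
      pre w (c ∷ s ++ v) + occ w (s ++ v) + occ w (v ++ t) ∎
      where
      open ≡-Reasoning
      bound : length w ≤ suc (length (s ++ v))
      bound = ≤-trans (≤-reflexive h) (s≤s (≤-trans (m≤n+m _ (length s)) (≤-reflexive (sym (length-++ s)))))

    ∑-pre-∷ʳ : ∀ u v → ∑ letters (λ a → pre (u ∷ʳ a) v) + eqʷ u v ≡ pre u v
    ∑-pre-∷ʳ []      []      = cong (_+ 1) (trans (∑-const letters 0) (*-zeroʳ (length letters)))
    ∑-pre-∷ʳ []      (c ∷ v) = trans (+-identityʳ _) (∑-δ* c 1)
    ∑-pre-∷ʳ (d ∷ u) []      = cong (_+ 0) (trans (∑-const letters 0) (*-zeroʳ (length letters)))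
    ∑-pre-∷ʳ (d ∷ u) (c ∷ v) = begin
      ∑ letters (λ a → ⟦ d Fin.≟ c ⟧ * pre (u ∷ʳ a) v) + ⟦ d Fin.≟ c ⟧ * eqʷ u v
        ≡⟨ cong (_+ ⟦ d Fin.≟ c ⟧ * eqʷ u v) (∑-*ˡ letters ⟦ d Fin.≟ c ⟧ _) ⟩
      ⟦ d Fin.≟ c ⟧ * ∑ letters (λ a → pre (u ∷ʳ a) v) + ⟦ d Fin.≟ c ⟧ * eqʷ u v
        ≡⟨ *-distribˡ-+ ⟦ d Fin.≟ c ⟧ _ _ ⟨
      ⟦ d Fin.≟ c ⟧ * (∑ letters (λ a → pre (u ∷ʳ a) v) + eqʷ u v)
        ≡⟨ cong (⟦ d Fin.≟ c ⟧ *_) (∑-pre-∷ʳ u v) ⟩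
      ⟦ d Fin.≟ c ⟧ * pre u v ∎
      where open ≡-Reasoning

    private
      interchange : ∀ a c d e → a + c + (d + e) ≡ a + d + (c + e)
      interchange = solve-∀

    -- Every visit of a walk at the vertex `u` leaves by exactly one edge, except a visit at the
    -- very end. With `balanceˡ` this is the degree balance of a walk.
    balanceʳ : ∀ u v → ∑ letters (λ a → occ (u ∷ʳ a) v) + suf u v ≡ occ u v
    balanceʳ u []      = ∑-pre-∷ʳ u []
    balanceʳ u (c ∷ v) = begin
      ∑ letters (λ a → pre (u ∷ʳ a) (c ∷ v) + occ (u ∷ʳ a) v) + (eqʷ u (c ∷ v) + suf u v)
        ≡⟨ cong (_+ (eqʷ u (c ∷ v) + suf u v)) (∑-+ letters _ _) ⟩
      ∑ letters (λ a → pre (u ∷ʳ a) (c ∷ v)) + ∑ letters (λ a → occ (u ∷ʳ a) v) + (eqʷ u (c ∷ v) + suf u v)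
        ≡⟨ interchange (∑ letters (λ a → pre (u ∷ʳ a) (c ∷ v))) _ _ _ ⟩
      ∑ letters (λ a → pre (u ∷ʳ a) (c ∷ v)) + eqʷ u (c ∷ v) + (∑ letters (λ a → occ (u ∷ʳ a) v) + suf u v)
        ≡⟨ cong₂ _+_ (∑-pre-∷ʳ u (c ∷ v)) (balanceʳ u v) ⟩
      pre u (c ∷ v) + occ u v ∎
      where open ≡-Reasoning

    balanceˡ : ∀ u v → ∑ letters (λ a → occ (a ∷ u) v) + pre u v ≡ occ u v
    balanceˡ u []      = cong (_+ pre u []) (trans (∑-const letters 0) (*-zeroʳ (length letters)))
    balanceˡ u (c ∷ v) = begin
      ∑ letters (λ a → ⟦ a Fin.≟ c ⟧ * pre u v + occ (a ∷ u) v) + pre u (c ∷ v)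
        ≡⟨ cong (_+ pre u (c ∷ v)) (∑-+ letters (λ a → ⟦ a Fin.≟ c ⟧ * pre u v) _) ⟩
      ∑ letters (λ a → ⟦ a Fin.≟ c ⟧ * pre u v) + ∑ letters (λ a → occ (a ∷ u) v) + pre u (c ∷ v)
        ≡⟨ cong (λ n → n + ∑ letters (λ a → occ (a ∷ u) v) + pre u (c ∷ v)) (∑-δ* c (pre u v)) ⟩
      pre u v + ∑ letters (λ a → occ (a ∷ u) v) + pre u (c ∷ v)
        ≡⟨ cong (_+ pre u (c ∷ v)) (trans (+-comm (pre u v) _) (balanceˡ u v)) ⟩
      occ u v + pre u (c ∷ v)
        ≡⟨ +-comm (occ u v) _ ⟩
      pre u (c ∷ v) + occ u v ∎
      where open ≡-Reasoning

    occ-∷ : ∀ a u v → occ (a ∷ u) v ≤ occ u v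
    occ-∷ a u v = ≤-trans (∑-∈ (λ a → occ (a ∷ u) v) (∈-allFin a))
      (≤-trans (m≤m+n _ _) (≤-reflexive (balanceˡ u v)))

    occ-∷ʳ : ∀ u a v → occ (u ∷ʳ a) v ≤ occ u v
    occ-∷ʳ u a v = ≤-trans (∑-∈ (λ a → occ (u ∷ʳ a) v) (∈-allFin a))
      (≤-trans (m≤m+n _ _) (≤-reflexive (balanceʳ u v)))

    ∑-pre-∷ʳ-∷ʳ : ∀ u v x → ∑ letters (λ a → pre (u ∷ʳ a) (v ∷ʳ x)) ≡ pre u v
    ∑-pre-∷ʳ-∷ʳ []      []      x = ∑-δ* x 1
    ∑-pre-∷ʳ-∷ʳ []      (c ∷ v) x = ∑-δ* c 1
    ∑-pre-∷ʳ-∷ʳ (d ∷ u) []      x = trans (∑-cong letters (λ a → pre-short (d ∷ u ∷ʳ a) (x ∷ [])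
        (s≤s (≤-trans (s≤s z≤n) (≤-reflexive (sym (length-∷ʳ u a)))))))
      (trans (∑-const letters 0) (*-zeroʳ (length letters)))
    ∑-pre-∷ʳ-∷ʳ (d ∷ u) (c ∷ v) x = trans (∑-*ˡ letters ⟦ d Fin.≟ c ⟧ _) (cong (⟦ d Fin.≟ c ⟧ *_) (∑-pre-∷ʳ-∷ʳ u v x))

    -- The extra letter `x` gives a successor even to an occurrence of `u` at the end of `v`, so the
    -- end term of `balanceʳ` disappears.
    ∑-occ-∷ʳ : ∀ u v x → ∑ letters (λ a → occ (u ∷ʳ a) (v ∷ʳ x)) ≡ occ u v
    ∑-occ-∷ʳ u []      x = trans
      (∑-cong letters (λ a → trans
        (cong (pre (u ∷ʳ a) (x ∷ []) +_)
          (pre-short (u ∷ʳ a) [] (≤-trans (s≤s z≤n) (≤-reflexive (sym (length-∷ʳ u a))))))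
        (+-identityʳ _)))
      (∑-pre-∷ʳ-∷ʳ u [] x)
    ∑-occ-∷ʳ u (c ∷ v) x = trans (∑-+ letters _ _) (cong₂ _+_ (∑-pre-∷ʳ-∷ʳ u (c ∷ v) x) (∑-occ-∷ʳ u v x))

    module _ {k : ℕ} where

      Σʷ-mono : ∀ {f g : Word b → ℕ} → (∀ w → length w ≡ k → f w ≤ g w) → Σʷ k f ≤ Σʷ k g
      Σʷ-mono h = ∑-mono (words b k) (λ w → h (toList w) (length-toList w))

      Σʷ-cong : ∀ {f g : Word b → ℕ} → (∀ w → length w ≡ k → f w ≡ g w) → Σʷ k f ≡ Σʷ k g
      Σʷ-cong h = ∑-cong (words b k) (λ w → h (toList w) (length-toList w))

    Σʷ-suc : ∀ k f → Σʷ (suc k) f ≡ ∑ letters (λ a → Σʷ k (f ∘ (a ∷_)))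
    Σʷ-suc k f = ∑-cartesian Vec._∷_ letters (words b k) (f ∘ toList)

    Σʷ-1 : ∀ k → Σʷ k (λ _ → 1) ≡ b ^ k
    Σʷ-1 zero    = refl
    Σʷ-1 (suc k) = trans (Σʷ-suc k (λ _ → 1))
      (trans (∑-cong letters (λ a → Σʷ-1 k)) (trans (∑-const letters (b ^ k)) (cong (_* b ^ k) (length-allFin b))))

    private
      leq : ℕ → ℕ → ℕ
      leq zero    n       = 1
      leq (suc k) zero    = 0
      leq (suc k) (suc n) = leq k n

      leq-∸ : ∀ k n → leq k (suc n) + (suc n ∸ k) ≡ suc (suc n) ∸ k
      leq-∸ zero          n       = refl
      leq-∸ (suc zero)    n       = refl
      leq-∸ (suc (suc k)) zero    = sym (0∸n≡0 k)
      leq-∸ (suc (suc k)) (suc n) = leq-∸ (suc k) n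

      Σʷ-pre : ∀ k u → Σʷ k (λ w → pre w u) ≡ leq k (length u)
      Σʷ-pre zero    u       = refl
      Σʷ-pre (suc k) []      = trans (Σʷ-suc k (λ w → pre w []))
        (trans (∑-cong letters (λ a → trans (∑-const (words b k) 0) (*-zeroʳ (length (words b k)))))
               (trans (∑-const letters 0) (*-zeroʳ (length letters))))
      Σʷ-pre (suc k) (c ∷ u) = begin
        Σʷ (suc k) (λ w → pre w (c ∷ u))
          ≡⟨ Σʷ-suc k (λ w → pre w (c ∷ u)) ⟩
        ∑ letters (λ a → Σʷ k (λ w → ⟦ a Fin.≟ c ⟧ * pre w u))
          ≡⟨ ∑-cong letters (λ a → ∑-*ˡ (words b k) ⟦ a Fin.≟ c ⟧ _) ⟩
        ∑ letters (λ a → ⟦ a Fin.≟ c ⟧ * Σʷ k (λ w → pre w u))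
          ≡⟨ ∑-δ* c _ ⟩
        Σʷ k (λ w → pre w u)
          ≡⟨ Σʷ-pre k u ⟩
        leq k (length u) ∎
        where open ≡-Reasoning

    -- Each position that leaves room for `k` letters contributes exactly one word. The later
    -- estimates rest on this total instead of on single windows.
    Σʷ-occ : ∀ k u → Σʷ k (λ w → occ w u) ≡ suc (length u) ∸ k
    Σʷ-occ zero    []      = refl
    Σʷ-occ (suc k) []      = trans (Σʷ-pre (suc k) []) (sym (0∸n≡0 k))
    Σʷ-occ k       (c ∷ u) = begin
      Σʷ k (λ w → pre w (c ∷ u) + occ w u)
        ≡⟨ ∑-+ (words b k) _ _ ⟩
      Σʷ k (λ w → pre w (c ∷ u)) + Σʷ k (λ w → occ w u)
        ≡⟨ cong₂ _+_ (Σʷ-pre k (c ∷ u)) (Σʷ-occ k u) ⟩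
      leq k (suc (length u)) + (suc (length u) ∸ k)
        ≡⟨ leq-∸ k (length u) ⟩
      suc (suc (length u)) ∸ k ∎
      where open ≡-Reasoning

    search : ∀ k (P : Word b → Set) → (∀ w → Dec (P w)) →
      (∃[ w ] length w ≡ k × P w) ⊎ (∀ w → length w ≡ k → ¬ P w)
    search zero P P? with P? []
    ... | yes p = inj₁ ([] , refl , p)
    ... | no ¬p = inj₂ λ { [] _ → ¬p }
    search (suc k) P P? with Fin.any? (λ a → decide (search k (P ∘ (a ∷_)) (P? ∘ (a ∷_))))
      where
      decide : ∀ {Q : Word b → Set} → (∃[ w ] length w ≡ k × Q w) ⊎ (∀ w → length w ≡ k → ¬ Q w) →
        Dec (∃[ w ] length w ≡ k × Q w)
      decide (inj₁ e) = yes e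
      decide (inj₂ n) = no λ { (w , h , q) → n w h q }
    ... | yes (a , w , h , p) = inj₁ (a ∷ w , cong suc h , p)
    ... | no ¬e = inj₂ λ { (a ∷ w) h p → ¬e (a , w , suc-injective h , p) }

  module _ {b : ℕ} where

    occ≡eqʷ : ∀ (u v : Word b) → length u ≡ length v → occ u v ≡ eqʷ u v
    occ≡eqʷ []      []      h = refl
    occ≡eqʷ u@(_ ∷ _) (c ∷ v) h = trans (cong₂ _+_ (pre≡eqʷ u (c ∷ v) h) (occ-short u v (≤-reflexive (sym h)))) (+-identityʳ _)

    pre-prefix : ∀ u v t → length u ≡ length v → pre u (v ++ t) ≡ eqʷ {b} u v
    pre-prefix u v t h = trans (pre-++ u v t (≤-reflexive h)) (pre≡eqʷ u v h)

    suf-suffix : ∀ u s v → length u ≡ length v → suf u (s ++ v) ≡ eqʷ {b} u v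
    suf-suffix u s v h = trans (suf-++ u s v (≤-reflexive h)) (suf≡eqʷ u v h)

    length-≤-++ʳ : ∀ (s v : Word b) → length v ≤ length (s ++ v)
    length-≤-++ʳ s v = ≤-trans (m≤n+m _ (length s)) (≤-reflexive (sym (length-++ s)))

    -- A word is read as a walk through its subwords of length `m`, and is closed when the first and
    -- the last vertex agree. Comparing indicators avoids naming this vertex.
    Closed : ℕ → Word b → Set
    Closed m v = ∀ u → length u ≡ m → pre u v ≡ suf u v

    closed-balanced : ∀ {m v} → Closed m v → ∀ u → length u ≡ m →
      ∑ letters (λ a → occ (u ∷ʳ a) v) ≡ ∑ letters (λ a → occ (a ∷ u) v)
    closed-balanced {v = v} closed u h = +-cancelʳ-≡ (suf u v) _ _
      (trans (balanceʳ u v) (trans (sym (balanceˡ u v)) (cong (∑ letters (λ a → occ (a ∷ u) v) +_) (closed u h))))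

    -- A walk that repeats no edge has at most `b ^ suc m` edges and `m` further letters. This
    -- provides the fuel for `walk` and `saturate`.
    length-bound : ∀ m v → (∀ w → length w ≡ suc m → occ w v ≤ 1) → length v ≤ b ^ suc m + m
    length-bound m v occ≤1 = begin
      length v            ≤⟨ m≤n+m∸n (length v) m ⟩
      m + (length v ∸ m)  ≡⟨ cong (m +_) (Σʷ-occ (suc m) v) ⟨
      m + Σʷ (suc m) (λ w → occ w v) ≤⟨ +-monoʳ-≤ m (Σʷ-mono {b} {suc m} occ≤1) ⟩
      m + Σʷ {b} (suc m) (λ _ → 1) ≡⟨ cong (m +_) (Σʷ-1 {b} (suc m)) ⟩
      m + b ^ suc m       ≡⟨ +-comm m _ ⟩
      b ^ suc m + m       ∎
      where open ≤-Reasoning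

  -- Eulerian circuits in de Bruijn graphs

  -- c counts the edges that are used already; edges are words of length suc m and
  -- vertices words of length m.
  module Walk {b m : ℕ} (c : Word b → ℕ)
    (balanced : ∀ u → length u ≡ m → ∑ letters (λ a → c (u ∷ʳ a)) ≡ ∑ letters (λ a → c (a ∷ u)))
    (v : Word b) (∣v∣≡m : length v ≡ m) where

    Fits : Word b → Set
    Fits W = ∀ w → length w ≡ suc m → c w + occ w W ≤ 1

    fits-bound : ∀ W → Fits W → length W ≤ b ^ suc m + m
    fits-bound W fits = length-bound {b} m W (λ w h → ≤-trans (m≤n+m _ (c w)) (fits w h))

    fits-∷ʳ : ∀ s u a → length u ≡ m → Fits (s ++ u) → c (u ∷ʳ a) + occ (u ∷ʳ a) (s ++ u) ≡ 0 → Fits (s ++ u ∷ʳ a)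
    fits-∷ʳ s u a ∣u∣≡m fits free w h = begin
      c w + occ w (s ++ u ∷ʳ a)            ≡⟨ cong (c w +_) (occ-join w s u (a ∷ []) (trans h (cong suc (sym ∣u∣≡m)))) ⟩
      c w + (occ w (s ++ u) + occ w (u ∷ʳ a)) ≡⟨ +-assoc (c w) _ _ ⟨
      c w + occ w (s ++ u) + occ w (u ∷ʳ a)   ≡⟨ cong (c w + occ w (s ++ u) +_) (occ≡eqʷ w (u ∷ʳ a) (trans h (sym ∣ua∣))) ⟩
      c w + occ w (s ++ u) + eqʷ w (u ∷ʳ a)   ≤⟨ bound ⟩
      1                                    ∎
      where
      open ≤-Reasoning
      ∣ua∣ : length (u ∷ʳ a) ≡ suc m
      ∣ua∣ = trans (length-∷ʳ u a) (cong suc ∣u∣≡m)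
      bound : c w + occ w (s ++ u) + eqʷ w (u ∷ʳ a) ≤ 1
      bound with eqʷ w (u ∷ʳ a) in eq
      ... | zero  = ≤-trans (≤-reflexive (+-identityʳ _)) (fits w h)
      ... | suc n with eqʷ⁻¹ w (u ∷ʳ a) (≤-trans (s≤s z≤n) (≤-reflexive (sym eq)))
      ... | refl = ≤-reflexive (cong₂ _+_ free (trans (sym eq) (eqʷ-refl (u ∷ʳ a))))

    -- Euler's argument. At a stuck end `u` all `b` exits are taken, by older edges or by the walk.
    -- The older edges are balanced, the last visit of the walk at `u` has no exit, and at most `b`
    -- edges enter `u`. Hence some visit at `u` has no entry, and `u` is the start.
    stuck⇒closed : ∀ s u t → length u ≡ m → s ++ u ≡ v ++ t → Fits (s ++ u) →
      (∀ a → 1 ≤ c (u ∷ʳ a) + occ (u ∷ʳ a) (s ++ u)) → u ≡ v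
    stuck⇒closed s u t ∣u∣≡m eq fits full = eqʷ⁻¹ u v (≤-trans 1≤pre (≤-reflexive
      (trans (cong (pre u) eq) (pre-prefix u v t (trans ∣u∣≡m (sym ∣v∣≡m))))))
      where
      W = s ++ u
      out = ∑ letters (λ a → occ (u ∷ʳ a) W)
      inn = ∑ letters (λ a → occ (a ∷ u) W)
      C = ∑ letters (λ a → c (u ∷ʳ a))
      1≤pre : 1 ≤ pre u W
      1≤pre = +-cancelˡ-≤ b _ _ (begin
        b + 1                  ≡⟨ cong (_+ 1) (length-allFin b) ⟨
        length (allFin b) + 1  ≤⟨ +-monoˡ-≤ 1 (length≤∑ (letters {b}) full) ⟩
        ∑ letters (λ a → c (u ∷ʳ a) + occ (u ∷ʳ a) W) + 1 ≡⟨ cong (_+ 1) (∑-+ (letters {b}) _ _) ⟩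
        C + out + 1            ≡⟨ +-assoc C out 1 ⟩
        C + (out + 1)          ≡⟨ cong (λ n → C + (out + n)) (suf-self s u) ⟨
        C + (out + suf u W)    ≡⟨ cong (C +_) (trans (balanceʳ u W) (sym (balanceˡ u W))) ⟩
        C + (inn + pre u W)    ≡⟨ +-assoc C inn _ ⟨
        C + inn + pre u W      ≡⟨ cong (λ n → n + inn + pre u W) (balanced u ∣u∣≡m) ⟩
        ∑ letters (λ a → c (a ∷ u)) + inn + pre u W ≡⟨ cong (_+ pre u W) (∑-+ (letters {b}) _ _) ⟨
        ∑ letters (λ a → c (a ∷ u) + occ (a ∷ u) W) + pre u W
          ≤⟨ +-monoˡ-≤ (pre u W) (∑≤length (letters {b}) (λ a → fits (a ∷ u) (cong suc ∣u∣≡m))) ⟩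
        length (allFin b) + pre u W ≡⟨ cong (_+ pre u W) (length-allFin b) ⟩
        b + pre u W            ∎)
        where open ≤-Reasoning

    record Circuit : Set where
      field
        s t    : Word b
        closed : v ++ t ≡ s ++ v
        fits   : Fits (v ++ t)
        long   : 1 ≤ length t

    -- The walk so far is read twice, as `s ++ u` from its end vertex and as `v ++ x ∷ t` from its
    -- start vertex; the letter `x` records that it is not trivial. Each step adds a letter, so
    -- exhausted fuel contradicts `fits-bound`.
    walk : ∀ fuel s u x t → length u ≡ m → s ++ u ≡ v ++ x ∷ t → Fits (s ++ u) →
      b ^ suc m + m < fuel + length (s ++ u) → Circuit
    walk zero s u x t ∣u∣≡m eq fits lt = contradiction (fits-bound (s ++ u) fits) (<⇒≱ lt)
    walk (suc fuel) s u x t ∣u∣≡m eq fits lt with Fin.any? (λ a → c (u ∷ʳ a) + occ (u ∷ʳ a) (s ++ u) ≟ 0)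
    ... | yes (a , free) = walk fuel (s ++ first) rest x (t ∷ʳ a) ∣rest∣ eq′ (subst Fits (sym split) (fits-∷ʳ s u a ∣u∣≡m fits free))
        (≤-trans lt (≤-reflexive (trans (sym (+-suc fuel _)) (cong (fuel +_) ∣su∣))))
      where
      -- The end vertex slides on by one letter. Splitting `u ∷ʳ a` with `take` and `drop` also
      -- covers `m = 0`, where `u` is empty.
      first = take 1 (u ∷ʳ a)
      rest = drop 1 (u ∷ʳ a)
      split : (s ++ first) ++ rest ≡ s ++ u ∷ʳ a
      split = trans (++-assoc s first rest) (cong (s ++_) (take++drop≡id 1 (u ∷ʳ a)))
      ∣rest∣ : length rest ≡ m
      ∣rest∣ = trans (length-drop 1 (u ∷ʳ a)) (trans (cong pred (length-∷ʳ u a)) ∣u∣≡m)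
      eq′ : (s ++ first) ++ rest ≡ v ++ x ∷ t ∷ʳ a
      eq′ = trans split (trans (sym (++-assoc s u _)) (trans (cong (_∷ʳ a) eq) (++-assoc v (x ∷ t) _)))
      ∣su∣ : suc (length (s ++ u)) ≡ length ((s ++ first) ++ rest)
      ∣su∣ = sym (trans (cong length (trans split (sym (++-assoc s u _)))) (length-∷ʳ (s ++ u) a))
    ... | no ¬free with stuck⇒closed s u (x ∷ t) ∣u∣≡m eq fits (λ a → n≢0⇒n>0 (λ e → ¬free (a , e)))
    ... | refl = record { s = s ; t = x ∷ t ; closed = sym eq ; fits = subst Fits eq fits ; long = s≤s z≤n }

    circuit : ∀ a → c (v ∷ʳ a) ≡ 0 → (∀ w → length w ≡ suc m → c w ≤ 1) → Circuit
    circuit a free c≤1 = walk (suc (b ^ suc m + m)) (take 1 (v ∷ʳ a)) (drop 1 (v ∷ʳ a)) a []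
      (trans (length-drop 1 (v ∷ʳ a)) (trans (cong pred (length-∷ʳ v a)) ∣v∣≡m))
      (take++drop≡id 1 (v ∷ʳ a))
      (subst Fits (sym (take++drop≡id 1 (v ∷ʳ a))) (fits-∷ʳ [] v a ∣v∣≡m
        (λ w h → ≤-trans (≤-reflexive (trans (cong (c w +_) (occ-short w v (≤-reflexive (trans (cong suc ∣v∣≡m) (sym h))))) (+-identityʳ _))) (c≤1 w h))
        (cong₂ _+_ free (occ-short (v ∷ʳ a) v (≤-reflexive (sym (length-∷ʳ v a)))))))
      (m≤m+n _ _)

  -- The last vertex `v₀` of the closed walk is split off because the circuit of the remaining edges
  -- is attached there.
  module Euler {b m : ℕ} (F₀ v₀ : Word b) (∣v₀∣≡m : length v₀ ≡ m)
    (F-closed : Closed m (F₀ ++ v₀))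
    (F≤1 : ∀ w → length w ≡ suc m → occ w (F₀ ++ v₀) ≤ 1)
    (sibling : ∀ w c c′ → suc (length w) ≡ m → c ≢ c′ →
      ∃[ a ] occ (c ∷ w ∷ʳ a) (F₀ ++ v₀) + occ (c′ ∷ w ∷ʳ a) (F₀ ++ v₀) ≡ 0)
    (source : ∀ w a → suc (length w) ≡ m → ∃[ c ] occ (c ∷ w ∷ʳ a) (F₀ ++ v₀) ≡ 0) where

    F : Word b
    F = F₀ ++ v₀

    record Tour (E : Word b) : Set where
      field
        starts : 1 ≤ pre v₀ E
        closed : Closed m E
        used≤1 : ∀ w → length w ≡ suc m → occ w F + occ w E ≤ 1

    open Tour

    used : Word b → Word b → ℕ
    used E w = occ w F + occ w E

    used-balanced : ∀ {E} → Tour E → ∀ u → length u ≡ m →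
      ∑ letters (λ a → used E (u ∷ʳ a)) ≡ ∑ letters (λ a → used E (a ∷ u))
    used-balanced {E} T u h = begin
      ∑ letters (λ a → used E (u ∷ʳ a))  ≡⟨ ∑-+ (letters {b}) _ _ ⟩
      ∑ letters (λ a → occ (u ∷ʳ a) F) + ∑ letters (λ a → occ (u ∷ʳ a) E)
        ≡⟨ cong₂ _+_ (closed-balanced {m = m} {F} F-closed u h) (closed-balanced {m = m} {E} (closed T) u h) ⟩
      ∑ letters (λ a → occ (a ∷ u) F) + ∑ letters (λ a → occ (a ∷ u) E)
        ≡⟨ ∑-+ (letters {b}) _ _ ⟨
      ∑ letters (λ a → used E (a ∷ u)) ∎
      where open ≡-Reasoning

    empty-tour : Tour v₀
    empty-tour = record
      { starts = ≤-reflexive (sym (trans (pre≡eqʷ v₀ v₀ refl) (eqʷ-refl v₀)))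
      ; closed = λ u h → trans (pre≡eqʷ u v₀ (trans h (sym ∣v₀∣≡m))) (sym (suf≡eqʷ u v₀ (trans h (sym ∣v₀∣≡m))))
      ; used≤1 = λ w h → ≤-trans (≤-reflexive (trans
          (cong (occ w F +_) (occ-short w v₀ (≤-reflexive (trans (cong suc ∣v₀∣≡m) (sym h)))))
          (+-identityʳ _))) (F≤1 w h)
      }

    module _ {E v : Word b} (T : Tour E) (∣v∣≡m : length v ≡ m) (v∈E : 1 ≤ occ v E)
      (C : Walk.Circuit (used E) (used-balanced T) v ∣v∣≡m) where
      open Walk.Circuit C renaming (s to p; t to q; closed to circuit-closed)

      -- The circuit is inserted at some visit of the tour at `v`. The two ends of the tour do not
      -- change, and by `occ-join` the edges of the tour and of the circuit add up.
      splice : ∃[ E′ ] Tour E′ × length E < length E′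
      splice with occ⁻¹ v E v∈E
      ... | s , t , refl = E′ , record
          { starts = ≤-trans (starts T) (≤-reflexive (pre-E′ v₀ ∣v₀∣≡m))
          ; closed = λ u h → trans (sym (pre-E′ u h)) (trans (closed T u h) (suf-E′ u h))
          ; used≤1 = λ w h → ≤-trans (≤-reflexive (trans (cong (occ w F +_) (occ-E′ w h)) (sym (+-assoc (occ w F) _ _)))) (fits w h)
          } , longer
        where
        E′ = s ++ v ++ q ++ t
        -- Read from the end vertex of the circuit, the new word still ends in `v ++ t`, as the old
        -- one does.
        E′≡ : E′ ≡ (s ++ p) ++ v ++ t
        E′≡ = begin
          s ++ v ++ q ++ t   ≡⟨ cong (s ++_) (++-assoc v q t) ⟨
          s ++ (v ++ q) ++ t ≡⟨ cong (λ x → s ++ x ++ t) circuit-closed ⟩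
          s ++ (p ++ v) ++ t ≡⟨ cong (s ++_) (++-assoc p v t) ⟩
          s ++ p ++ v ++ t   ≡⟨ ++-assoc s p _ ⟨
          (s ++ p) ++ v ++ t ∎
          where open ≡-Reasoning
        m≤sv : m ≤ length (s ++ v)
        m≤sv = ≤-trans (≤-reflexive (sym ∣v∣≡m)) (length-≤-++ʳ s v)
        m≤vt : m ≤ length (v ++ t)
        m≤vt = ≤-trans (≤-reflexive (sym ∣v∣≡m)) (≤-trans (m≤m+n _ (length t)) (≤-reflexive (sym (length-++ v))))
        pre-E′ : ∀ u → length u ≡ m → pre u (s ++ v ++ t) ≡ pre u E′
        pre-E′ u refl = trans (trans (cong (pre u) (sym (++-assoc s v t))) (pre-++ u (s ++ v) t m≤sv))
          (sym (trans (cong (pre u) (sym (++-assoc s v _))) (pre-++ u (s ++ v) (q ++ t) m≤sv)))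
        suf-E′ : ∀ u → length u ≡ m → suf u (s ++ v ++ t) ≡ suf u E′
        suf-E′ u refl = trans (suf-++ u s (v ++ t) m≤vt)
          (sym (trans (cong (suf u) E′≡) (suf-++ u (s ++ p) (v ++ t) m≤vt)))
        occ-E′ : ∀ w → length w ≡ suc m → occ w E′ ≡ occ w (s ++ v ++ t) + occ w (v ++ q)
        occ-E′ w h = begin
          occ w (s ++ v ++ q ++ t)               ≡⟨ occ-join w s v (q ++ t) h′ ⟩
          occ w (s ++ v) + occ w (v ++ q ++ t)   ≡⟨ cong (λ x → occ w (s ++ v) + occ w x) vqt ⟩
          occ w (s ++ v) + occ w (p ++ v ++ t)   ≡⟨ cong (occ w (s ++ v) +_) (occ-join w p v t h′) ⟩
          occ w (s ++ v) + (occ w (p ++ v) + occ w (v ++ t))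
            ≡⟨ rearrange (occ w (s ++ v)) _ _ ⟩
          occ w (s ++ v) + occ w (v ++ t) + occ w (p ++ v)
            ≡⟨ cong₂ _+_ (sym (occ-join w s v t h′)) (cong (occ w) (sym circuit-closed)) ⟩
          occ w (s ++ v ++ t) + occ w (v ++ q)   ∎
          where
          open ≡-Reasoning
          h′ : length w ≡ suc (length v)
          h′ = trans h (cong suc (sym ∣v∣≡m))
          vqt : v ++ q ++ t ≡ p ++ v ++ t
          vqt = trans (sym (++-assoc v q t)) (trans (cong (_++ t) circuit-closed) (++-assoc p v t))
          rearrange : ∀ x y z → x + (y + z) ≡ x + z + y
          rearrange = solve-∀
        longer : length (s ++ v ++ t) < length E′
        longer = begin-strict
          length (s ++ v ++ t)          ≡⟨ cong length (sym (++-assoc s v t)) ⟩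
          length ((s ++ v) ++ t)        ≡⟨ length-++ (s ++ v) ⟩
          length (s ++ v) + length t    <⟨ +-monoʳ-< (length (s ++ v)) (≤-trans (+-monoˡ-≤ (length t) long) (≤-reflexive (sym (length-++ q)))) ⟩
          length (s ++ v) + length (q ++ t) ≡⟨ length-++ (s ++ v) ⟨
          length ((s ++ v) ++ q ++ t)   ≡⟨ cong length (++-assoc s v _) ⟩
          length (s ++ v ++ q ++ t)     ∎
          where open ≤-Reasoning

    Open : Word b → Word b → Set
    Open E v = 1 ≤ occ v E × ∃[ a ] used E (v ∷ʳ a) ≡ 0

    Open? : ∀ E v → Dec (Open E v)
    Open? E v = (1 ≤? occ v E) ×-dec Fin.any? (λ a → used E (v ∷ʳ a) ≟ 0)

    Saturated : Word b → Set
    Saturated E = ∀ v → length v ≡ m → ¬ Open E v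

    tour-bound : ∀ {E} → Tour E → length E ≤ b ^ suc m + m
    tour-bound {E} T = length-bound {b} m E (λ w h → ≤-trans (m≤n+m _ (occ w F)) (used≤1 T w h))

    -- Hierholzer's method: as long as some vertex of the tour has a free exit, a circuit from there
    -- is spliced in. Each splice lengthens the tour, whose length is bounded.
    saturate : ∀ fuel E → Tour E → b ^ suc m + m < fuel + length E → ∃[ E ] Tour E × Saturated E
    saturate zero E T lt = contradiction (tour-bound T) (<⇒≱ lt)
    saturate (suc fuel) E T lt with search m (Open E) (Open? E)
    ... | inj₂ saturated = E , T , saturated
    ... | inj₁ (v , ∣v∣≡m , v∈E , a , free)
      with splice T ∣v∣≡m v∈E (Walk.circuit (used E) (used-balanced T) v ∣v∣≡m a free (used≤1 T))
    ... | E′ , T′ , longer = saturate fuel E′ T′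
      (≤-trans lt (≤-trans (≤-reflexive (sym (+-suc fuel _))) (+-monoʳ-≤ fuel longer)))

    module _ {E : Word b} (T : Tour E) (saturated : Saturated E) where

      exits : ∀ v → length v ≡ m → 1 ≤ occ v E → ∀ a → 1 ≤ used E (v ∷ʳ a)
      exits v h v∈E a = n≢0⇒n>0 (λ free → saturated v h (v∈E , a , free))

      -- All `b` exits of `v` are used, and used edges are balanced, so the used entries count at
      -- least `b`. Each counts at most once; hence none is missing.
      entries : ∀ v → length v ≡ m → 1 ≤ occ v E → ∀ a → 1 ≤ used E (a ∷ v)
      entries v h v∈E a = length≤∑⇒1≤ {xs = letters} {a} {λ a → used E (a ∷ v)} (λ a → used≤1 T (a ∷ v) (cong suc h))
        (≤-trans (length≤∑ (letters {b}) (exits v h v∈E)) (≤-reflexive (used-balanced T v h))) (∈-allFin a)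

      used⇒∈E : ∀ w → occ w F ≡ 0 → 1 ≤ used E w → 1 ≤ occ w E
      used⇒∈E w free h = ≤-trans h (≤-reflexive (cong (_+ occ w E) free))

      target : ∀ c w a → suc (length w) ≡ m → occ (c ∷ w ∷ʳ a) F ≡ 0 → 1 ≤ occ (c ∷ w) E → 1 ≤ occ (w ∷ʳ a) E
      target c w a h free cw∈E = ≤-trans (used⇒∈E (c ∷ w ∷ʳ a) free (exits (c ∷ w) h cw∈E a)) (occ-∷ c (w ∷ʳ a) E)

      origin : ∀ c w a → suc (length w) ≡ m → occ (c ∷ w ∷ʳ a) F ≡ 0 → 1 ≤ occ (w ∷ʳ a) E → 1 ≤ occ (c ∷ w) E
      origin c w a h free wa∈E = ≤-trans
        (used⇒∈E (c ∷ w ∷ʳ a) free (entries (w ∷ʳ a) (trans (length-∷ʳ w a) h) wa∈E c)) (occ-∷ʳ (c ∷ w) a E)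

      -- From `c ∷ w` forward to a common successor along an edge outside `F`, then backward along
      -- the edge from `c′ ∷ w`. A saturated tour contains both edges.
      change : ∀ c c′ w → suc (length w) ≡ m → 1 ≤ occ (c ∷ w) E → 1 ≤ occ (c′ ∷ w) E
      change c c′ w h cw∈E with c Fin.≟ c′
      ... | yes refl = cw∈E
      ... | no c≢c′ with sibling w c c′ h c≢c′
      ... | a , free = origin c′ w a h (m+n≡0⇒n≡0 (occ (c ∷ w ∷ʳ a) F) free)
        (target c w a h (m+n≡0⇒m≡0 (occ (c ∷ w ∷ʳ a) F) free) cw∈E)

      -- The direct edge from `c ∷ w` to `w ∷ʳ a` may belong to `F`. In any case some predecessor
      -- `c′ ∷ w` has its edge to `w ∷ʳ a` outside `F`, and `change` leads to it.
      shift : ∀ c w a → suc (length w) ≡ m → 1 ≤ occ (c ∷ w) E → 1 ≤ occ (w ∷ʳ a) E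
      shift c w a h cw∈E with source w a h
      ... | c′ , free = target c′ w a h free (change c c′ w h cw∈E)

      -- Vertices shift as the letters of `z` are read; after `m` letters the starting vertex is
      -- forgotten. With `z` any given vertex this yields `spanning`.
      shifts : ∀ z v → length v ≡ m → 1 ≤ m → 1 ≤ occ v E → 1 ≤ occ (drop (length z) (v ++ z)) E
      shifts []      v       h 1≤m v∈E = subst (λ x → 1 ≤ occ x E) (sym (++-identityʳ v)) v∈E
      shifts (a ∷ z) []      h 1≤m v∈E = contradiction 1≤m (<⇒≱ (≤-reflexive (cong suc (sym h))))
      shifts (a ∷ z) (c ∷ w) h 1≤m v∈E = subst (λ x → 1 ≤ occ (drop (length z) x) E) (++-assoc w (a ∷ []) z)
        (shifts z (w ∷ʳ a) (trans (length-∷ʳ w a) h) 1≤m (shift c w a h v∈E))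

      spanning : 1 ≤ m → ∀ v → length v ≡ m → 1 ≤ occ v E
      spanning 1≤m v h = subst (λ x → 1 ≤ occ x E)
        (trans (cong (λ n → drop n (v₀ ++ v)) (trans h (sym ∣v₀∣≡m))) (drop-length-++ v₀ v))
        (shifts v v₀ ∣v₀∣≡m 1≤m (≤-trans (starts T) (pre≤occ v₀ E)))
        where
        drop-length-++ : ∀ (s t : Word b) → drop (length s) (s ++ t) ≡ t
        drop-length-++ []      t = refl
        drop-length-++ (c ∷ s) t = drop-length-++ s t

      exhausted : 1 ≤ m → ∀ w → length w ≡ suc m → used E w ≡ 1
      exhausted 1≤m w h with initLast w
      ... | u ∷ʳ′ a = ≤-antisym (used≤1 T (u ∷ʳ a) h) (exits u ∣u∣ (spanning 1≤m u ∣u∣) a)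
        where
        ∣u∣ : length u ≡ m
        ∣u∣ = suc-injective (trans (sym (length-∷ʳ u a)) h)

    -- The saturated tour consists of all edges that `F` leaves over, and it starts at the vertex
    -- `v₀` where `F` ends.
    complete : 1 ≤ m → ∃[ t ] Closed m (F ++ t) × (∀ w → length w ≡ suc m → occ w (F ++ t) ≡ 1)
    complete 1≤m with saturate (suc (b ^ suc m + m)) v₀ empty-tour (m≤m+n _ _)
    ... | E , T , saturated with pre⁻¹ v₀ E (starts T)
    ... | t , refl = t , closed′ , (λ w h → trans (trans (cong (occ w) (++-assoc F₀ v₀ t))
            (occ-join w F₀ v₀ t (trans h (cong suc (sym ∣v₀∣≡m))))) (exhausted T saturated 1≤m w h))
      where
      closed′ : Closed m (F ++ t)
      closed′ u h = begin
        pre u (F ++ t)        ≡⟨ pre-++ u F t (≤-trans (≤-reflexive (trans h (sym ∣v₀∣≡m))) (length-≤-++ʳ F₀ v₀)) ⟩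
        pre u F               ≡⟨ F-closed u h ⟩
        suf u F               ≡⟨ suf-suffix u F₀ v₀ (trans h (sym ∣v₀∣≡m)) ⟩
        eqʷ u v₀              ≡⟨ pre-prefix u v₀ t (trans h (sym ∣v₀∣≡m)) ⟨
        pre u (v₀ ++ t)       ≡⟨ closed T u h ⟩
        suf u (v₀ ++ t)       ≡⟨ suf-++ u F₀ (v₀ ++ t) (≤-trans (≤-reflexive (trans h (sym ∣v₀∣≡m))) (≤-trans (m≤m+n _ _) (≤-reflexive (sym (length-++ v₀))))) ⟨
        suf u (F₀ ++ v₀ ++ t) ≡⟨ cong (suf u) (++-assoc F₀ v₀ t) ⟨
        suf u (F ++ t)        ∎
        where open ≡-Reasoning

  -- De Bruijn words

  module _ {b : ℕ} where

    -- A cyclic de Bruijn word of order `suc m`, cut open and with its first `m` letters repeated at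
    -- the end, so that every cyclic window becomes a subword.
    record DeBruijn (m : ℕ) (v : Word b) : Set where
      field
        once   : ∀ w → length w ≡ suc m → occ w v ≡ 1
        closed : Closed m v

    open DeBruijn

    deBruijn-length : ∀ {m v} → DeBruijn m v → length v ∸ m ≡ b ^ suc m
    deBruijn-length {m} {v} D = trans (sym (Σʷ-occ (suc m) v))
      (trans (Σʷ-cong {b} {suc m} (once D)) (Σʷ-1 {b} (suc m)))

    record Rotation (m : ℕ) (v : Word b) : Set where
      field
        next   : Fin b
        front  : Word b
        final   : Word b
        split  : v ∷ʳ next ≡ front ++ final
        ∣final∣ : length final ≡ suc m
        closed : Closed (suc m) (v ∷ʳ next)

    -- The word ends with its own first `m` letters `u`. Appending the letter that follows `u` at
    -- the start closes the same cycle in the next graph, where the former edges are vertices.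
    rotate : ∀ {m v} → Closed m v → m < length v → Rotation m v
    rotate {m} {v} closed m<∣v∣ = from (drop m v) refl
      where
      u = take m v
      ∣u∣ : length u ≡ m
      ∣u∣ = trans (length-take m v) (m≤n⇒m⊓n≡m (<⇒≤ m<∣v∣))
      from : ∀ t → drop m v ≡ t → Rotation m v
      from [] eq = contradiction m<∣v∣ (≤⇒≯ (m∸n≡0⇒m≤n (trans (sym (length-drop m v)) (cong length eq))))
      from (a ∷ t) eq = rot (suf⁻¹ u v (≤-trans (≤-reflexive (sym (trans (cong (pre u) v≡) (pre-self u _)))) (≤-reflexive (closed u ∣u∣))))
        where
        v≡ : v ≡ u ++ a ∷ t
        v≡ = trans (sym (take++drop≡id m v)) (cong (u ++_) eq)
        ∣ua∣ : length (u ∷ʳ a) ≡ suc m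
        ∣ua∣ = trans (length-∷ʳ u a) (cong suc ∣u∣)
        rot : ∃[ s ] v ≡ s ++ u → Rotation m v
        rot (s , v≡su) = record
          { next = a ; front = s ; final = u ∷ʳ a
          ; split = split ; ∣final∣ = ∣ua∣
          ; closed = λ w h → trans (trans (cong (pre w) start) (pre-prefix w (u ∷ʳ a) _ (trans h (sym ∣ua∣))))
              (sym (trans (cong (suf w) split) (suf-suffix w s (u ∷ʳ a) (trans h (sym ∣ua∣)))))
          }
          where
          split : v ∷ʳ a ≡ s ++ u ∷ʳ a
          split = trans (cong (_∷ʳ a) v≡su) (++-assoc s u _)
          start : v ∷ʳ a ≡ (u ∷ʳ a) ++ t ∷ʳ a
          start = trans (cong (_∷ʳ a) v≡) (trans (++-assoc u (a ∷ t) _) (sym (++-assoc u (a ∷ []) _)))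

    ∑-occ-∷-∷ʳ : ∀ {m} {v : Word b} {x} → Closed (suc m) (v ∷ʳ x) → ∀ u → length u ≡ suc m →
      ∑ letters (λ c → occ (c ∷ u) (v ∷ʳ x)) ≡ occ u v
    ∑-occ-∷-∷ʳ {m} {v} {x} closed u h = trans (sym (closed-balanced {m = suc m} {v ∷ʳ x} closed u h)) (∑-occ-∷ʳ u v x)

    -- An occurrence in `v ∷ʳ x` contains an occurrence in `v` of the word without its last letter.
    occ-∷ʳ≤1 : ∀ {m} {v : Word b} {x} → (∀ w → length w ≡ suc m → occ w v ≤ 1) →
      ∀ w → length w ≡ suc (suc m) → occ w (v ∷ʳ x) ≤ 1
    occ-∷ʳ≤1 {m} {v} {x} occ≤1 w h with initLast w
    ... | u ∷ʳ′ a = ≤-trans (∑-∈ (λ a → occ (u ∷ʳ a) (v ∷ʳ x)) (∈-allFin a))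
      (≤-trans (≤-reflexive (∑-occ-∷ʳ u v x)) (occ≤1 u (suc-injective (trans (sym (length-∷ʳ u a)) h))))

    -- One order higher the cycle visits every vertex once, taking one exit and one entry there. Two
    -- vertices `c ∷ w` and `c′ ∷ w` block at most two letters, so one of at least three letters is
    -- free for both.
    step₁ : 2 < b → ∀ {m v} → DeBruijn m v → ∃[ t ] 1 ≤ length t × DeBruijn (suc m) (v ++ t)
    step₁ 2<b {m} {v} D = extend complete′
      where
      0<∣v∣-m : 0 < length v ∸ m
      0<∣v∣-m = ≤-trans (>-nonZero⁻¹ (b ^ suc m) {{m^n≢0 b (suc m) {{>-nonZero (<-trans z<s 2<b)}}}}) (≤-reflexive (sym (deBruijn-length D)))
      open Rotation (rotate {v = v} (closed D) (≰⇒> λ ∣v∣≤m → <⇒≢ 0<∣v∣-m (sym (m≤n⇒m∸n≡0 ∣v∣≤m)))) renaming (closed to closed′)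
      V = front ++ final
      V-closed : Closed (suc m) V
      V-closed = subst (Closed (suc m)) split closed′
      once-∷ʳ : ∀ u → length u ≡ suc m → ∑ letters (λ a → occ (u ∷ʳ a) V) ≡ 1
      once-∷ʳ u h = trans (cong (λ V → ∑ letters (λ a → occ (u ∷ʳ a) V)) (sym split)) (trans (∑-occ-∷ʳ u v next) (once D u h))
      sibling : ∀ w c c′ → suc (length w) ≡ suc m → c ≢ c′ →
        ∃[ a ] occ (c ∷ w ∷ʳ a) V + occ (c′ ∷ w ∷ʳ a) V ≡ 0
      sibling w c c′ h _ = ∑<length⇒∃≡0 letters _ (≤-trans (s≤s (≤-reflexive
        (trans (∑-+ (letters {b}) _ _) (cong₂ _+_ (once-∷ʳ (c ∷ w) h) (once-∷ʳ (c′ ∷ w) h))))) (≤-trans 2<b (≤-reflexive (sym (length-allFin b)))))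
      source : ∀ w a → suc (length w) ≡ suc m → ∃[ c ] occ (c ∷ w ∷ʳ a) V ≡ 0
      source w a h = ∑<length⇒∃≡0 letters _ (≤-trans (s≤s (≤-reflexive
        (trans (sym (closed-balanced {m = suc m} {V} V-closed (w ∷ʳ a) ∣wa∣)) (once-∷ʳ (w ∷ʳ a) ∣wa∣))))
        (≤-trans (≤-trans (s≤s (s≤s z≤n)) 2<b) (≤-reflexive (sym (length-allFin b)))))
        where
        ∣wa∣ = trans (length-∷ʳ w a) h
      V≤1 : ∀ w → length w ≡ suc (suc m) → occ w V ≤ 1
      V≤1 w h = subst (λ V → occ w V ≤ 1) split (occ-∷ʳ≤1 {m} {v} {next} (λ u h → ≤-reflexive (once D u h)) w h)
      complete′ = Euler.complete front final ∣final∣ V-closed V≤1 sibling source (s≤s z≤n)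
      extend : ∃[ t ] Closed (suc m) (V ++ t) × (∀ w → length w ≡ suc (suc m) → occ w (V ++ t) ≡ 1) →
        ∃[ t ] 1 ≤ length t × DeBruijn (suc m) (v ++ t)
      extend (t , closed″ , once″) = next ∷ t , s≤s z≤n , subst (DeBruijn (suc m)) V++t≡ (record { once = once″ ; closed = closed″ })
        where
        V++t≡ : V ++ t ≡ v ++ next ∷ t
        V++t≡ = trans (cong (_++ t) (sym split)) (++-assoc v _ t)

  -- Two orders higher, each `w` of length `suc m` is the core of four edges `c ∷ w ∷ʳ a`, and
  -- exactly one of them is used (`total`). The vertices `c ∷ w` and `c′ ∷ w` together therefore
  -- block one of the two letters, and the other is free for both.
  step₂ : ∀ {m} {v : Word 2} → DeBruijn m v → ∃[ t ] 1 ≤ length t × DeBruijn (suc (suc m)) (v ++ t)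
  step₂ {m} {v} D = extend (Euler.complete R₂.front R₂.final R₂.∣final∣ V-closed V≤1 sibling source (s≤s z≤n))
    where
    open DeBruijn
    m<∣v∣ : m < length v
    m<∣v∣ = ≰⇒> λ ∣v∣≤m → <⇒≢ (>-nonZero⁻¹ (2 ^ suc m) {{m^n≢0 2 (suc m)}}) (trans (sym (m≤n⇒m∸n≡0 ∣v∣≤m)) (deBruijn-length D))
    module R₁ = Rotation (rotate {v = v} (closed D) m<∣v∣)
    V₁ = v ∷ʳ R₁.next
    module R₂ = Rotation (rotate {v = V₁} R₁.closed (≤-trans (s≤s m<∣v∣) (≤-reflexive (sym (length-∷ʳ v _)))))
    V = R₂.front ++ R₂.final
    V-closed : Closed (suc (suc m)) V
    V-closed = subst (Closed (suc (suc m))) R₂.split R₂.closed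
    V≤1 : ∀ w → length w ≡ suc (suc (suc m)) → occ w V ≤ 1
    V≤1 w h = subst (λ V → occ w V ≤ 1) R₂.split (occ-∷ʳ≤1 {2} {suc m} {V₁} {R₂.next} (occ-∷ʳ≤1 {2} {m} {v} {R₁.next} (λ u h → ≤-reflexive (once D u h))) w h)
    total : ∀ w → length w ≡ suc m → ∑ letters (λ c → ∑ letters (λ a → occ (c ∷ w ∷ʳ a) V)) ≡ 1
    total w h = begin
      ∑ letters (λ c → ∑ letters (λ a → occ (c ∷ w ∷ʳ a) V))
        ≡⟨ cong (λ V → ∑ letters (λ c → ∑ letters (λ a → occ (c ∷ w ∷ʳ a) V))) R₂.split ⟨
      ∑ letters (λ c → ∑ letters (λ a → occ (c ∷ w ∷ʳ a) (V₁ ∷ʳ R₂.next)))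
        ≡⟨ ∑-cong (letters {2}) (λ c → ∑-occ-∷ʳ (c ∷ w) V₁ R₂.next) ⟩
      ∑ letters (λ c → occ (c ∷ w) V₁)
        ≡⟨ ∑-occ-∷-∷ʳ {2} {m} {v} {R₁.next} R₁.closed w h ⟩
      occ w v
        ≡⟨ once D w h ⟩
      1 ∎
      where open ≡-Reasoning
    sibling : ∀ w c c′ → suc (length w) ≡ suc (suc m) → c ≢ c′ →
      ∃[ a ] occ (c ∷ w ∷ʳ a) V + occ (c′ ∷ w ∷ʳ a) V ≡ 0
    sibling w c c′ h c≢c′ = ∑<length⇒∃≡0 (letters {2}) _ (s≤s (≤-reflexive
      (trans (∑-+ (letters {2}) (λ a → occ (c ∷ w ∷ʳ a) V) (λ a → occ (c′ ∷ w ∷ʳ a) V)) (trans (both c c′ c≢c′) (total w (suc-injective h))))))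
      where
      f : Fin 2 → ℕ
      f c = ∑ letters (λ a → occ (c ∷ w ∷ʳ a) V)
      both : ∀ c c′ → c ≢ c′ → f c + f c′ ≡ ∑ letters f
      both zero zero c≢c′ = contradiction refl c≢c′
      both zero (suc zero) _ = cong (f zero +_) (sym (+-identityʳ (f (suc zero))))
      both (suc zero) zero _ = trans (+-comm (f (suc zero)) (f zero)) (cong (f zero +_) (sym (+-identityʳ (f (suc zero)))))
      both (suc zero) (suc zero) c≢c′ = contradiction refl c≢c′
    source : ∀ w a → suc (length w) ≡ suc (suc m) → ∃[ c ] occ (c ∷ w ∷ʳ a) V ≡ 0
    source w a h = ∑<length⇒∃≡0 (letters {2}) _ (s≤s (≤-trans
      (∑-mono (letters {2}) (λ c → ∑-∈ (λ a → occ (c ∷ w ∷ʳ a) V) (∈-allFin a))) (≤-reflexive (total w (suc-injective h)))))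
    extend : ∃[ t ] Closed (suc (suc m)) (V ++ t) × (∀ w → length w ≡ suc (suc (suc m)) → occ w (V ++ t) ≡ 1) →
      ∃[ t ] 1 ≤ length t × DeBruijn (suc (suc m)) (v ++ t)
    extend (t , closed″ , once″) = R₁.next ∷ R₂.next ∷ t , s≤s z≤n , subst (DeBruijn (suc (suc m))) V++t≡ (record { once = once″ ; closed = closed″ })
      where
      V++t≡ : V ++ t ≡ v ++ R₁.next ∷ R₂.next ∷ t
      V++t≡ = trans (cong (_++ t) (sym R₂.split)) (trans (++-assoc V₁ _ t) (++-assoc v _ _))

  -- Infinite words as limits of growing words

  applyUpTo-+ : ∀ {A : Set} (f : ℕ → A) m n → applyUpTo f (m + n) ≡ applyUpTo f m ++ applyUpTo (f ∘ (m +_)) n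
  applyUpTo-+ f zero    n = refl
  applyUpTo-+ f (suc m) n = cong (f 0 ∷_) (applyUpTo-+ (f ∘ suc) m n)

  module _ {b : ℕ} where

    module Limit (default : Fin b) (X : ℕ → Word b)
      (extends : ∀ n → ∃[ t ] 1 ≤ length t × X (suc n) ≡ X n ++ t) where

      nth : Word b → ℕ → Fin b
      nth []      i       = default
      nth (c ∷ w) zero    = c
      nth (c ∷ w) (suc i) = nth w i

      nth-++ : ∀ w t i → i < length w → nth (w ++ t) i ≡ nth w i
      nth-++ (c ∷ w) t zero    h = refl
      nth-++ (c ∷ w) t (suc i) h = nth-++ w t i (s≤s⁻¹ h)

      applyUpTo-nth : ∀ w f n → n ≤ length w → (∀ i → i < n → f i ≡ nth w i) → applyUpTo f n ≡ take n w
      applyUpTo-nth w       f zero    h f≡ = refl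
      applyUpTo-nth (c ∷ w) f (suc n) h f≡ =
        cong₂ _∷_ (f≡ 0 z<s) (applyUpTo-nth w (f ∘ suc) n (s≤s⁻¹ h) (λ i i<n → f≡ (suc i) (s≤s i<n)))

      growing : ∀ n → n ≤ length (X n)
      growing zero    = z≤n
      growing (suc n) with extends n
      ... | t , 1≤∣t∣ , eq = begin
        suc n                   ≡⟨ +-comm 1 n ⟩
        n + 1                   ≤⟨ +-mono-≤ (growing n) 1≤∣t∣ ⟩
        length (X n) + length t ≡⟨ length-++ (X n) ⟨
        length (X n ++ t)       ≡⟨ cong length eq ⟨
        length (X (suc n))      ∎
        where open ≤-Reasoning

      extends⁺ : ∀ n d → ∃[ t ] X (d + n) ≡ X n ++ t
      extends⁺ n zero    = [] , sym (++-identityʳ _)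
      extends⁺ n (suc d) with extends⁺ n d | extends (d + n)
      ... | t , eq | t′ , _ , eq′ = t ++ t′ , trans eq′ (trans (cong (_++ t′) eq) (++-assoc (X n) t t′))

      extends-≤ : ∀ {m n} → m ≤ n → ∃[ t ] X n ≡ X m ++ t
      extends-≤ {m} {n} m≤n = subst (λ j → ∃[ t ] X j ≡ X m ++ t) (m∸n+n≡m m≤n) (extends⁺ m (n ∸ m))

      nth-X : ∀ m n i → i < length (X m) → i < length (X n) → nth (X m) i ≡ nth (X n) i
      nth-X m n i i<m i<n with ≤-total m n
      ... | inj₁ m≤n with extends-≤ m≤n
      ... | t , eq = sym (trans (cong (λ w → nth w i) eq) (nth-++ (X m) t i i<m))
      nth-X m n i i<m i<n | inj₂ n≤m with extends-≤ n≤m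
      ... | t , eq = trans (cong (λ w → nth w i) eq) (nth-++ (X n) t i i<n)

      -- Every stage appends at least one letter, so `X (suc i)` has a letter at index `i` and `nth`
      -- never falls back to `default`.
      limit : ℕ → Fin b
      limit i = nth (X (suc i)) i

      limit-prefix : ∀ n C → C ≤ length (X n) → applyUpTo limit C ≡ take C (X n)
      limit-prefix n C h = applyUpTo-nth (X n) limit C h
        (λ i i<C → nth-X (suc i) n i (growing (suc i)) (≤-trans i<C h))

    -- The number `h` is 1 for `b ≥ 3` and 2 for `b = 2`; multiplying the length by it avoids the
    -- division of `b ^ k`.
    Unrepeated : ℕ → (ℕ → Fin b) → Set
    Unrepeated h y = ∀ k C → 1 ≤ k → h * C ≤ b ^ k → ∀ w → length w ≡ k → occ w (applyUpTo y C) ≤ 1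

    occ-take : ∀ w C (v : Word b) → 1 ≤ length w → occ w (take C v) ≤ occ w v
    occ-take w C v h = begin
      occ w (take C v)                      ≤⟨ m≤m+n _ _ ⟩
      occ w (take C v) + occ w (drop C v)   ≤⟨ occ-superadditive w (take C v) (drop C v) h ⟩
      occ w (take C v ++ drop C v)          ≡⟨ cong (occ w) (take++drop≡id C v) ⟩
      occ w v                               ∎
      where open ≤-Reasoning

    deBruijn₀ : DeBruijn 0 (letters {b})
    deBruijn₀ = record
      { once = once ; closed = λ { [] _ → sym (trans (cong (suf {b} []) (sym (++-identityʳ (letters {b})))) (suf-self {b} (letters {b}) [])) } }
      where
      ≟-sym : ∀ (a c : Fin b) → ⟦ a Fin.≟ c ⟧ * 1 ≡ ⟦ c Fin.≟ a ⟧
      ≟-sym a c with a Fin.≟ c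
      ... | yes refl = sym (⟦⟧-yes (a Fin.≟ a) refl)
      ... | no a≢c   = sym (⟦⟧-no (c Fin.≟ a) (a≢c ∘ sym))
      occ-singleton : ∀ a u → occ (a ∷ []) u ≡ ∑ u (λ c → ⟦ c Fin.≟ a ⟧)
      occ-singleton a []      = refl
      occ-singleton a (c ∷ u) = cong₂ _+_ (≟-sym a c) (occ-singleton a u)
      once : ∀ w → length w ≡ 1 → occ w letters ≡ 1
      once (a ∷ []) _ = trans (occ-singleton a letters) (∑-≟ a)

    module FromDeBruijn (default : Fin b) (level : ℕ → ℕ)
      (step : ∀ n (v : Word b) → DeBruijn (level n) v → ∃[ t ] 1 ≤ length t × DeBruijn (level (suc n)) (v ++ t))
      (base : DeBruijn (level 0) (letters {b})) where

      stage : ∀ n → Σ[ v ∈ Word b ] DeBruijn (level n) v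
      stage zero    = letters , base
      stage (suc n) with stage n
      ... | v , D with step n v D
      ... | t , _ , D′ = v ++ t , D′

      extends : ∀ n → ∃[ t ] 1 ≤ length t × proj₁ (stage (suc n)) ≡ proj₁ (stage n) ++ t
      extends n with stage n
      ... | v , D with step n v D
      ... | t , 1≤∣t∣ , _ = t , 1≤∣t∣ , refl

      open Limit default (proj₁ ∘ stage) extends public

      limit-once : ∀ n C → C ≤ b ^ suc (level n) → ∀ w → length w ≡ suc (level n) → occ w (applyUpTo limit C) ≤ 1
      limit-once n C h w ∣w∣ = begin
        occ w (applyUpTo limit C)           ≡⟨ cong (occ w) (limit-prefix n C (≤-trans h (≤-trans (≤-reflexive (sym (deBruijn-length D))) (m∸n≤m _ (level n))))) ⟩
        occ w (take C (proj₁ (stage n)))    ≤⟨ occ-take w C _ (≤-trans (s≤s z≤n) (≤-reflexive (sym ∣w∣))) ⟩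
        occ w (proj₁ (stage n))             ≡⟨ DeBruijn.once D w ∣w∣ ⟩
        1                                   ∎
        where
        open ≤-Reasoning
        D = proj₂ (stage n)

    deBruijn-limit : Fin b → (level : ℕ → ℕ) →
      (∀ n v → DeBruijn (level n) v → ∃[ t ] 1 ≤ length t × DeBruijn (level (suc n)) (v ++ t)) →
      DeBruijn (level 0) (letters {b}) →
      ∃[ y ] (∀ n C → C ≤ b ^ suc (level n) → ∀ w → length w ≡ suc (level n) → occ w (applyUpTo y C) ≤ 1)
    deBruijn-limit default level step base =
      FromDeBruijn.limit default level step base , FromDeBruijn.limit-once default level step base

  unrepeated₁ : ∀ b → ∃[ y ] Unrepeated {3 + b} 1 y
  unrepeated₁ b = from (deBruijn-limit {3 + b} zero id (λ n v → step₁ (s≤s (s≤s (s≤s z≤n)))) deBruijn₀)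
    where
    from : ∃[ y ] (∀ n C → C ≤ (3 + b) ^ suc n → ∀ w → length w ≡ suc n → occ {3 + b} w (applyUpTo y C) ≤ 1) →
      ∃[ y ] Unrepeated {3 + b} 1 y
    from (y , once) = y , λ { (suc m) C _ h w ∣w∣ → once m C (≤-trans (≤-reflexive (sym (+-identityʳ C))) h) w ∣w∣ }

  -- The levels 0, 2, 4, ... carry de Bruijn words of the odd orders 1, 3, 5, ....
  unrepeated₂ : ∃[ y ] Unrepeated {2} 2 y
  unrepeated₂ = from (deBruijn-limit {2} zero double (λ n v → step₂) deBruijn₀)
    where
    double : ℕ → ℕ
    double zero    = 0
    double (suc n) = suc (suc (double n))
    halve : ∀ m → ∃[ n ] (m ≡ double n ⊎ m ≡ suc (double n))
    halve zero    = 0 , inj₁ refl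
    halve (suc m) with halve m
    ... | n , inj₁ refl = n , inj₂ refl
    ... | n , inj₂ refl = suc n , inj₁ refl
    from : ∃[ y ] (∀ n C → C ≤ 2 ^ suc (double n) → ∀ w → length w ≡ suc (double n) → occ {2} w (applyUpTo y C) ≤ 1) →
      ∃[ y ] Unrepeated {2} 2 y
    from (y , once) = y , bound
      where
      bound : Unrepeated {2} 2 y
      bound (suc m) C _ h w ∣w∣ with halve m | *-cancelˡ-≤ {C} {2 ^ m} 2 h
      ... | n , inj₁ refl | C≤ = once n C (≤-trans C≤ (m≤n*m (2 ^ double n) 2)) w ∣w∣
      -- For the even length `suc m` the order `m` is used: a word repeats only if its tail of
      -- length `m` does. This allows prefixes up to length `2 ^ m`, half of `2 ^ suc m`.
      bound (suc m) C _ h (c ∷ w) ∣w∣ | n , inj₂ refl | C≤ =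
        ≤-trans (occ-∷ c w (applyUpTo y C)) (once n C C≤ w (suc-injective ∣w∣))

  -- Counting words by multiplicity

  Near : ℕ → ℕ → ℕ → Set
  Near e m n = m ≤ n + e × n ≤ m + e

  near-sym : ∀ {e m n} → Near e m n → Near e n m
  near-sym (p , q) = q , p

  near-trans : ∀ {d e l m n} → Near d l m → Near e m n → Near (d + e) l n
  near-trans {d} {e} {l} {m} {n} (p , q) (p′ , q′) =
    ≤-trans p (≤-trans (+-monoˡ-≤ d p′) (≤-reflexive (trans (+-assoc n e d) (cong (n +_) (+-comm e d))))) ,
    ≤-trans q′ (≤-trans (+-monoˡ-≤ e q) (≤-reflexive (+-assoc l d e)))

  near-weaken : ∀ {d e m n} → d ≤ e → Near d m n → Near e m n
  near-weaken d≤e (p , q) = ≤-trans p (+-monoʳ-≤ _ d≤e) , ≤-trans q (+-monoʳ-≤ _ d≤e)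

  ∑↓-mono : ∀ n {f g : ℕ → ℕ} → (∀ j → j < n → f j ≤ g j) → ∑ (downFrom n) f ≤ ∑ (downFrom n) g
  ∑↓-mono zero    f≤g = z≤n
  ∑↓-mono (suc n) f≤g = +-mono-≤ (f≤g n ≤-refl) (∑↓-mono n (λ j j<n → f≤g j (m≤n⇒m≤1+n j<n)))

  m+n∸o≤m∸o+n : ∀ m n o → m + n ∸ o ≤ (m ∸ o) + n
  m+n∸o≤m∸o+n m n o = m≤n+o⇒m∸n≤o (m + n) o
    (≤-trans (+-monoˡ-≤ n (m≤n+m∸n m o)) (≤-reflexive (+-assoc o (m ∸ o) n)))

  module _ {b : ℕ} where

    count : ℕ → ℕ → (Word b → ℕ) → ℕ
    count k i f = Σʷ k (λ w → ⟦ f w ≟ i ⟧)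

    -- Wherever `f` and `g` differ they differ by at least 1, so there are at most `e` such words.
    count-near : ∀ k i {f g : Word b → ℕ} e → (∀ w → length w ≡ k → f w ≤ g w) → Σʷ k g ≤ Σʷ k f + e →
      Near e (count k i f) (count k i g)
    count-near k i {f} {g} e f≤g Σg≤ = bound pointwiseˡ , bound pointwiseʳ
      where
      Σ∸≤e : Σʷ k (λ w → g w ∸ f w) ≤ e
      Σ∸≤e = +-cancelˡ-≤ (Σʷ k f) _ _ (begin
        Σʷ k f + Σʷ k (λ w → g w ∸ f w)  ≡⟨ ∑-+ (words b k) _ _ ⟨
        Σʷ k (λ w → f w + (g w ∸ f w))   ≡⟨ Σʷ-cong {b} {k} (λ w h → m+[n∸m]≡n (f≤g w h)) ⟩
        Σʷ k g                           ≤⟨ Σg≤ ⟩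
        Σʷ k f + e                       ∎)
        where open ≤-Reasoning
      bound : ∀ {p q : Word b → ℕ} → (∀ w → length w ≡ k → p w ≤ q w + (g w ∸ f w)) → Σʷ k p ≤ Σʷ k q + e
      bound {p} {q} h = begin
        Σʷ k p                            ≤⟨ Σʷ-mono {b} {k} h ⟩
        Σʷ k (λ w → q w + (g w ∸ f w))    ≡⟨ ∑-+ (words b k) _ _ ⟩
        Σʷ k q + Σʷ k (λ w → g w ∸ f w)   ≤⟨ +-monoʳ-≤ (Σʷ k q) Σ∸≤e ⟩
        Σʷ k q + e                        ∎
        where open ≤-Reasoning
      pointwiseˡ : ∀ w → length w ≡ k → ⟦ f w ≟ i ⟧ ≤ ⟦ g w ≟ i ⟧ + (g w ∸ f w)
      pointwiseˡ w h with m≤n⇒m<n∨m≡n (f≤g w h)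
      ... | inj₁ f<g = ≤-trans (⟦⟧≤1 (f w ≟ i)) (≤-trans (m<n⇒0<n∸m f<g) (m≤n+m _ _))
      ... | inj₂ f≡g = ≤-trans (≤-reflexive (cong (λ n → ⟦ n ≟ i ⟧) f≡g)) (m≤m+n _ _)
      pointwiseʳ : ∀ w → length w ≡ k → ⟦ g w ≟ i ⟧ ≤ ⟦ f w ≟ i ⟧ + (g w ∸ f w)
      pointwiseʳ w h with m≤n⇒m<n∨m≡n (f≤g w h)
      ... | inj₁ f<g = ≤-trans (⟦⟧≤1 (g w ≟ i)) (≤-trans (m<n⇒0<n∸m f<g) (m≤n+m _ _))
      ... | inj₂ f≡g = ≤-trans (≤-reflexive (cong (λ n → ⟦ n ≟ i ⟧) (sym f≡g))) (m≤m+n _ _)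

    count-prefix : ∀ k i (s t : Word b) → 1 ≤ k →
      Near (length t) (count k i (λ w → occ w s)) (count k i (λ w → occ w (s ++ t)))
    count-prefix k i s t 1≤k = count-near k i {λ w → occ w s} {λ w → occ w (s ++ t)} (length t)
      (λ w h → ≤-trans (m≤m+n (occ w s) (occ w t)) (occ-superadditive w s t (≤-trans 1≤k (≤-reflexive (sym h)))))
      (begin
        Σʷ k (λ w → occ w (s ++ t))      ≡⟨ Σʷ-occ k (s ++ t) ⟩
        suc (length (s ++ t)) ∸ k        ≡⟨ cong (λ n → suc n ∸ k) (length-++ s) ⟩
        suc (length s) + length t ∸ k    ≤⟨ m+n∸o≤m∸o+n (suc (length s)) (length t) k ⟩
        (suc (length s) ∸ k) + length t  ≡⟨ cong (_+ length t) (Σʷ-occ k s) ⟨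
        Σʷ k (λ w → occ w s) + length t  ∎)
      where open ≤-Reasoning

    count-applyUpTo : ∀ k i (x : ℕ → Fin b) {e m n} → 1 ≤ k → Near e m n →
      Near e (count k i (λ w → occ w (applyUpTo x m))) (count k i (λ w → occ w (applyUpTo x n)))
    count-applyUpTo k i x {e} 1≤k near = go near (≤-total _ _)
      where
      up : ∀ {m n} → m ≤ n → n ≤ m + e →
        Near e (count k i (λ w → occ w (applyUpTo x m))) (count k i (λ w → occ w (applyUpTo x n)))
      up {m} {n} m≤n n≤m+e = subst
        (λ u → Near e (count k i (λ w → occ w (applyUpTo x m))) (count k i (λ w → occ w u)))
        (trans (sym (applyUpTo-+ x m (n ∸ m))) (cong (applyUpTo x) (m+[n∸m]≡n m≤n)))
        (near-weaken (≤-trans (≤-reflexive (length-applyUpTo _ (n ∸ m))) (m≤n+o⇒m∸n≤o n m n≤m+e))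
          (count-prefix k i (applyUpTo x m) _ 1≤k))
      go : ∀ {m n} → Near e m n → m ≤ n ⊎ n ≤ m →
        Near e (count k i (λ w → occ w (applyUpTo x m))) (count k i (λ w → occ w (applyUpTo x n)))
      go (_ , n≤m+e) (inj₁ m≤n) = up m≤n n≤m+e
      go (m≤n+e , _) (inj₂ n≤m) = near-sym (up n≤m m≤n+e)

    -- The block (u , j) stands for suc j consecutive copies of u.
    Block : Set
    Block = Word b × ℕ

    power : ℕ → Word b → Word b
    power r u = concat (replicate r u)

    length-power : ∀ r u → length (power r u) ≡ r * length u
    length-power zero    u = refl
    length-power (suc r) u = trans (length-++ u) (cong (length u +_) (length-power r u))

    occ-power : ∀ w r u → 1 ≤ length w → r * occ w u ≤ occ w (power r u)
    occ-power w zero    u h = z≤n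
    occ-power w (suc r) u h = ≤-trans (+-monoʳ-≤ (occ w u) (occ-power w r u h)) (occ-superadditive w u (power r u) h)

    -- A padding letter after every block makes the spelled words grow.
    spell : Fin b → List Block → Word b
    spell pad []             = []
    spell pad ((u , j) ∷ bs) = power (suc j) u ++ pad ∷ spell pad bs

    -- The multiplicity that a word would have in the spelled word if windows across the ends of
    -- copies were ignored.
    weight : List Block → Word b → ℕ
    weight bs w = ∑ bs (λ (u , j) → suc j * occ w u)

    spell-++ : ∀ pad bs bs′ → spell pad (bs ++ bs′) ≡ spell pad bs ++ spell pad bs′
    spell-++ pad []             bs′ = refl
    spell-++ pad ((u , j) ∷ bs) bs′ = trans (cong (λ s → power (suc j) u ++ pad ∷ s) (spell-++ pad bs bs′))
      (sym (++-assoc (power (suc j) u) _ _))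

    length-spell : ∀ pad bs → length (spell pad bs) ≡ ∑ bs (λ (u , j) → suc j * length u) + length bs
    length-spell pad []             = refl
    length-spell pad ((u , j) ∷ bs) = begin
      length (power (suc j) u ++ pad ∷ spell pad bs)
        ≡⟨ length-++ (power (suc j) u) ⟩
      length (power (suc j) u) + suc (length (spell pad bs))
        ≡⟨ cong₂ (λ m n → m + suc n) (length-power (suc j) u) (length-spell pad bs) ⟩
      suc j * length u + suc (∑ bs (λ (u , j) → suc j * length u) + length bs)
        ≡⟨ rearrange (suc j * length u) _ _ ⟩
      suc j * length u + ∑ bs (λ (u , j) → suc j * length u) + suc (length bs) ∎
      where
      open ≡-Reasoning
      rearrange : ∀ x y z → x + suc (y + z) ≡ x + y + suc z
      rearrange = solve-∀

    weight≤occ : ∀ pad bs w → 1 ≤ length w → weight bs w ≤ occ w (spell pad bs)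
    weight≤occ pad []             w       h = z≤n
    weight≤occ pad ((u , j) ∷ bs) w       h = begin
      suc j * occ w u + weight bs w
        ≤⟨ +-mono-≤ (occ-power w (suc j) u h) (weight≤occ pad bs w h) ⟩
      occ w (power (suc j) u) + occ w (spell pad bs)
        ≤⟨ +-monoʳ-≤ (occ w (power (suc j) u)) (≤-trans (m≤n+m _ (occ w (pad ∷ []))) (occ-superadditive w (pad ∷ []) (spell pad bs) h)) ⟩
      occ w (power (suc j) u) + occ w (pad ∷ spell pad bs)
        ≤⟨ occ-superadditive w (power (suc j) u) _ h ⟩
      occ w (power (suc j) u ++ pad ∷ spell pad bs) ∎
      where open ≤-Reasoning

    Σʷ-blocks : ∀ k (bs : List Block) (c : ℕ → ℕ) →
      Σʷ k (λ w → ∑ bs (λ (u , j) → c j * occ w u)) ≡ ∑ bs (λ (u , j) → c j * (suc (length u) ∸ k))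
    Σʷ-blocks k bs c = trans (∑-swap (words b k) bs _)
      (∑-cong bs (λ (u , j) → trans (∑-*ˡ (words b k) (c j) _) (cong (c j *_) (Σʷ-occ k u))))

    -- An allowance for the windows that `weight` neglects: `k` for each copy of a segment and one
    -- for each padding letter.
    junctions : ℕ → List Block → ℕ
    junctions k bs = ∑ bs (λ (u , j) → k * suc j) + length bs

    -- Since `weight` is a lower bound word by word, it is enough to compare total numbers of
    -- windows; which windows cross a seam does not matter.
    spell-near-weight : ∀ k i pad bs → 1 ≤ k →
      Near (junctions k bs) (count k i (weight bs)) (count k i (λ w → occ w (spell pad bs)))
    spell-near-weight k i pad bs 1≤k = count-near k i (junctions k bs)
      (λ w h → weight≤occ pad bs w (≤-trans 1≤k (≤-reflexive (sym h))))
      (begin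
        Σʷ k (λ w → occ w (spell pad bs))
          ≡⟨ Σʷ-occ k (spell pad bs) ⟩
        suc (length (spell pad bs)) ∸ k
          ≤⟨ ∸-monoʳ-≤ (suc (length (spell pad bs))) 1≤k ⟩
        length (spell pad bs)
          ≡⟨ length-spell pad bs ⟩
        ∑ bs (λ (u , j) → suc j * length u) + length bs
          ≤⟨ +-monoˡ-≤ (length bs) (∑-mono bs bound) ⟩
        ∑ bs (λ (u , j) → suc j * (suc (length u) ∸ k) + k * suc j) + length bs
          ≡⟨ cong (_+ length bs) (∑-+ bs _ _) ⟩
        ∑ bs (λ (u , j) → suc j * (suc (length u) ∸ k)) + ∑ bs (λ (u , j) → k * suc j) + length bs
          ≡⟨ +-assoc (∑ bs (λ (u , j) → suc j * (suc (length u) ∸ k))) _ _ ⟩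
        ∑ bs (λ (u , j) → suc j * (suc (length u) ∸ k)) + junctions k bs
          ≡⟨ cong (_+ junctions k bs) (Σʷ-blocks k bs suc) ⟨
        Σʷ k (weight bs) + junctions k bs ∎)
      where
      open ≤-Reasoning
      bound : ∀ (B : Block) → suc (proj₂ B) * length (proj₁ B) ≤ suc (proj₂ B) * (suc (length (proj₁ B)) ∸ k) + k * suc (proj₂ B)
      bound (u , j) = begin
        suc j * length u                            ≤⟨ *-monoʳ-≤ (suc j) (≤-trans (n≤1+n _) (m≤n+m∸n (suc (length u)) k)) ⟩
        suc j * (k + (suc (length u) ∸ k))          ≡⟨ *-distribˡ-+ (suc j) k _ ⟩
        suc j * k + suc j * (suc (length u) ∸ k)    ≡⟨ +-comm (suc j * k) _ ⟩
        suc j * (suc (length u) ∸ k) + suc j * k    ≡⟨ cong (suc j * (suc (length u) ∸ k) +_) (*-comm (suc j) k) ⟩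
        suc j * (suc (length u) ∸ k) + k * suc j    ∎

    Disjoint : ℕ → List Block → Set
    Disjoint k bs = ∀ w → length w ≡ k → ∑ bs (λ (u , j) → occ w u) ≤ 1

    private
      zero-blocks : ∀ (bs : List Block) w (c : ℕ → ℕ) → ∑ bs (λ (u , j) → occ w u) ≡ 0 → ∑ bs (λ (u , j) → c j * occ w u) ≡ 0
      zero-blocks []             w c h = refl
      zero-blocks ((u , j) ∷ bs) w c h = cong₂ _+_
        (trans (cong (c j *_) (m+n≡0⇒m≡0 (occ w u) h)) (*-zeroʳ (c j))) (zero-blocks bs w c (m+n≡0⇒n≡0 (occ w u) h))

    -- A word lies in at most one segment, and only once; if the label there is `j`, its weight is
    -- `suc j`. The right side is linear in occurrences, so `Σʷ-blocks` can sum it over all words.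
    weight≡suc : ∀ bs i w → ∑ bs (λ (u , j) → occ w u) ≤ 1 →
      ⟦ weight bs w ≟ suc i ⟧ ≡ ∑ bs (λ (u , j) → ⟦ j ≟ i ⟧ * occ w u)
    weight≡suc []             i w h = refl
    weight≡suc ((u , j) ∷ bs) i w h with occ w u
    ... | zero = trans (cong (λ n → ⟦ n + weight bs w ≟ suc i ⟧) (*-zeroʳ (suc j)))
      (trans (weight≡suc bs i w h) (cong (_+ ∑ bs (λ (u , j) → ⟦ j ≟ i ⟧ * occ w u)) (sym (*-zeroʳ ⟦ j ≟ i ⟧))))
    ... | suc zero = trans
      (cong (λ n → ⟦ n ≟ suc i ⟧) (trans (cong₂ _+_ (*-identityʳ (suc j)) (zero-blocks bs w suc none)) (+-identityʳ _)))
      (sym (trans (cong₂ _+_ (*-identityʳ ⟦ j ≟ i ⟧) (zero-blocks bs w (λ j → ⟦ j ≟ i ⟧) none)) (+-identityʳ _)))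
      where
      none = n≤0⇒n≡0 (s≤s⁻¹ h)
    ... | suc (suc _) = contradiction h λ { (s≤s ()) }

    -- A word has weight 0 exactly when no segment contains it. The factor 1 matches the form of
    -- `Σʷ-blocks` with constant coefficients.
    weight≡0 : ∀ bs w → ∑ bs (λ (u , j) → occ w u) ≤ 1 →
      ⟦ weight bs w ≟ 0 ⟧ + ∑ bs (λ (u , j) → 1 * occ w u) ≡ 1
    weight≡0 []             w h = refl
    weight≡0 ((u , j) ∷ bs) w h with occ w u
    ... | zero = trans (cong (λ n → ⟦ n + weight bs w ≟ 0 ⟧ + ∑ bs (λ (u , j) → 1 * occ w u)) (*-zeroʳ (suc j))) (weight≡0 bs w h)
    ... | suc zero = cong suc (zero-blocks bs w (λ _ → 1) (n≤0⇒n≡0 (s≤s⁻¹ h)))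
    ... | suc (suc _) = contradiction h λ { (s≤s ()) }

    -- A segment has at most `k` more letters than windows, even if it is shorter than `k`.
    windows-near : ∀ k (bs : List Block) (c : ℕ → ℕ) → 1 ≤ k → (∀ j → c j ≤ 1) →
      Near (k * length bs) (∑ bs (λ (u , j) → c j * (suc (length u) ∸ k))) (∑ bs (λ (u , j) → c j * length u))
    windows-near k bs c 1≤k c≤1 =
      ≤-trans (∑-mono bs (λ (u , j) → *-monoʳ-≤ (c j) (∸-monoʳ-≤ (suc (length u)) 1≤k))) (m≤m+n _ _) ,
      (begin
        ∑ bs (λ (u , j) → c j * length u)
          ≤⟨ ∑-mono bs (λ (u , j) → *-monoʳ-≤ (c j) (≤-trans (n≤1+n _) (m≤n+m∸n (suc (length u)) k))) ⟩
        ∑ bs (λ (u , j) → c j * (k + (suc (length u) ∸ k)))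
          ≤⟨ ∑-mono bs (λ (u , j) → ≤-trans (≤-reflexive (*-distribˡ-+ (c j) k _)) (+-monoˡ-≤ _ (≤-trans (*-monoˡ-≤ k (c≤1 j)) (≤-reflexive (*-identityˡ k))))) ⟩
        ∑ bs (λ (u , j) → k + c j * (suc (length u) ∸ k))
          ≡⟨ ∑-+ bs (λ _ → k) _ ⟩
        ∑ bs (λ _ → k) + ∑ bs (λ (u , j) → c j * (suc (length u) ∸ k))
          ≡⟨ trans (+-comm (∑ bs (λ _ → k)) _) (cong (∑ bs (λ (u , j) → c j * (suc (length u) ∸ k)) +_) (trans (∑-const bs k) (*-comm (length bs) k))) ⟩
        ∑ bs (λ (u , j) → c j * (suc (length u) ∸ k)) + k * length bs ∎)
      where open ≤-Reasoning

    count-weight-suc : ∀ k i bs → 1 ≤ k → Disjoint k bs →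
      Near (k * length bs) (count k (suc i) (weight bs)) (∑ bs (λ (u , j) → ⟦ j ≟ i ⟧ * length u))
    count-weight-suc k i bs 1≤k disjoint = subst
      (λ n → Near (k * length bs) n (∑ bs (λ (u , j) → ⟦ j ≟ i ⟧ * length u)))
      (sym (trans (Σʷ-cong {b} {k} (λ w h → weight≡suc bs i w (disjoint w h))) (Σʷ-blocks k bs (λ j → ⟦ j ≟ i ⟧))))
      (windows-near k bs (λ j → ⟦ j ≟ i ⟧) 1≤k (λ j → ⟦⟧≤1 (j ≟ i)))

    count-weight-zero : ∀ k bs → 1 ≤ k → Disjoint k bs →
      Near (k * length bs) (count k 0 (weight bs) + ∑ bs (λ (u , j) → 1 * length u)) (b ^ k)
    count-weight-zero k bs 1≤k disjoint with windows-near k bs (λ _ → 1) 1≤k (λ _ → ≤-refl)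
    ... | p , q =
      ≤-trans (+-monoʳ-≤ (count k 0 (weight bs)) q) (≤-reflexive (trans (sym (+-assoc (count k 0 (weight bs)) _ _)) (cong (_+ k * length bs) total))) ,
      ≤-trans (≤-reflexive (sym total)) (≤-trans (+-monoʳ-≤ (count k 0 (weight bs)) p) (≤-reflexive (sym (+-assoc (count k 0 (weight bs)) _ _))))
      where
      total : count k 0 (weight bs) + ∑ bs (λ (u , j) → 1 * (suc (length u) ∸ k)) ≡ b ^ k
      total = begin
        count k 0 (weight bs) + ∑ bs (λ (u , j) → 1 * (suc (length u) ∸ k))
          ≡⟨ cong (count k 0 (weight bs) +_) (Σʷ-blocks k bs (λ _ → 1)) ⟨
        count k 0 (weight bs) + Σʷ k (λ w → ∑ bs (λ (u , j) → 1 * occ w u))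
          ≡⟨ ∑-+ (words b k) _ _ ⟨
        Σʷ k (λ w → ⟦ weight bs w ≟ 0 ⟧ + ∑ bs (λ (u , j) → 1 * occ w u))
          ≡⟨ Σʷ-cong {b} {k} (λ w h → weight≡0 bs w (disjoint w h)) ⟩
        Σʷ {b} k (λ _ → 1)
          ≡⟨ Σʷ-1 {b} k ⟩
        b ^ k ∎
        where open ≡-Reasoning

  ∑↓-pick : ∀ n i (f : ℕ → ℕ) → i < n → ∑ (downFrom n) (λ j → ⟦ j ≟ i ⟧ * f j) ≡ f i
  ∑↓-pick (suc n) i f i<1+n with m≤n⇒m<n∨m≡n (s≤s⁻¹ i<1+n)
  ... | inj₁ i<n  = trans (cong (λ d → d * f n + ∑ (downFrom n) (λ j → ⟦ j ≟ i ⟧ * f j)) (⟦⟧-no (n ≟ i) (>⇒≢ i<n))) (∑↓-pick n i f i<n)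
  ... | inj₂ refl = trans (cong₂ _+_ (trans (cong (_* f n) (⟦⟧-yes (n ≟ n) refl)) (*-identityˡ (f n))) (none n ≤-refl)) (+-identityʳ (f n))
    where
    none : ∀ m → m ≤ n → ∑ (downFrom m) (λ j → ⟦ j ≟ n ⟧ * f j) ≡ 0
    none zero    _   = refl
    none (suc m) m<n = cong₂ _+_ (cong (_* f m) (⟦⟧-no (m ≟ n) (<⇒≢ m<n))) (none m (<⇒≤ m<n))

  module _ {b : ℕ} where

    cut : (ℕ → Fin b) → List (ℕ × ℕ) → List (Word b × ℕ)
    cut y []            = []
    cut y ((n , j) ∷ l) = (applyUpTo y n , j) ∷ cut (y ∘ (n +_)) l

    ∑-cut : ∀ (g : ℕ → ℕ → ℕ) y l → ∑ (cut y l) (λ (u , j) → g j (length u)) ≡ ∑ l (λ (n , j) → g j n)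
    ∑-cut g y []            = refl
    ∑-cut g y ((n , j) ∷ l) = cong₂ _+_ (cong (g j) (length-applyUpTo y n)) (∑-cut g (y ∘ (n +_)) l)

    length-cut : ∀ y l → length (cut y l) ≡ length l
    length-cut y []            = refl
    length-cut y ((n , j) ∷ l) = cong suc (length-cut (y ∘ (n +_)) l)

    cut-++ : ∀ y l l′ → ∃[ bs ] cut y (l ++ l′) ≡ cut y l ++ bs × length bs ≡ length l′
    cut-++ y []            l′ = cut y l′ , refl , length-cut y l′
    cut-++ y ((n , j) ∷ l) l′ with cut-++ (y ∘ (n +_)) l l′
    ... | bs , eq , len = bs , cong ((applyUpTo y n , j) ∷_) eq , len

    -- The segments are consecutive and make up a prefix of `y`, so that `Disjoint` will follow from
    -- `Unrepeated`.
    occ-cut : ∀ w y l → 1 ≤ length w → ∑ (cut y l) (λ (u , j) → occ w u) ≤ occ w (applyUpTo y (∑ l proj₁))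
    occ-cut w y []            h = z≤n
    occ-cut w y ((n , j) ∷ l) h = begin
      occ w (applyUpTo y n) + ∑ (cut (y ∘ (n +_)) l) (λ (u , j) → occ w u)
        ≤⟨ +-monoʳ-≤ (occ w (applyUpTo y n)) (occ-cut w (y ∘ (n +_)) l h) ⟩
      occ w (applyUpTo y n) + occ w (applyUpTo (y ∘ (n +_)) (∑ l proj₁))
        ≤⟨ occ-superadditive w (applyUpTo y n) _ h ⟩
      occ w (applyUpTo y n ++ applyUpTo (y ∘ (n +_)) (∑ l proj₁))
        ≡⟨ cong (occ w) (applyUpTo-+ y n _) ⟨
      occ w (applyUpTo y (n + ∑ l proj₁)) ∎
      where open ≤-Reasoning

  -- In this order: the `k ∸ 1` letters that complete the last window read by `Z`, the padding
  -- letters, the bound for `junctions` in two summands, and `k` for each of at most `k * k`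
  -- segments when windows are replaced by letters.
  error : ℕ → ℕ
  error k = k + k * k + (k * k * (k * k) + k * k + k * (k * k))

  -- A k j is the number of letters of y that have multiplicity suc j in the first
  -- k stages.
  module Construction {b h : ℕ} (pad : Fin b) (y : ℕ → Fin b) (unrepeated : Unrepeated h y)
    (A : ℕ → ℕ → ℕ) (A-zero : ∀ j → A 0 j ≡ 0) (A-mono : ∀ k j → A k j ≤ A (suc k) j)
    (A-support : ∀ k → A k k ≡ 0) (A-fits : ∀ k → h * ∑ (downFrom k) (A k) ≤ b ^ k) where

    -- Stage `k` serves the labels up to `k`, so every label is served from some stage on although
    -- each stage is finite. A segment may be empty; its padding letter is still spelled.
    stage-cuts cuts : ℕ → List (ℕ × ℕ)
    stage-cuts k = map (λ j → A (suc k) j ∸ A k j , j) (downFrom (suc k))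
    cuts zero    = []
    cuts (suc k) = cuts k ++ stage-cuts k

    prefix : ℕ → Word b
    prefix k = spell pad (cut y (cuts k))

    extends : ∀ k → ∃[ t ] 1 ≤ length t × prefix (suc k) ≡ prefix k ++ t
    extends k with cut-++ y (cuts k) (stage-cuts k)
    ... | bs , eq , len = spell pad bs , (begin
        1                                                     ≤⟨ s≤s z≤n ⟩
        length (stage-cuts k)                                 ≡⟨ len ⟨
        length bs                                             ≤⟨ m≤n+m _ _ ⟩
        ∑ bs (λ (u , j) → suc j * length u) + length bs       ≡⟨ length-spell pad bs ⟨
        length (spell pad bs)                                 ∎)
      , trans (cong (spell pad) eq) (spell-++ pad (cut y (cuts k)) bs)
      where open ≤-Reasoning

    open Limit pad prefix extends using (limit; limit-prefix) public

    -- The increments telescope. The label `k` is new at stage `k`, and `A-support` says that its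
    -- old value is 0.
    ∑-cuts : ∀ k (c : ℕ → ℕ) → ∑ (cuts k) (λ (n , j) → c j * n) ≡ ∑ (downFrom k) (λ j → c j * A k j)
    ∑-cuts zero    c = refl
    ∑-cuts (suc k) c = begin
      ∑ (cuts k ++ stage-cuts k) (λ (n , j) → c j * n)
        ≡⟨ ∑-++ (cuts k) (stage-cuts k) _ ⟩
      ∑ (cuts k) (λ (n , j) → c j * n) + ∑ (stage-cuts k) (λ (n , j) → c j * n)
        ≡⟨ cong₂ _+_ (∑-cuts k c) (∑-map _ (downFrom (suc k)) (λ (n , j) → c j * n)) ⟩
      ∑ (downFrom k) (λ j → c j * A k j) + ∑ (downFrom (suc k)) (λ j → c j * (A (suc k) j ∸ A k j))
        ≡⟨ cong (λ n → n + ∑ (downFrom k) (λ j → c j * A k j) + ∑ (downFrom (suc k)) (λ j → c j * (A (suc k) j ∸ A k j)))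
             (trans (cong (c k *_) (A-support k)) (*-zeroʳ (c k))) ⟨
      ∑ (downFrom (suc k)) (λ j → c j * A k j) + ∑ (downFrom (suc k)) (λ j → c j * (A (suc k) j ∸ A k j))
        ≡⟨ ∑-+ (downFrom (suc k)) (λ j → c j * A k j) (λ j → c j * (A (suc k) j ∸ A k j)) ⟨
      ∑ (downFrom (suc k)) (λ j → c j * A k j + c j * (A (suc k) j ∸ A k j))
        ≡⟨ ∑-cong (downFrom (suc k)) (λ j → trans (sym (*-distribˡ-+ (c j) (A k j) _)) (cong (c j *_) (m+[n∸m]≡n (A-mono k j)))) ⟩
      ∑ (downFrom (suc k)) (λ j → c j * A (suc k) j) ∎
      where open ≡-Reasoning

    ∑-cut-cuts : ∀ k (c : ℕ → ℕ) → ∑ (cut y (cuts k)) (λ (u , j) → c j * length u) ≡ ∑ (downFrom k) (λ j → c j * A k j)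
    ∑-cut-cuts k c = trans (∑-cut (λ j n → c j * n) y (cuts k)) (∑-cuts k c)

    private
      square : ∀ k → k * k + suc k ≤ suc k * suc k
      square k = ≤-trans (m≤m+n (k * k + suc k) k) (≤-reflexive (lemma k))
        where
        lemma : ∀ k → k * k + suc k + k ≡ suc k * suc k
        lemma = solve-∀

    length-cuts : ∀ k → length (cuts k) ≤ k * k
    length-cuts zero    = z≤n
    length-cuts (suc k) = begin
      length (cuts k ++ stage-cuts k)          ≡⟨ length-++ (cuts k) ⟩
      length (cuts k) + length (stage-cuts k)  ≤⟨ +-mono-≤ (length-cuts k) (≤-reflexive (trans (length-map _ (downFrom (suc k))) (length-downFrom (suc k)))) ⟩
      k * k + suc k                            ≤⟨ square k ⟩
      suc k * suc k                            ∎
      where open ≤-Reasoning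

    -- The coefficient `K` must stay fixed while the induction runs over the stages `k`; the case of
    -- interest is `K = k`.
    multiplicities : ∀ K k → k ≤ K → ∑ (cuts k) (λ (n , j) → K * suc j) ≤ k * k * (K * K)
    multiplicities K zero    _   = z≤n
    multiplicities K (suc k) k<K = begin
      ∑ (cuts k ++ stage-cuts k) (λ (n , j) → K * suc j)
        ≡⟨ ∑-++ (cuts k) (stage-cuts k) _ ⟩
      ∑ (cuts k) (λ (n , j) → K * suc j) + ∑ (stage-cuts k) (λ (n , j) → K * suc j)
        ≤⟨ +-mono-≤ (multiplicities K k (<⇒≤ k<K)) (≤-reflexive (∑-map _ (downFrom (suc k)) (λ (n , j) → K * suc j))) ⟩
      k * k * (K * K) + ∑ (downFrom (suc k)) (λ j → K * suc j)
        ≤⟨ +-monoʳ-≤ (k * k * (K * K)) (∑↓-mono (suc k) (λ j j≤k → *-monoʳ-≤ K (≤-trans j≤k k<K))) ⟩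
      k * k * (K * K) + ∑ (downFrom (suc k)) (λ j → K * K)
        ≡⟨ cong (k * k * (K * K) +_) (trans (∑-const (downFrom (suc k)) (K * K)) (cong (_* (K * K)) (length-downFrom (suc k)))) ⟩
      k * k * (K * K) + suc k * (K * K)
        ≡⟨ *-distribʳ-+ (K * K) (k * k) (suc k) ⟨
      (k * k + suc k) * (K * K)
        ≤⟨ *-monoˡ-≤ (K * K) (square k) ⟩
      suc k * suc k * (K * K) ∎
      where open ≤-Reasoning

    junctions-cuts : ∀ k → junctions k (cut y (cuts k)) ≤ k * k * (k * k) + k * k
    junctions-cuts k = +-mono-≤
      (≤-trans (≤-reflexive (∑-cut (λ j n → k * suc j) y (cuts k))) (multiplicities k k ≤-refl))
      (≤-trans (≤-reflexive (length-cut y (cuts k))) (length-cuts k))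

    cuts-disjoint : ∀ k → 1 ≤ k → Disjoint k (cut y (cuts k))
    cuts-disjoint k 1≤k w ∣w∣ = ≤-trans (occ-cut w y (cuts k) (≤-trans 1≤k (≤-reflexive (sym ∣w∣))))
      (unrepeated k (∑ (cuts k) proj₁) 1≤k (≤-trans (≤-reflexive (cong (h *_) total)) (A-fits k)) w ∣w∣)
      where
      total : ∑ (cuts k) proj₁ ≡ ∑ (downFrom k) (A k)
      total = trans (∑-cong (cuts k) (λ (n , j) → sym (*-identityˡ n)))
        (trans (∑-cuts k (λ _ → 1)) (∑-cong (downFrom k) (λ j → *-identityˡ (A k j))))

    -- The number `ℓ` stands for the floor in `Z`, which reads `ℓ + k ∸ 1` letters. Besides `D` only
    -- the letters of the last window and one padding letter per segment intervene.
    length-prefix-near : ∀ k {D ℓ} → 1 ≤ k → Near D ℓ (∑ (downFrom k) (λ j → suc j * A k j)) →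
      Near (D + (k + k * k)) (ℓ + k ∸ 1) (length (prefix k))
    length-prefix-near k {D} {ℓ} 1≤k (p , q) = subst (Near (D + (k + k * k)) (ℓ + k ∸ 1)) (sym length≡)
      ( (begin
          ℓ + k ∸ 1                     ≤⟨ m∸n≤m (ℓ + k) 1 ⟩
          ℓ + k                         ≤⟨ +-monoˡ-≤ k p ⟩
          S + D + k                     ≤⟨ m≤m+n _ (len + k * k) ⟩
          S + D + k + (len + k * k)     ≡⟨ rearrange S D k len (k * k) ⟩
          S + len + (D + (k + k * k))   ∎)
      , (begin
          S + len                       ≤⟨ +-mono-≤ q (length-cuts k) ⟩
          ℓ + D + k * k                 ≡⟨ rearrange′ ℓ D (k * k) ⟩
          ℓ + (D + k * k)               ≤⟨ +-mono-≤ (ℓ≤ k 1≤k) (+-monoʳ-≤ D (m≤n+m (k * k) k)) ⟩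
          ℓ + k ∸ 1 + (D + (k + k * k)) ∎) )
      where
      open ≤-Reasoning
      S = ∑ (downFrom k) (λ j → suc j * A k j)
      len = length (cuts k)
      length≡ : length (prefix k) ≡ S + len
      length≡ = trans (length-spell pad (cut y (cuts k))) (cong₂ _+_ (∑-cut-cuts k suc) (length-cut y (cuts k)))
      ℓ≤ : ∀ k → 1 ≤ k → ℓ ≤ ℓ + k ∸ 1
      ℓ≤ (suc k) _ = ≤-trans (m≤m+n ℓ k) (≤-reflexive (cong (_∸ 1) (sym (+-suc ℓ k))))
      rearrange : ∀ s d k l m → s + d + k + (l + m) ≡ s + l + (d + (k + m))
      rearrange = solve-∀
      rearrange′ : ∀ l d m → l + d + m ≡ l + (d + m)
      rearrange′ = solve-∀

    module _ (k D ℓ : ℕ) (1≤k : 1 ≤ k) (ℓ-near : Near D ℓ (∑ (downFrom k) (λ j → suc j * A k j))) where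

      count-limit : ℕ → ℕ
      count-limit i = count k i (λ w → occ w (applyUpTo limit (ℓ + k ∸ 1)))

      -- The prefix that `Z` reads is compared with the prefix built by stage `k`, and this in turn
      -- with the idealised `weight`.
      count-limit-near : ∀ i → Near (D + (k + k * k) + (k * k * (k * k) + k * k)) (count-limit i) (count k i (weight (cut y (cuts k))))
      count-limit-near i = near-trans
        (count-applyUpTo k i limit 1≤k (length-prefix-near k 1≤k ℓ-near))
        (near-sym (near-weaken (junctions-cuts k) (subst
          (λ v → Near (junctions k (cut y (cuts k))) (count k i (weight (cut y (cuts k)))) (count k i (λ w → occ w v)))
          (sym (trans (limit-prefix k (length (prefix k)) ≤-refl) (take-all (length (prefix k)) (prefix k) ≤-refl)))
          (spell-near-weight k i pad (cut y (cuts k)) 1≤k))))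

      regroup : D + (k + k * k) + (k * k * (k * k) + k * k) + k * length (cut y (cuts k)) ≤ D + error k
      regroup = ≤-trans (+-monoʳ-≤ _ (*-monoʳ-≤ k (≤-trans (≤-reflexive (length-cut y (cuts k))) (length-cuts k))))
        (≤-reflexive (lemma D (k + k * k) (k * k * (k * k) + k * k) (k * (k * k))))
        where
        lemma : ∀ d x y z → d + x + y + z ≡ d + (x + (y + z))
        lemma = solve-∀

      count-suc : ∀ i → i < k → Near (D + error k) (count-limit (suc i)) (A k i)
      count-suc i i<k = near-weaken regroup (near-trans (count-limit-near (suc i))
        (subst (Near (k * length (cut y (cuts k))) (count k (suc i) (weight (cut y (cuts k)))))
          (trans (∑-cut-cuts k (λ j → ⟦ j ≟ i ⟧)) (∑↓-pick k i (A k) i<k))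
          (count-weight-suc k i (cut y (cuts k)) 1≤k (cuts-disjoint k 1≤k))))

      count-zero : Near (D + error k) (count-limit 0 + ∑ (downFrom k) (A k)) (b ^ k)
      count-zero = near-weaken regroup (near-trans (near-+ (count-limit-near 0))
        (subst (λ n → Near (k * length (cut y (cuts k))) (count k 0 (weight (cut y (cuts k))) + n) (b ^ k))
          (trans (∑-cut-cuts k (λ _ → 1)) (∑-cong (downFrom k) (λ j → *-identityˡ (A k j))))
          (count-weight-zero k (cut y (cuts k)) 1≤k (cuts-disjoint k 1≤k))))
        where
        near-+ : ∀ {e m n s} → Near e m n → Near e (m + s) (n + s)
        near-+ {e} {m} {n} {s} (p , q) =
          ≤-trans (+-monoˡ-≤ s p) (≤-reflexive (swap n e s)) , ≤-trans (+-monoˡ-≤ s q) (≤-reflexive (swap m e s))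
          where
          swap : ∀ x y z → x + y + z ≡ x + z + y
          swap = solve-∀

  -- Agreement with the counts in the statement

  module _ {b : ℕ} where

    -- The range in `occurrences` stops at the last position with room for `w`; at the later ones
    -- `pre` is 0.
    occurrences≡occ : ∀ (v w : Word b) → occurrences v w ≡ occ w v
    occurrences≡occ v w = trans (length-filter≡∑ (λ i → take (length w) (drop i v) ≟ʷ w) (upTo (suc (length v) ∸ length w))) (go v)
      where
      _≟ʷ_ = ≡-dec Fin._≟_
      ⟦_at_⟧ : Word b → Word b → ℕ
      ⟦ w at v ⟧ = ⟦ take (length w) v ≟ʷ w ⟧
      ≟ʷ-∷ : ∀ a c x w → ⟦ (c ∷ x) ≟ʷ (a ∷ w) ⟧ ≡ ⟦ a Fin.≟ c ⟧ * ⟦ x ≟ʷ w ⟧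
      ≟ʷ-∷ a c x w with a Fin.≟ c
      ... | no a≢c   = ⟦⟧-no ((c ∷ x) ≟ʷ (a ∷ w)) (a≢c ∘ sym ∘ ∷-injectiveˡ)
      ... | yes refl = trans (cong (λ d → if d ∧ does (x ≟ʷ w) then 1 else 0) (dec-true (a Fin.≟ a) refl)) (sym (*-identityˡ _))
      at≡pre : ∀ w v → length w ≤ length v → ⟦ w at v ⟧ ≡ pre w v
      at≡pre []      v       h = refl
      at≡pre (a ∷ w) (c ∷ v) h = trans (≟ʷ-∷ a c (take (length w) v) w)
        (cong (⟦ a Fin.≟ c ⟧ *_) (at≡pre w v (s≤s⁻¹ h)))
      shift : ∀ c v n → ∑ (applyUpTo suc n) (λ i → ⟦ w at drop i (c ∷ v) ⟧) ≡ ∑ (upTo n) (λ i → ⟦ w at drop i v ⟧)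
      shift c v n = trans (cong (λ xs → ∑ xs (λ i → ⟦ w at drop i (c ∷ v) ⟧)) (sym (map-applyUpTo id suc n))) (∑-map suc (upTo n) _)
      go : ∀ v → ∑ (upTo (suc (length v) ∸ length w)) (λ i → ⟦ w at drop i v ⟧) ≡ occ w v
      go v with length w ≤? length v
      ... | no ≰ = trans (cong (λ n → ∑ (upTo n) (λ i → ⟦ w at drop i v ⟧)) (m≤n⇒m∸n≡0 (≰⇒> ≰))) (sym (occ-short w v (≰⇒> ≰)))
      go [] | yes h = trans (cong (λ n → ∑ (upTo n) (λ i → ⟦ w at drop i [] ⟧)) (cong (1 ∸_) (n≤0⇒n≡0 h)))
        (trans (+-identityʳ _) (at≡pre w [] h))
      go (c ∷ v) | yes h = begin
        ∑ (upTo (suc (suc (length v)) ∸ length w)) (λ i → ⟦ w at drop i (c ∷ v) ⟧)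
          ≡⟨ cong (λ n → ∑ (upTo n) (λ i → ⟦ w at drop i (c ∷ v) ⟧)) (+-∸-assoc 1 h) ⟩
        ⟦ w at c ∷ v ⟧ + ∑ (applyUpTo suc (suc (length v) ∸ length w)) (λ i → ⟦ w at drop i (c ∷ v) ⟧)
          ≡⟨ cong₂ _+_ (at≡pre w (c ∷ v) h) (trans (shift c v (suc (length v) ∸ length w)) (go v)) ⟩
        pre w (c ∷ v) + occ w v ∎
        where open ≡-Reasoning

    wordsOccurring≡count : ∀ i k (v : Word b) → wordsOccurring i k v ≡ count k i (λ w → occ w v)
    wordsOccurring≡count i k v = trans (length-filter≡∑ (λ w → occurrences v (toList w) ≟ i) (words b k))
      (∑-cong (words b k) (λ w → cong (λ n → ⟦ n ≟ i ⟧) (occurrences≡occ v (toList w))))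

  -- Added to `error`: `3 * suc k` for rounding the numbers of letters and their sum, the same
  -- rounding weighted by multiplicity for the length of the word, and 1 for the floor.
  total-error : ℕ → ℕ
  total-error k = error k + 3 * suc k + ∑ (downFrom k) (λ j → suc j * 3) + 1

  n<2^n : ∀ n → suc n ≤ 2 ^ n
  n<2^n zero    = ≤-refl
  n<2^n (suc n) = ≤-trans (+-mono-≤ (>-nonZero⁻¹ (2 ^ n) {{m^n≢0 2 n}}) (n<2^n n)) (≤-reflexive (cong (2 ^ n +_) (sym (+-identityʳ _))))

  -- With `q = k / 5`, the bound `suc q ≤ 2 ^ q` gives `suc k ≤ 5 * 2 ^ q`; then fifth powers are
  -- taken.
  suc^5≤2^ : ∀ k → suc k ^ 5 ≤ 5 ^ 5 * 2 ^ k
  suc^5≤2^ k = begin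
    suc k ^ 5                ≤⟨ ^-monoˡ-≤ 5 k<5*2^q ⟩
    (5 * 2 ^ q) ^ 5          ≡⟨ fifth-power (2 ^ q) ⟩
    5 ^ 5 * (2 ^ q) ^ 5      ≡⟨ cong (5 ^ 5 *_) (^-*-assoc 2 q 5) ⟩
    5 ^ 5 * 2 ^ (q * 5)      ≤⟨ *-monoʳ-≤ (5 ^ 5) (^-monoʳ-≤ 2 (m/n*n≤m k 5)) ⟩
    5 ^ 5 * 2 ^ k            ∎
    where
    open ≤-Reasoning
    fifth-power : ∀ y → 5 * y * (5 * y * (5 * y * (5 * y * (5 * y * 1)))) ≡ 3125 * (y * (y * (y * (y * (y * 1)))))
    fifth-power = solve-∀
    q = k / 5
    k<5*2^q : suc k ≤ 5 * 2 ^ q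
    k<5*2^q = begin
      suc k                ≡⟨ cong suc (m≡m%n+[m/n]*n k 5) ⟩
      suc (k % 5) + q * 5  ≤⟨ +-monoˡ-≤ (q * 5) (m%n<n k 5) ⟩
      suc q * 5            ≤⟨ *-monoˡ-≤ 5 (n<2^n q) ⟩
      2 ^ q * 5            ≡⟨ *-comm (2 ^ q) 5 ⟩
      5 * 2 ^ q            ∎

  -- The error has degree 4. The additional factor `suc k` shows that its quotient by `2 ^ k` is at
  -- most `C / suc k` and tends to 0.
  total-error-growth : ∃[ C ] (∀ k → suc k * total-error k ≤ C * 2 ^ k)
  total-error-growth = 12 * 5 ^ 5 , λ k → begin
    suc k * total-error k              ≤⟨ *-monoʳ-≤ (suc k) (quartic k) ⟩
    suc k * (12 * suc k ^ 4)           ≡⟨ rearrange (suc k) (suc k ^ 4) ⟩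
    12 * suc k ^ 5                     ≤⟨ *-monoʳ-≤ 12 (suc^5≤2^ k) ⟩
    12 * (5 ^ 5 * 2 ^ k)               ≡⟨ *-assoc 12 (5 ^ 5) (2 ^ k) ⟨
    12 * 5 ^ 5 * 2 ^ k                 ∎
    where
    open ≤-Reasoning
    rearrange : ∀ x y → x * (12 * y) ≡ 12 * (x * y)
    rearrange = solve-∀
    quartic : ∀ k → total-error k ≤ 12 * suc k ^ 4
    quartic k = begin
      error k + 3 * suc k + ∑ (downFrom k) (λ j → suc j * 3) + 1
        ≤⟨ +-monoˡ-≤ 1 (+-monoʳ-≤ (error k + 3 * suc k) (≤-trans (∑↓-mono k (λ j j<k → *-monoˡ-≤ 3 j<k))
             (≤-reflexive (trans (∑-const (downFrom k) (k * 3)) (cong (_* (k * 3)) (length-downFrom k)))))) ⟩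
      error k + 3 * suc k + k * (k * 3) + 1
        -- The added polynomial is the difference of 12 (k + 1)^4 and k^4 + k^3 + 5 k^2 + 4 k + 4,
        -- with non-negative coefficients.
        ≤⟨ m≤m+n _ (11 * (k * k * (k * k)) + 47 * (k * (k * k)) + 67 * (k * k) + 44 * k + 8) ⟩
      error k + 3 * suc k + k * (k * 3) + 1 + (11 * (k * k * (k * k)) + 47 * (k * (k * k)) + 67 * (k * k) + 44 * k + 8)
        ≡⟨ expand k ⟩
      12 * suc k ^ 4 ∎
      where
      expand : ∀ k → k + k * k + (k * k * (k * k) + k * k + k * (k * k)) + 3 * suc k + k * (k * 3) + 1
        + (11 * (k * k * (k * k)) + 47 * (k * (k * k)) + 67 * (k * k) + 44 * k + 8) ≡ 12 * (suc k * (suc k * (suc k * (suc k * 1))))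
      expand = solve-∀

import Data.Integer.Base as ℤ
import Data.Integer.Properties as ℤ
import Data.Nat.Base as ℕ
import Data.Nat.Properties as ℕ
import Data.Rational.Base as ℚ
import Data.Rational.Properties as ℚ
import Data.Rational.Unnormalised.Base as ℚᵘ
import Data.Rational.Unnormalised.Properties as ℚᵘ
open import Data.Fin.Base using (Fin; zero)
open import Data.Integer.Base using (+_)
open import Data.Integer.Tactic.RingSolver using (solve-∀)
open import Data.List.Base using (downFrom; applyUpTo)
open import Data.List.Properties using (length-downFrom)
open import Data.Nat.Base using (ℕ; zero; suc; NonTrivial; NonZero)
open import Data.Product.Base using (Σ-syntax; ∃-syntax; _×_; _,_; proj₁; proj₂)
open import Data.Rational.Base using (ℚ; 0ℚ; 1ℚ; ½)
open import Data.Rational.Solver using (module +-*-Solver)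
open import Data.Sum.Base using (_⊎_; inj₁; inj₂)
open import Defs
open import Relation.Binary.PropositionalEquality
open import Relation.Nullary using (Dec; yes; no; contradiction)
open ℚ-Lemmas
open ℝ-Lemmas
open Combinatorics

-- Real inequalities

-- The fraction `n / 1` unfolds to a gcd computation; it is sealed so that only the laws below are
-- used.
opaque
  ι : ℕ → ℚ
  ι n = + n ℚ./ 1

  ι≡/1 : ∀ n → ι n ≡ + n ℚ./ 1
  ι≡/1 n = refl

  ι0≡0 : ι 0 ≡ 0ℚ
  ι0≡0 = refl

  ι1≡1 : ι 1 ≡ 1ℚ
  ι1≡1 = refl

  ι-mono : ∀ {m n} → m ℕ.≤ n → ι m ℚ.≤ ι n
  ι-mono = /1-mono-≤

  ι-archimedean : ∀ q → ∃[ n ] q ℚ.≤ ι n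
  ι-archimedean = archimedean

  toℚᵘ-ι : ∀ n → ℚ.toℚᵘ (ι n) ℚᵘ.≃ ℚᵘ.mkℚᵘ (+ n) 0
  toℚᵘ-ι n = ℚ.toℚᵘ-fromℚᵘ (ℚᵘ.mkℚᵘ (+ n) 0)

  ι-+ : ∀ m n → ι (m ℕ.+ n) ≡ ι m ℚ.+ ι n
  ι-+ m n = ℚ.toℚᵘ-injective (ℚᵘ.≃-trans (toℚᵘ-ι (m ℕ.+ n)) (ℚᵘ.≃-sym
    (ℚᵘ.≃-trans (ℚ.toℚᵘ-homo-+ (ι m) (ι n)) (ℚᵘ.≃-trans (ℚᵘ.+-cong (toℚᵘ-ι m) (toℚᵘ-ι n))
      (ℚᵘ.*≡* (cong (ℤ._* + 1) (cong₂ ℤ._+_ (ℤ.*-identityʳ (+ m)) (ℤ.*-identityʳ (+ n)))))))))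

  ι-* : ∀ m n → ι (m ℕ.* n) ≡ ι m ℚ.* ι n
  ι-* m n = ℚ.toℚᵘ-injective (ℚᵘ.≃-trans (toℚᵘ-ι (m ℕ.* n)) (ℚᵘ.≃-sym
    (ℚᵘ.≃-trans (ℚ.toℚᵘ-homo-* (ι m) (ι n)) (ℚᵘ.≃-trans (ℚᵘ.*-cong (toℚᵘ-ι m) (toℚᵘ-ι n))
      (ℚᵘ.*≡* (cong (ℤ._* + 1) (sym (ℤ.pos-* m n))))))))

  ι*[c/d] : ∀ c d .{{_ : NonZero d}} → ι d ℚ.* (+ c ℚ./ d) ≡ ι c
  ι*[c/d] c (suc d) = ℚ.toℚᵘ-injective (ℚᵘ.≃-trans (ℚ.toℚᵘ-homo-* (ι (suc d)) (+ c ℚ./ suc d))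
    (ℚᵘ.≃-trans (ℚᵘ.*-cong (toℚᵘ-ι (suc d)) (ℚ.toℚᵘ-fromℚᵘ (ℚᵘ.mkℚᵘ (+ c) d)))
      (ℚᵘ.≃-trans (ℚᵘ.*≡* (lemma (+ suc d) (+ c))) (ℚᵘ.≃-sym (toℚᵘ-ι c)))))
    where
    lemma : ∀ x y → x ℤ.* y ℤ.* + 1 ≡ y ℤ.* (+ 1 ℤ.* x)
    lemma = solve-∀

  0≤ι : ∀ n → 0ℚ ℚ.≤ ι n
  0≤ι n = ι-mono {0} {n} ℕ.z≤n

  0<ι : ∀ n → 1 ℕ.≤ n → 0ℚ ℚ.< ι n
  0<ι n 1≤n = ℚ.<-≤-trans (ℚ.positive⁻¹ 1ℚ) (ι-mono {1} {n} 1≤n)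

  ι-cancel-≤ : ∀ m n → ι m ℚ.≤ ι n → m ℕ.≤ n
  ι-cancel-≤ m n ιm≤ιn with m ℕ.≤? n
  ... | yes m≤n = m≤n
  ... | no m≰n = contradiction
    (ℚ.<-≤-trans (subst₂ ℚ._<_ (ℚ.+-identityˡ (ι n)) (sym (ι-+ 1 n)) (ℚ.+-monoˡ-< (ι n) (ℚ.positive⁻¹ 1ℚ)))
      (ℚ.≤-trans (ι-mono {suc n} {m} (ℕ.≰⇒> m≰n)) ιm≤ιn))
    (ℚ.<-irrefl refl)

ιᴿ : ℕ → ℝ
ιᴿ n = fromℚ (ι n)

-- Linear arithmetic: the hypotheses are added up to a ≤ b, and the equation is a ring identity.
linear : ∀ {a b x y} → a ℚ.≤ b → x ℚ.+ b ≡ y ℚ.+ a → x ℚ.≤ y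
linear {a} {b} {x} {y} a≤b eq = subst₂ ℚ._≤_ (cancel x a) (cancel y a)
  (ℚ.+-monoˡ-≤ (ℚ.- a) (ℚ.≤-trans (ℚ.+-monoʳ-≤ x a≤b) (ℚ.≤-reflexive eq)))
  where
  open +-*-Solver using (solve; _:=_; _:+_; _:-_)
  cancel : ∀ x a → x ℚ.+ a ℚ.- a ≡ x
  cancel = solve 2 (λ x a → x :+ a :- a := x) refl

*-mono-ι : ∀ n {p q} → p ℚ.≤ q → ι n ℚ.* p ℚ.≤ ι n ℚ.* q
*-mono-ι n = ℚ.*-monoˡ-≤-nonNeg (ι n) {{ℚ.nonNegative (0≤ι n)}}

*-cancel-ι : ∀ n {p q} → 1 ℕ.≤ n → ι n ℚ.* p ℚ.≤ ι n ℚ.* q → p ℚ.≤ q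
*-cancel-ι n 1≤n = ℚ.*-cancelˡ-≤-pos (ι n) {{ℚ.positive (0<ι n 1≤n)}}

∣p-q∣≤ : ∀ p q {δ} → p ℚ.≤ q ℚ.+ δ → q ℚ.≤ p ℚ.+ δ → ℚ.∣ p ℚ.- q ∣ ℚ.≤ δ
∣p-q∣≤ p q {δ} p≤q+δ q≤p+δ with ℚ.∣p∣≡p∨∣p∣≡-p (p ℚ.- q)
... | inj₁ eq = ℚ.≤-trans (ℚ.≤-reflexive eq) (linear p≤q+δ (lemma p q δ))
  where
  open +-*-Solver using (solve; _:=_; _:+_; _:-_)
  lemma : ∀ p q δ → p ℚ.- q ℚ.+ (q ℚ.+ δ) ≡ δ ℚ.+ p
  lemma = solve 3 (λ p q δ → p :- q :+ (q :+ δ) := δ :+ p) refl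
... | inj₂ eq = ℚ.≤-trans (ℚ.≤-reflexive eq) (linear q≤p+δ (lemma p q δ))
  where
  open +-*-Solver using (solve; _:=_; _:+_; _:-_; :-_)
  lemma : ∀ p q δ → ℚ.- (p ℚ.- q) ℚ.+ (p ℚ.+ δ) ≡ δ ℚ.+ q
  lemma = solve 3 (λ p q δ → :- (p :- q) :+ (p :+ δ) := δ :+ q) refl

≤-from-ε : ∀ p q → (∀ ε → 0ℚ ℚ.< ε → p ℚ.≤ q ℚ.+ ε) → p ℚ.≤ q
≤-from-ε p q h with p ℚ.≤? q
... | yes p≤q = p≤q
... | no p≰q = contradiction (ℚ.≤-<-trans (h ε (half-pos 0<p-q)) q+ε<p) (ℚ.<-irrefl refl)
  where
  ε = half (p ℚ.- q)
  0<p-q : 0ℚ ℚ.< p ℚ.- q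
  0<p-q = <-respˡ (ℚ.+-inverseʳ q) (ℚ.+-monoˡ-< (ℚ.- q) (ℚ.≰⇒> p≰q))
  q+ε<p : q ℚ.+ ε ℚ.< p
  q+ε<p = subst (q ℚ.+ ε ℚ.<_) (ring₁ p q) (ℚ.+-monoʳ-< q (half<self 0<p-q))

≤-trans : ∀ x y z → x ≤ y → y ≤ z → x ≤ z
≤-trans x y z x≤y y≤z ε 0<ε with x≤y (half ε) (half-pos 0<ε) | y≤z (half ε) (half-pos 0<ε)
... | M , p | N , q = M ℕ.⊔ N , λ n h → begin
  seq x n                       ≤⟨ p n (ℕ.m⊔n≤o⇒m≤o M N h) ⟩
  seq y n ℚ.+ half ε            ≤⟨ ℚ.+-monoˡ-≤ (half ε) (q n (ℕ.m⊔n≤o⇒n≤o M N h)) ⟩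
  seq z n ℚ.+ half ε ℚ.+ half ε ≡⟨ ℚ.+-assoc (seq z n) _ _ ⟩
  seq z n ℚ.+ (half ε ℚ.+ half ε) ≡⟨ cong (seq z n ℚ.+_) (half+half ε) ⟩
  seq z n ℚ.+ ε                 ∎
  where open ℚ.≤-Reasoning

+-mono-≤ : ∀ w x y z → w ≤ x → y ≤ z → w + y ≤ x + z
+-mono-≤ w x y z w≤x y≤z ε 0<ε with w≤x (half ε) (half-pos 0<ε) | y≤z (half ε) (half-pos 0<ε)
... | M , p | N , q = M ℕ.⊔ N , λ n h → begin
  seq w n ℚ.+ seq y n
    ≤⟨ ℚ.+-mono-≤ (p n (ℕ.m⊔n≤o⇒m≤o M N h)) (q n (ℕ.m⊔n≤o⇒n≤o M N h)) ⟩
  seq x n ℚ.+ half ε ℚ.+ (seq z n ℚ.+ half ε)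
    ≡⟨ lemma (seq x n) (seq z n) (half ε) ⟩
  seq x n ℚ.+ seq z n ℚ.+ (half ε ℚ.+ half ε)
    ≡⟨ cong (seq x n ℚ.+ seq z n ℚ.+_) (half+half ε) ⟩
  seq x n ℚ.+ seq z n ℚ.+ ε ∎
  where
  open ℚ.≤-Reasoning
  open +-*-Solver using (solve; _:=_; _:+_)
  lemma : ∀ a c e → a ℚ.+ e ℚ.+ (c ℚ.+ e) ≡ a ℚ.+ c ℚ.+ (e ℚ.+ e)
  lemma = solve 3 (λ a c e → a :+ e :+ (c :+ e) := a :+ c :+ (e :+ e)) refl

p≤p+ε : ∀ p {ε} → 0ℚ ℚ.< ε → p ℚ.≤ p ℚ.+ ε
p≤p+ε p 0<ε = ≤-respˡ (ℚ.+-identityʳ p) (ℚ.+-monoʳ-≤ p (ℚ.<⇒≤ 0<ε))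

pointwise-≤ : ∀ x y → (∀ n → seq x n ℚ.≤ seq y n) → x ≤ y
pointwise-≤ x y h ε 0<ε = 0 , λ n _ → ℚ.≤-trans (h n) (p≤p+ε (seq y n) 0<ε)

≤-resp : ∀ w x y z → (∀ n → seq x n ≡ seq w n) → (∀ n → seq y n ≡ seq z n) → x ≤ y → w ≤ z
≤-resp w x y z x≗w y≗z x≤y ε 0<ε with x≤y ε 0<ε
... | N , h = N , λ n N≤n → subst₂ (λ p q → p ℚ.≤ q ℚ.+ ε) (x≗w n) (y≗z n) (h n N≤n)

*-mono-≤ : ∀ m x y → x ≤ y → ιᴿ m * x ≤ ιᴿ m * y
-- Dividing by `suc m` instead of `m` covers `m = 0`.
*-mono-≤ m x y x≤y ε 0<ε with divide (ι (suc m)) ε (0<ι (suc m) (ℕ.s≤s ℕ.z≤n)) 0<ε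
... | δ , 0<δ , eq with x≤y δ 0<δ
... | N , h = N , λ n N≤n → begin
  ι m ℚ.* seq x n             ≤⟨ *-mono-ι m (h n N≤n) ⟩
  ι m ℚ.* (seq y n ℚ.+ δ)     ≡⟨ ℚ.*-distribˡ-+ (ι m) (seq y n) δ ⟩
  ι m ℚ.* seq y n ℚ.+ ι m ℚ.* δ ≤⟨ ℚ.+-monoʳ-≤ (ι m ℚ.* seq y n) ιmδ≤ε ⟩
  ι m ℚ.* seq y n ℚ.+ ε       ∎
  where
  open ℚ.≤-Reasoning
  ιmδ≤ε : ι m ℚ.* δ ℚ.≤ ε
  ιmδ≤ε = ℚ.≤-trans (ℚ.*-monoʳ-≤-nonNeg δ {{ℚ.nonNegative (ℚ.<⇒≤ 0<δ)}} (ι-mono {m} {suc m} (ℕ.n≤1+n m))) (ℚ.≤-reflexive eq)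

fromℚ-cancel-≤ : ∀ p q → fromℚ p ≤ fromℚ q → p ℚ.≤ q
fromℚ-cancel-≤ p q h = ≤-from-ε p q (λ ε 0<ε → let N , bound = h ε 0<ε in bound N ℕ.≤-refl)

*-monoˡ-ι : ∀ {m n} x → 0ℝ ≤ x → m ℕ.≤ n → ιᴿ m * x ≤ ιᴿ n * x
*-monoˡ-ι {m} {n} x 0≤x m≤n = ≤-resp (ιᴿ m * x) (ιᴿ m * x + ιᴿ d * 0ℝ) (ιᴿ m * x + ιᴿ d * x) (ιᴿ n * x)
  (λ i → trans (cong (ι m ℚ.* seq x i ℚ.+_) (ℚ.*-zeroʳ (ι d))) (ℚ.+-identityʳ _))
  (λ i → trans (sym (ℚ.*-distribʳ-+ (seq x i) (ι m) (ι d)))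
    (cong (ℚ._* seq x i) (trans (sym (ι-+ m d)) (cong ι (ℕ.m+[n∸m]≡n m≤n)))))
  (+-mono-≤ (ιᴿ m * x) (ιᴿ m * x) (ιᴿ d * 0ℝ) (ιᴿ d * x)
    (pointwise-≤ (ιᴿ m * x) (ιᴿ m * x) (λ _ → ℚ.≤-refl)) (*-mono-≤ d 0ℝ x 0≤x))
  where
  d = n ℕ.∸ m

-- Rounding of non-negative reals

floor-below : ∀ q N → q ℚ.< ι N → (q ℚ.< 0ℚ) ⊎ (∃[ t ] ι t ℚ.≤ q × q ℚ.< ι (suc t))
floor-below q zero    q<0 = inj₁ (subst (q ℚ.<_) ι0≡0 q<0)
floor-below q (suc N) q<N+1 with ι N ℚ.≤? q
... | yes N≤q = inj₂ (N , N≤q , q<N+1)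
... | no N≰q  = floor-below q N (ℚ.≰⇒> N≰q)

-- Some term of the Cauchy sequence is within 1 of `x`; let q be this term minus 1. Then `x` lies
-- between q and q + 2, and comparisons of rationals find t with t ≤ q < t + 1, whence t ≤ x ≤ t +
-- 3. If q is negative, `x` is below 2 and t = 0 serves.
approximate : ∀ x → 0ℝ ≤ x → ∃[ t ] ιᴿ t ≤ x × x ≤ ιᴿ (t ℕ.+ 3)
approximate x 0≤x with cauchy x 1ℚ (ℚ.positive⁻¹ 1ℚ)
... | N , close with ι-archimedean (seq x N)
... | M , x≤M with floor-below (seq x N ℚ.- 1ℚ) M (ℚ.<-≤-trans p-1<p x≤M)
  where
  p-1<p : seq x N ℚ.- 1ℚ ℚ.< seq x N
  p-1<p = subst (seq x N ℚ.- 1ℚ ℚ.<_) (ℚ.+-identityʳ _) (ℚ.+-monoʳ-< (seq x N) (ℚ.negative⁻¹ (ℚ.- 1ℚ)))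
... | inj₁ q<0 = 0 , subst (λ q → fromℚ q ≤ x) (sym ι0≡0) 0≤x , λ ε 0<ε → N , λ n N≤n → ℚ.≤-trans
  (ℚ.≤-trans (ℚ.<⇒≤ (∣p-q∣<ε⇒p<q+ε (seq x n) (seq x N) (close n N N≤n ℕ.≤-refl)))
    (ℚ.≤-trans (linear (ℚ.<⇒≤ q<0) (lemma (seq x N) 1ℚ))
      (ℚ.≤-trans (ℚ.≤-reflexive (trans (cong₂ ℚ._+_ (sym ι1≡1) (sym ι1≡1)) (sym (ι-+ 1 1))))
        (ι-mono {2} {3} (ℕ.s≤s (ℕ.s≤s ℕ.z≤n))))))
  (p≤p+ε (ι 3) 0<ε)
  where
  open +-*-Solver using (solve; _:=_; _:+_; _:-_; con)
  lemma : ∀ a o → a ℚ.+ o ℚ.+ 0ℚ ≡ o ℚ.+ o ℚ.+ (a ℚ.- o)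
  lemma = solve 2 (λ a o → a :+ o :+ con 0ℚ := o :+ o :+ (a :- o)) refl
... | inj₂ (t , t≤q , q<t+1) = t ,
  (λ ε 0<ε → N , λ n N≤n → ℚ.≤-trans (linear (ℚ.+-mono-≤ t≤q (ℚ.<⇒≤ (∣p-q∣<ε⇒p<q+ε (seq x N) (seq x n) (close N n ℕ.≤-refl N≤n))))
     (lemma₁ (ι t) (seq x N) (seq x n) 1ℚ)) (p≤p+ε (seq x n) 0<ε)) ,
  (λ ε 0<ε → N , λ n N≤n → ℚ.≤-trans (linear (ℚ.+-mono-≤ (ℚ.<⇒≤ q<t+1) (ℚ.<⇒≤ (∣p-q∣<ε⇒p<q+ε (seq x n) (seq x N) (close n N N≤n ℕ.≤-refl))))
     (begin
       seq x n ℚ.+ (ι (suc t) ℚ.+ (seq x N ℚ.+ 1ℚ))     ≡⟨ cong₂ (λ s o → seq x n ℚ.+ (s ℚ.+ (seq x N ℚ.+ o))) (ι-+ 1 t) (sym ι1≡1) ⟩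
       seq x n ℚ.+ (ι 1 ℚ.+ ι t ℚ.+ (seq x N ℚ.+ ι 1))  ≡⟨ lemma₂ (ι t) (ι 1) (seq x N) (seq x n) ⟩
       ι t ℚ.+ (ι 1 ℚ.+ (ι 1 ℚ.+ ι 1)) ℚ.+ (seq x N ℚ.- ι 1 ℚ.+ seq x n)
         ≡⟨ cong₂ (λ s o → ι t ℚ.+ s ℚ.+ (seq x N ℚ.- o ℚ.+ seq x n)) (sym (trans (ι-+ 1 2) (cong (ι 1 ℚ.+_) (ι-+ 1 1)))) ι1≡1 ⟩
       ι t ℚ.+ ι 3 ℚ.+ (seq x N ℚ.- 1ℚ ℚ.+ seq x n)     ≡⟨ cong (ℚ._+ (seq x N ℚ.- 1ℚ ℚ.+ seq x n)) (ι-+ t 3) ⟨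
       ι (t ℕ.+ 3) ℚ.+ (seq x N ℚ.- 1ℚ ℚ.+ seq x n)     ∎))
     (p≤p+ε (ι (t ℕ.+ 3)) 0<ε))
  where
  open ≡-Reasoning
  open +-*-Solver using (solve; _:=_; _:+_; _:-_)
  lemma₁ : ∀ t a c o → t ℚ.+ (a ℚ.- o ℚ.+ (c ℚ.+ o)) ≡ c ℚ.+ (t ℚ.+ a)
  lemma₁ = solve 4 (λ t a c o → t :+ (a :- o :+ (c :+ o)) := c :+ (t :+ a)) refl
  lemma₂ : ∀ t o a c → c ℚ.+ (o ℚ.+ t ℚ.+ (a ℚ.+ o)) ≡ t ℚ.+ (o ℚ.+ (o ℚ.+ o)) ℚ.+ (a ℚ.- o ℚ.+ c)
  lemma₂ = solve 4 (λ t o a c → c :+ (o :+ t :+ (a :+ o)) := t :+ (o :+ (o :+ o)) :+ (a :- o :+ c)) refl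

0≤ι* : ∀ n x → 0ℝ ≤ x → 0ℝ ≤ ιᴿ n * x
0≤ι* n x 0≤x = ≤-resp 0ℝ (ιᴿ n * 0ℝ) (ιᴿ n * x) (ιᴿ n * x) (λ _ → ℚ.*-zeroʳ (ι n)) (λ _ → refl) (*-mono-≤ n 0ℝ x 0≤x)

-- Numbers of letters for each multiplicity

module Targets (b : ℕ) (1≤b : 1 ℕ.≤ b) (p : ℕ → ℝ) (0≤p : ∀ i → 0ℝ ≤ p i) where

  open +-*-Solver using (solve; _:=_; _:+_; _:*_; con)

  candidate : ∀ k j → Dec (j ℕ.< k) → ℕ
  candidate k j (no _)  = 0
  candidate k j (yes _) = proj₁ (approximate (ιᴿ (b ℕ.^ k) * p (suc j)) (0≤ι* (b ℕ.^ k) (p (suc j)) (0≤p (suc j))))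

  -- A rounded value may fall from one stage to the next, whereas letters once placed remain. The
  -- maximum over the stages repairs this, and it keeps the upper bound because `b ^ k * p (suc j)`
  -- grows with `k`.
  A : ℕ → ℕ → ℕ
  A zero    j = 0
  A (suc k) j = A k j ℕ.⊔ candidate (suc k) j (j ℕ.<? suc k)

  A-mono : ∀ k j → A k j ℕ.≤ A (suc k) j
  A-mono k j = ℕ.m≤m⊔n (A k j) _

  A-support : ∀ k j → k ℕ.≤ j → A k j ≡ 0
  A-support zero    j k≤j = refl
  A-support (suc k) j k<j with j ℕ.<? suc k
  ... | yes j<k = contradiction j<k (ℕ.≤⇒≯ k<j)
  ... | no _    = trans (ℕ.⊔-identityʳ (A k j)) (A-support k j (ℕ.<⇒≤ k<j))

  candidate-lower : ∀ k j j<?k → ιᴿ (candidate k j j<?k) ≤ ιᴿ (b ℕ.^ k) * p (suc j)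
  candidate-lower k j (no _)  = subst (λ q → fromℚ q ≤ ιᴿ (b ℕ.^ k) * p (suc j)) (sym ι0≡0) (0≤ι* (b ℕ.^ k) (p (suc j)) (0≤p (suc j)))
  candidate-lower k j (yes _) = proj₁ (proj₂ (approximate (ιᴿ (b ℕ.^ k) * p (suc j)) (0≤ι* (b ℕ.^ k) (p (suc j)) (0≤p (suc j)))))

  A-lower : ∀ k j → ιᴿ (A k j) ≤ ιᴿ (b ℕ.^ k) * p (suc j)
  A-lower zero    j = subst (λ q → fromℚ q ≤ ιᴿ 1 * p (suc j)) (sym ι0≡0) (0≤ι* 1 (p (suc j)) (0≤p (suc j)))
  A-lower (suc k) j with ℕ.⊔-sel (A k j) (candidate (suc k) j (j ℕ.<? suc k))
  ... | inj₁ eq = subst (λ n → ιᴿ n ≤ ιᴿ (b ℕ.^ suc k) * p (suc j)) (sym eq)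
    (≤-trans (ιᴿ (A k j)) (ιᴿ (b ℕ.^ k) * p (suc j)) (ιᴿ (b ℕ.^ suc k) * p (suc j)) (A-lower k j)
      (*-monoˡ-ι (p (suc j)) (0≤p (suc j)) (ℕ.m≤n*m (b ℕ.^ k) b {{ℕ.>-nonZero 1≤b}})))
  ... | inj₂ eq = subst (λ n → ιᴿ n ≤ ιᴿ (b ℕ.^ suc k) * p (suc j)) (sym eq)
    (candidate-lower (suc k) j (j ℕ.<? suc k))

  A-upper : ∀ k j → j ℕ.< k → ιᴿ (b ℕ.^ k) * p (suc j) ≤ ιᴿ (A k j ℕ.+ 3)
  A-upper (suc k) j j<k = ≤-trans (ιᴿ (b ℕ.^ suc k) * p (suc j)) (ιᴿ (cand ℕ.+ 3)) (ιᴿ (A (suc k) j ℕ.+ 3))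
    (bound (j ℕ.<? suc k))
    (pointwise-≤ (ιᴿ (cand ℕ.+ 3)) (ιᴿ (A (suc k) j ℕ.+ 3)) (λ _ → ι-mono (ℕ.+-monoˡ-≤ 3 (ℕ.m≤n⊔m (A k j) cand))))
    where
    cand = candidate (suc k) j (j ℕ.<? suc k)
    bound : ∀ d → ιᴿ (b ℕ.^ suc k) * p (suc j) ≤ ιᴿ (candidate (suc k) j d ℕ.+ 3)
    bound (no j≮k) = contradiction j<k j≮k
    bound (yes _)  = proj₂ (proj₂ (approximate (ιᴿ (b ℕ.^ suc k) * p (suc j)) (0≤ι* (b ℕ.^ suc k) (p (suc j)) (0≤p (suc j)))))

  -- Taken with `c i = 1` for the total probability and with `c i = i` for the mean. The term `f 0`
  -- stands apart because no letters belong to multiplicity 0.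
  module _ (c : ℕ → ℕ) (f : ℕ → ℝ) (f≗cp : ∀ i n → seq (f i) n ≡ ι (c i) ℚ.* seq (p i) n) where

    sum-lower : ∀ k n → ιᴿ (b ℕ.^ k) * f 0 + ιᴿ (∑ (downFrom n) (λ j → c (suc j) ℕ.* A k j)) ≤ ιᴿ (b ℕ.^ k) * ∑< (suc n) f
    sum-lower k zero = pointwise-≤ (ιᴿ (b ℕ.^ k) * f 0 + ιᴿ 0) (ιᴿ (b ℕ.^ k) * ∑< 1 f)
      (λ m → ℚ.≤-reflexive (trans (cong (ι (b ℕ.^ k) ℚ.* seq (f 0) m ℚ.+_) ι0≡0) (lemma (ι (b ℕ.^ k)) (seq (f 0) m))))
      where
      lemma : ∀ B x → B ℚ.* x ℚ.+ 0ℚ ≡ B ℚ.* (0ℚ ℚ.+ x)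
      lemma = solve 2 (λ B x → B :* x :+ con 0ℚ := B :* (con 0ℚ :+ x)) refl
    sum-lower k (suc n) = ≤-resp
      (ιᴿ B * f 0 + ιᴿ (c (suc n) ℕ.* A k n ℕ.+ S))
      (ιᴿ B * f 0 + ιᴿ S + ιᴿ (c (suc n)) * ιᴿ (A k n))
      (ιᴿ B * ∑< (suc n) f + ιᴿ (c (suc n)) * (ιᴿ B * p (suc n)))
      (ιᴿ B * ∑< (suc (suc n)) f)
      (λ m → trans (lemma₁ (ι B ℚ.* seq (f 0) m) (ι S) (ι (c (suc n))) (ι (A k n)))
        (cong (ι B ℚ.* seq (f 0) m ℚ.+_) (sym (trans (ι-+ (c (suc n) ℕ.* A k n) S) (cong (ℚ._+ ι S) (ι-* (c (suc n)) (A k n)))))))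
      (λ m → trans (lemma₂ (ι B) (seq (∑< (suc n) f) m) (ι (c (suc n))) (seq (p (suc n)) m))
        (cong (λ x → ι B ℚ.* (seq (∑< (suc n) f) m ℚ.+ x)) (sym (f≗cp (suc n) m))))
      (+-mono-≤ (ιᴿ B * f 0 + ιᴿ S) (ιᴿ B * ∑< (suc n) f) (ιᴿ (c (suc n)) * ιᴿ (A k n)) (ιᴿ (c (suc n)) * (ιᴿ B * p (suc n)))
        (sum-lower k n) (*-mono-≤ (c (suc n)) (ιᴿ (A k n)) (ιᴿ B * p (suc n)) (A-lower k n)))
      where
      B = b ℕ.^ k
      S = ∑ (downFrom n) (λ j → c (suc j) ℕ.* A k j)
      lemma₁ : ∀ x s y z → x ℚ.+ s ℚ.+ y ℚ.* z ≡ x ℚ.+ (y ℚ.* z ℚ.+ s)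
      lemma₁ = solve 4 (λ x s y z → x :+ s :+ y :* z := x :+ (y :* z :+ s)) refl
      lemma₂ : ∀ B s y z → B ℚ.* s ℚ.+ y ℚ.* (B ℚ.* z) ≡ B ℚ.* (s ℚ.+ y ℚ.* z)
      lemma₂ = solve 4 (λ B s y z → B :* s :+ y :* (B :* z) := B :* (s :+ y :* z)) refl

    sum-upper : ∀ k n → n ℕ.≤ k → ιᴿ (b ℕ.^ k) * ∑< (suc n) f ≤ ιᴿ (b ℕ.^ k) * f 0 + ιᴿ (∑ (downFrom n) (λ j → c (suc j) ℕ.* (A k j ℕ.+ 3)))
    sum-upper k zero _ = pointwise-≤ (ιᴿ (b ℕ.^ k) * ∑< 1 f) (ιᴿ (b ℕ.^ k) * f 0 + ιᴿ 0)
      (λ m → ℚ.≤-reflexive (sym (trans (cong (ι (b ℕ.^ k) ℚ.* seq (f 0) m ℚ.+_) ι0≡0) (lemma (ι (b ℕ.^ k)) (seq (f 0) m)))))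
      where
      lemma : ∀ B x → B ℚ.* x ℚ.+ 0ℚ ≡ B ℚ.* (0ℚ ℚ.+ x)
      lemma = solve 2 (λ B x → B :* x :+ con 0ℚ := B :* (con 0ℚ :+ x)) refl
    sum-upper k (suc n) n<k = ≤-resp
      (ιᴿ B * ∑< (suc (suc n)) f)
      (ιᴿ B * ∑< (suc n) f + ιᴿ (c (suc n)) * (ιᴿ B * p (suc n)))
      (ιᴿ B * f 0 + ιᴿ S + ιᴿ (c (suc n)) * ιᴿ (A k n ℕ.+ 3))
      (ιᴿ B * f 0 + ιᴿ (c (suc n) ℕ.* (A k n ℕ.+ 3) ℕ.+ S))
      (λ m → trans (lemma₂ (ι B) (seq (∑< (suc n) f) m) (ι (c (suc n))) (seq (p (suc n)) m))
        (cong (λ x → ι B ℚ.* (seq (∑< (suc n) f) m ℚ.+ x)) (sym (f≗cp (suc n) m))))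
      (λ m → trans (lemma₁ (ι B ℚ.* seq (f 0) m) (ι S) (ι (c (suc n))) (ι (A k n ℕ.+ 3)))
        (cong (ι B ℚ.* seq (f 0) m ℚ.+_) (sym (trans (ι-+ (c (suc n) ℕ.* (A k n ℕ.+ 3)) S) (cong (ℚ._+ ι S) (ι-* (c (suc n)) (A k n ℕ.+ 3)))))))
      (+-mono-≤ (ιᴿ B * ∑< (suc n) f) (ιᴿ B * f 0 + ιᴿ S) (ιᴿ (c (suc n)) * (ιᴿ B * p (suc n))) (ιᴿ (c (suc n)) * ιᴿ (A k n ℕ.+ 3))
        (sum-upper k n (ℕ.<⇒≤ n<k)) (*-mono-≤ (c (suc n)) (ιᴿ B * p (suc n)) (ιᴿ (A k n ℕ.+ 3)) (A-upper k n n<k)))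
      where
      B = b ℕ.^ k
      S = ∑ (downFrom n) (λ j → c (suc j) ℕ.* (A k j ℕ.+ 3))
      lemma₁ : ∀ x s y z → x ℚ.+ s ℚ.+ y ℚ.* z ≡ x ℚ.+ (y ℚ.* z ℚ.+ s)
      lemma₁ = solve 4 (λ x s y z → x :+ s :+ y :* z := x :+ (y :* z :+ s)) refl
      lemma₂ : ∀ B s y z → B ℚ.* s ℚ.+ y ℚ.* (B ℚ.* z) ≡ B ℚ.* (s ℚ.+ y ℚ.* z)
      lemma₂ = solve 4 (λ B s y z → B :* s :+ y :* (B :* z) := B :* (s :+ y :* z)) refl

const-≤ : ∀ {p q} → p ℚ.≤ q → fromℚ p ≤ fromℚ q
const-≤ {p} {q} p≤q = pointwise-≤ (fromℚ p) (fromℚ q) (λ _ → p≤q)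

<⇒≤ : ∀ x y → x < y → x ≤ y
<⇒≤ x y (δ , 0<δ , N , h) ε 0<ε = N , λ n N≤n →
  ℚ.≤-trans (p≤p+ε (seq x n) 0<δ) (ℚ.≤-trans (h n N≤n) (p≤p+ε (seq y n) 0<ε))

linearᴿ : ∀ a b x y → a ≤ b → (∀ n → seq x n ℚ.+ seq b n ≡ seq y n ℚ.+ seq a n) → x ≤ y
linearᴿ a b x y a≤b eq ε 0<ε with a≤b ε 0<ε
... | N , h = N , λ n N≤n → linear (h n N≤n)
  (trans (sym (ℚ.+-assoc (seq x n) (seq b n) ε)) (trans (cong (ℚ._+ ε) (eq n)) (swap (seq y n) (seq a n) ε)))
  where
  open +-*-Solver using (solve; _:=_; _:+_)
  swap : ∀ y a e → y ℚ.+ a ℚ.+ e ≡ y ℚ.+ e ℚ.+ a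
  swap = solve 3 (λ y a e → y :+ a :+ e := y :+ e :+ a) refl

+₃-mono-≤ : ∀ a b c d e f → a ≤ b → c ≤ d → e ≤ f → a + c + e ≤ b + d + f
+₃-mono-≤ a b c d e f p q r = +-mono-≤ (a + c) (b + d) e f (+-mono-≤ a b c d p q) r

*-cancel-≤ : ∀ n x y → 1 ℕ.≤ n → ιᴿ n * x ≤ ιᴿ n * y → x ≤ y
*-cancel-≤ n x y 1≤n h ε 0<ε with h ε 0<ε
... | N , bound = N , λ m N≤m → *-cancel-ι n 1≤n (begin
  ι n ℚ.* seq x m                 ≤⟨ bound m N≤m ⟩
  ι n ℚ.* seq y m ℚ.+ ε           ≡⟨ cong (ι n ℚ.* seq y m ℚ.+_) (trans (cong (ℚ._* ε) ι1≡1) (ℚ.*-identityˡ ε)) ⟨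
  ι n ℚ.* seq y m ℚ.+ ι 1 ℚ.* ε   ≤⟨ ℚ.+-monoʳ-≤ (ι n ℚ.* seq y m) (ℚ.*-monoʳ-≤-nonNeg ε {{ℚ.nonNegative (ℚ.<⇒≤ 0<ε)}} (ι-mono 1≤n)) ⟩
  ι n ℚ.* seq y m ℚ.+ ι n ℚ.* ε   ≡⟨ ℚ.*-distribˡ-+ (ι n) (seq y m) ε ⟨
  ι n ℚ.* (seq y m ℚ.+ ε)         ∎)
  where open ℚ.≤-Reasoning

Within : ℚ → ℝ → ℝ → Set
Within ε x y = (x ≤ y + fromℚ ε) × (y ≤ x + fromℚ ε)

∣-∣<⇒within : ∀ x y ε → ∣ x - y ∣ < fromℚ ε → Within ε x y
∣-∣<⇒within x y ε (δ , 0<δ , N , h) =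
  (λ η 0<η → N , λ n N≤n → ℚ.≤-trans (ℚ.<⇒≤ (∣p-q∣<ε⇒p<q+ε (seq x n) (seq y n) (near n N≤n))) (p≤p+ε _ 0<η)) ,
  (λ η 0<η → N , λ n N≤n → ℚ.≤-trans (ℚ.<⇒≤ (∣p-q∣<ε⇒p<q+ε (seq y n) (seq x n)
    (<-respˡ (∣p-q∣≡∣q-p∣ (seq x n) (seq y n)) (near n N≤n)))) (p≤p+ε _ 0<η))
  where
  near : ∀ n → N ℕ.≤ n → ℚ.∣ seq x n ℚ.- seq y n ∣ ℚ.< ε
  near n N≤n = ℚ.<-≤-trans (subst (ℚ._< ℚ.∣ seq x n ℚ.- seq y n ∣ ℚ.+ δ) (ℚ.+-identityʳ _)
    (ℚ.+-monoʳ-< ℚ.∣ seq x n ℚ.- seq y n ∣ 0<δ)) (h n N≤n)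

-- One `η` absorbs the slack in the order `≤` of reals, the other is the gap that `<` demands.
within⇒∣-∣< : ∀ x y δ η ε → 0ℚ ℚ.< η → δ ℚ.+ η ℚ.+ η ≡ ε → Within δ x y → ∣ x - y ∣ < fromℚ ε
within⇒∣-∣< x y δ η ε 0<η eq (x≤y , y≤x) with x≤y η 0<η | y≤x η 0<η
... | M , p | N , q = η , 0<η , M ℕ.⊔ N , λ n h → ℚ.≤-trans
  (ℚ.+-monoˡ-≤ η (∣p-q∣≤ (seq x n) (seq y n)
    (ℚ.≤-trans (p n (ℕ.m⊔n≤o⇒m≤o M N h)) (ℚ.≤-reflexive (ℚ.+-assoc (seq y n) δ η)))
    (ℚ.≤-trans (q n (ℕ.m⊔n≤o⇒n≤o M N h)) (ℚ.≤-reflexive (ℚ.+-assoc (seq x n) δ η)))))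
  (ℚ.≤-reflexive eq)

partial-sum-≤ : ∀ f s → (∀ i → 0ℝ ≤ f i) → HasSum f s → ∀ n → ∑< n f ≤ s
partial-sum-≤ f s 0≤f sum n ε 0<ε with sum (half ε) (half-pos 0<ε)
... | N , close = bound .proj₁ , λ m h → ℚ.≤-trans (bound .proj₂ m h) (ℚ.≤-reflexive (trans (ℚ.+-assoc (seq s m) _ _) (cong (seq s m ℚ.+_) (half+half ε))))
  where
  monotone : ∀ d → ∑< n f ≤ ∑< (d ℕ.+ n) f
  monotone zero    = pointwise-≤ (∑< n f) (∑< n f) (λ _ → ℚ.≤-refl)
  monotone (suc d) = ≤-resp (∑< n f) (∑< n f + 0ℝ) (∑< (d ℕ.+ n) f + f (d ℕ.+ n)) (∑< (suc d ℕ.+ n) f)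
    (λ m → ℚ.+-identityʳ _) (λ _ → refl)
    (+-mono-≤ (∑< n f) (∑< (d ℕ.+ n) f) 0ℝ (f (d ℕ.+ n)) (monotone d) (0≤f (d ℕ.+ n)))
  bound = ≤-trans (∑< n f) (∑< (N ℕ.+ n) f) (s + fromℚ (half ε)) (monotone N)
    (proj₁ (∣-∣<⇒within (∑< (N ℕ.+ n) f) s (half ε) (close (N ℕ.+ n) (ℕ.m≤m+n N n)))) (half ε) (half-pos 0<ε)

-- By `total-error-growth` every `k` beyond `suc C / ε` suffices; `suc C` is taken because `divide`
-- needs a positive number.
error-vanishes : ∀ ε → 0ℚ ℚ.< ε → ∃[ K ] (∀ k → K ℕ.≤ k → ι (total-error k) ℚ.≤ ι (2 ℕ.^ k) ℚ.* ε)
error-vanishes ε 0<ε = from total-error-growth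
  where
  open ℚ.≤-Reasoning
  open +-*-Solver using (solve; _:=_; _:*_)
  swap : ∀ x y z → x ℚ.* y ℚ.* z ≡ y ℚ.* (z ℚ.* x)
  swap = solve 3 (λ x y z → x :* y :* z := y :* (z :* x)) refl
  from : ∃[ C ] (∀ k → suc k ℕ.* total-error k ℕ.≤ C ℕ.* 2 ℕ.^ k) →
    ∃[ K ] (∀ k → K ℕ.≤ k → ι (total-error k) ℚ.≤ ι (2 ℕ.^ k) ℚ.* ε)
  from (C , growth) with divide ε (ι (suc C)) 0<ε (0<ι (suc C) (ℕ.s≤s ℕ.z≤n))
  ... | δ , _ , εδ≡C with ι-archimedean δ
  ... | K , δ≤K = K , λ k K≤k → *-cancel-ι (suc k) (ℕ.s≤s ℕ.z≤n) (begin
    ι (suc k) ℚ.* ι (total-error k)    ≡⟨ ι-* (suc k) (total-error k) ⟨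
    ι (suc k ℕ.* total-error k)        ≤⟨ ι-mono (growth k) ⟩
    ι (C ℕ.* 2 ℕ.^ k)                  ≤⟨ ι-mono (ℕ.*-monoˡ-≤ (2 ℕ.^ k) (ℕ.n≤1+n C)) ⟩
    ι (suc C ℕ.* 2 ℕ.^ k)              ≡⟨ ι-* (suc C) (2 ℕ.^ k) ⟩
    ι (suc C) ℚ.* ι (2 ℕ.^ k)          ≡⟨ cong (ℚ._* ι (2 ℕ.^ k)) εδ≡C ⟨
    ε ℚ.* δ ℚ.* ι (2 ℕ.^ k)            ≡⟨ swap ε δ (ι (2 ℕ.^ k)) ⟩
    δ ℚ.* (ι (2 ℕ.^ k) ℚ.* ε)          ≤⟨ ℚ.*-monoʳ-≤-nonNeg (ι (2 ℕ.^ k) ℚ.* ε) {{nonNeg k}}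
                                            (ℚ.≤-trans δ≤K (ι-mono (ℕ.≤-trans K≤k (ℕ.n≤1+n k)))) ⟩
    ι (suc k) ℚ.* (ι (2 ℕ.^ k) ℚ.* ε)  ∎)
    where
    nonNeg : ∀ k → ℚ.NonNegative (ι (2 ℕ.^ k) ℚ.* ε)
    nonNeg k = ℚ.nonNegative (ℚ.≤-trans (ℚ.≤-reflexive (sym (ℚ.*-zeroʳ (ι (2 ℕ.^ k))))) (*-mono-ι (2 ℕ.^ k) (ℚ.<⇒≤ 0<ε)))

near⇒ι-≤ : ∀ m n e → m ℕ.≤ n ℕ.+ e → ι m ℚ.≤ ι n ℚ.+ ι e
near⇒ι-≤ m n e h = ℚ.≤-trans (ι-mono h) (ℚ.≤-reflexive (ι-+ n e))

distance-≤ : ∀ ℓ M e x → ι ℓ ℚ.≤ ι (M ℕ.+ e) ℚ.+ x → ι M ℚ.≤ ι (suc ℓ) ℚ.+ x →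
  ι ℕ.∣ ℓ - M ∣ ℚ.≤ ι (e ℕ.+ 1) ℚ.+ x
distance-≤ ℓ M e x p q with ℕ.≤-total ℓ M
... | inj₁ ℓ≤M = linear (ℚ.+-mono-≤ q (0≤ι e)) (begin
  ι ℕ.∣ ℓ - M ∣ ℚ.+ (ι (suc ℓ) ℚ.+ x ℚ.+ ι e)
    ≡⟨ cong₂ (λ d s → ι d ℚ.+ (s ℚ.+ x ℚ.+ ι e)) (ℕ.m≤n⇒∣m-n∣≡n∸m ℓ≤M) (ι-+ 1 ℓ) ⟩
  ι (M ℕ.∸ ℓ) ℚ.+ (ι 1 ℚ.+ ι ℓ ℚ.+ x ℚ.+ ι e)
    ≡⟨ lemma (ι (M ℕ.∸ ℓ)) (ι 1) (ι ℓ) x (ι e) ⟩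
  ι e ℚ.+ ι 1 ℚ.+ x ℚ.+ (ι ℓ ℚ.+ ι (M ℕ.∸ ℓ) ℚ.+ 0ℚ)
    ≡⟨ cong₂ (λ s m → s ℚ.+ x ℚ.+ (m ℚ.+ 0ℚ)) (sym (ι-+ e 1)) (trans (sym (ι-+ ℓ (M ℕ.∸ ℓ))) (cong ι (ℕ.m+[n∸m]≡n ℓ≤M))) ⟩
  ι (e ℕ.+ 1) ℚ.+ x ℚ.+ (ι M ℚ.+ 0ℚ) ∎)
  where
  open ≡-Reasoning
  open +-*-Solver using (solve; _:=_; _:+_; con)
  lemma : ∀ d o l x e → d ℚ.+ (o ℚ.+ l ℚ.+ x ℚ.+ e) ≡ e ℚ.+ o ℚ.+ x ℚ.+ (l ℚ.+ d ℚ.+ 0ℚ)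
  lemma = solve 5 (λ d o l x e → d :+ (o :+ l :+ x :+ e) := e :+ o :+ x :+ (l :+ d :+ con 0ℚ)) refl
... | inj₂ M≤ℓ = linear (ℚ.+-mono-≤ p (0≤ι 1)) (begin
  ι ℕ.∣ ℓ - M ∣ ℚ.+ (ι (M ℕ.+ e) ℚ.+ x ℚ.+ ι 1)
    ≡⟨ cong₂ (λ d s → ι d ℚ.+ (s ℚ.+ x ℚ.+ ι 1)) (ℕ.m≤n⇒∣n-m∣≡n∸m M≤ℓ) (ι-+ M e) ⟩
  ι (ℓ ℕ.∸ M) ℚ.+ (ι M ℚ.+ ι e ℚ.+ x ℚ.+ ι 1)
    ≡⟨ lemma (ι (ℓ ℕ.∸ M)) (ι 1) (ι M) x (ι e) ⟩
  ι e ℚ.+ ι 1 ℚ.+ x ℚ.+ (ι M ℚ.+ ι (ℓ ℕ.∸ M) ℚ.+ 0ℚ)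
    ≡⟨ cong₂ (λ s m → s ℚ.+ x ℚ.+ (m ℚ.+ 0ℚ)) (sym (ι-+ e 1)) (trans (sym (ι-+ M (ℓ ℕ.∸ M))) (cong ι (ℕ.m+[n∸m]≡n M≤ℓ))) ⟩
  ι (e ℕ.+ 1) ℚ.+ x ℚ.+ (ι ℓ ℚ.+ 0ℚ) ∎)
  where
  open ≡-Reasoning
  open +-*-Solver using (solve; _:=_; _:+_; con)
  lemma : ∀ d o l x e → d ℚ.+ (l ℚ.+ e ℚ.+ x ℚ.+ o) ≡ e ℚ.+ o ℚ.+ x ℚ.+ (l ℚ.+ d ℚ.+ 0ℚ)
  lemma = solve 5 (λ d o l x e → d :+ (l :+ e :+ x :+ o) := e :+ o :+ x :+ (l :+ d :+ con 0ℚ)) refl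

-- Convergence of the frequencies

module Main (b : ℕ) .{{_ : NonTrivial b}} (lam : ℝ) (p : ℕ → ℝ) (0≤p : ∀ i → 0ℝ ≤ p i)
  (∑p : HasSum p 1ℝ) (∑ip : HasSum (λ i → fromℕ i * p i) lam)
  (h : ℕ) (A-bound : ∀ S B → ιᴿ B * p 0 + ιᴿ S ≤ ιᴿ B * 1ℝ → h ℕ.* S ℕ.≤ B)
  (pad : Fin b) (y : ℕ → Fin b) (unrepeated : Unrepeated h y) where

  open +-*-Solver using (solve; _:=_; _:+_; _:*_; con)

  2≤b : 2 ℕ.≤ b
  2≤b = ℕ.nonTrivial⇒n>1 b

  1≤b : 1 ℕ.≤ b
  1≤b = ℕ.<⇒≤ 2≤b

  open Targets b 1≤b p 0≤p

  f : ℕ → ℝ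
  f i = fromℕ i * p i

  S M e : ℕ → ℕ
  S k = ∑ (downFrom k) (A k)
  M k = ∑ (downFrom k) (λ j → suc j ℕ.* A k j)
  e k = ∑ (downFrom k) (λ j → suc j ℕ.* 3)

  p≗1p : ∀ i n → seq (p i) n ≡ ι 1 ℚ.* seq (p i) n
  p≗1p i n = sym (trans (cong (ℚ._* seq (p i) n) ι1≡1) (ℚ.*-identityˡ (seq (p i) n)))

  f≗ιp : ∀ i n → seq (f i) n ≡ ι i ℚ.* seq (p i) n
  f≗ιp i n = cong (ℚ._* seq (p i) n) (sym (ι≡/1 i))

  S-lower : ∀ k → ιᴿ (b ℕ.^ k) * p 0 + ιᴿ (S k) ≤ ιᴿ (b ℕ.^ k) * ∑< (suc k) p
  S-lower k = subst (λ s → ιᴿ (b ℕ.^ k) * p 0 + ιᴿ s ≤ ιᴿ (b ℕ.^ k) * ∑< (suc k) p)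
    (∑-cong (downFrom k) (λ j → ℕ.*-identityˡ (A k j))) (sum-lower (λ _ → 1) p p≗1p k k)

  S-upper : ∀ k → ιᴿ (b ℕ.^ k) * ∑< (suc k) p ≤ ιᴿ (b ℕ.^ k) * p 0 + ιᴿ (S k ℕ.+ k ℕ.* 3)
  S-upper k = subst (λ s → ιᴿ (b ℕ.^ k) * ∑< (suc k) p ≤ ιᴿ (b ℕ.^ k) * p 0 + ιᴿ s)
    (trans (∑-cong (downFrom k) (λ j → ℕ.*-identityˡ (A k j ℕ.+ 3)))
      (trans (∑-+ (downFrom k) (A k) (λ _ → 3)) (cong (S k ℕ.+_) (trans (∑-const (downFrom k) 3) (cong (ℕ._* 3) (length-downFrom k))))))
    (sum-upper (λ _ → 1) p p≗1p k k ℕ.≤-refl)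

  drop-f0 : ∀ k s n → ι (b ℕ.^ k) ℚ.* seq (f 0) n ℚ.+ s ≡ s
  drop-f0 k s n = trans (cong (λ q → ι (b ℕ.^ k) ℚ.* q ℚ.+ s) (trans (f≗ιp 0 n) (cong (ℚ._* seq (p 0) n) ι0≡0)))
    (lemma (ι (b ℕ.^ k)) (seq (p 0) n) s)
    where
    lemma : ∀ B x s → B ℚ.* (0ℚ ℚ.* x) ℚ.+ s ≡ s
    lemma = solve 3 (λ B x s → B :* (con 0ℚ :* x) :+ s := s) refl

  M-lower : ∀ k → ιᴿ (M k) ≤ ιᴿ (b ℕ.^ k) * ∑< (suc k) f
  M-lower k = ≤-resp (ιᴿ (M k)) (ιᴿ (b ℕ.^ k) * f 0 + ιᴿ (M k)) (ιᴿ (b ℕ.^ k) * ∑< (suc k) f) (ιᴿ (b ℕ.^ k) * ∑< (suc k) f)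
    (drop-f0 k (ι (M k))) (λ _ → refl) (sum-lower (λ i → i) f f≗ιp k k)

  M-upper : ∀ k → ιᴿ (b ℕ.^ k) * ∑< (suc k) f ≤ ιᴿ (M k ℕ.+ e k)
  M-upper k = ≤-resp (ιᴿ (b ℕ.^ k) * ∑< (suc k) f) (ιᴿ (b ℕ.^ k) * ∑< (suc k) f)
    (ιᴿ (b ℕ.^ k) * f 0 + ιᴿ (M k ℕ.+ e k)) (ιᴿ (M k ℕ.+ e k)) (λ _ → refl) (drop-f0 k (ι (M k ℕ.+ e k)))
    (subst (λ s → ιᴿ (b ℕ.^ k) * ∑< (suc k) f ≤ ιᴿ (b ℕ.^ k) * f 0 + ιᴿ s)
      (trans (∑-cong (downFrom k) (λ j → ℕ.*-distribˡ-+ (suc j) (A k j) 3)) (∑-+ (downFrom k) _ _))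
      (sum-upper (λ i → i) f f≗ιp k k ℕ.≤-refl))

  A-fits : ∀ k → h ℕ.* S k ℕ.≤ b ℕ.^ k
  A-fits k = A-bound (S k) (b ℕ.^ k) (≤-trans (ιᴿ B * p 0 + ιᴿ (S k)) (ιᴿ B * ∑< (suc k) p) (ιᴿ B * 1ℝ) (S-lower k)
    (*-mono-≤ B (∑< (suc k) p) 1ℝ (partial-sum-≤ p 1ℝ 0≤p ∑p (suc k))))
    where
    B = b ℕ.^ k

  module C = Construction {b} {h} pad y unrepeated A (λ _ → refl) A-mono (λ k → A-support k k ℕ.≤-refl) A-fits

  x : ℕ → Fin b
  x = C.limit

  module At (k : ℕ) (1≤k : 1 ℕ.≤ k) (ε : ℚ) (0<ε : 0ℚ ℚ.< ε)
    (∑p-near : Within ε (∑< (suc k) p) 1ℝ) (∑f-near : Within ε (∑< (suc k) f) lam)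
    (small : ι (total-error k) ℚ.≤ ι (b ℕ.^ k) ℚ.* ε) (⌊λbᵏ⌋ : Floor (lam * fromℕ (b ℕ.^ k))) where

    B ℓ D Q : ℕ
    B = b ℕ.^ k
    ℓ = value ⌊λbᵏ⌋
    D = ℕ.∣ ℓ - M k ∣
    Q = D ℕ.+ (error k ℕ.+ 3 ℕ.* suc k)

    Bε : ℚ
    Bε = ι B ℚ.* ε

    0≤Bε : 0ℚ ℚ.≤ Bε
    0≤Bε = ℚ.≤-trans (ℚ.≤-reflexive (sym (ℚ.*-zeroʳ (ι B)))) (*-mono-ι B (ℚ.<⇒≤ 0<ε))

    scale : ∀ u v → u ≤ v + fromℚ ε → ιᴿ B * u ≤ ιᴿ B * v + fromℚ Bε
    scale u v u≤v+ε = ≤-resp (ιᴿ B * u) (ιᴿ B * u) (ιᴿ B * (v + fromℚ ε)) (ιᴿ B * v + fromℚ Bε)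
      (λ _ → refl) (λ n → ℚ.*-distribˡ-+ (ι B) (seq v n) ε) (*-mono-≤ B u (v + fromℚ ε) u≤v+ε)

    commute : ∀ n → seq (lam * fromℕ B) n ≡ seq (ιᴿ B * lam) n
    commute n = trans (cong (seq lam n ℚ.*_) (sym (ι≡/1 B))) (ℚ.*-comm (seq lam n) (ι B))

    ℓ-lower : ιᴿ ℓ ≤ ιᴿ B * lam
    ℓ-lower = ≤-resp (ιᴿ ℓ) (fromℕ ℓ) (lam * fromℕ B) (ιᴿ B * lam) (λ _ → sym (ι≡/1 ℓ)) commute (lower ⌊λbᵏ⌋)

    ℓ-upper : ιᴿ B * lam ≤ ιᴿ (suc ℓ)
    ℓ-upper = ≤-resp (ιᴿ B * lam) (lam * fromℕ B) (fromℕ (suc ℓ)) (ιᴿ (suc ℓ)) commute (λ _ → sym (ι≡/1 (suc ℓ)))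
      (<⇒≤ (lam * fromℕ B) (fromℕ (suc ℓ)) (upper ⌊λbᵏ⌋))

    -- Two chains through the partial sum `σ` of the mean: ℓ ≤ B λ ≤ B σ + B ε ≤ M + e + B ε, and M
    -- ≤ B σ ≤ B λ + B ε ≤ ℓ + 1 + B ε.
    D≤ : ι D ℚ.≤ ι (e k ℕ.+ 1) ℚ.+ Bε
    D≤ = distance-≤ ℓ (M k) (e k) Bε
      (fromℚ-cancel-≤ (ι ℓ) (ι (M k ℕ.+ e k) ℚ.+ Bε) (linearᴿ
        (ιᴿ ℓ + ιᴿ B * lam + ιᴿ B * σ) (ιᴿ B * lam + (ιᴿ B * σ + fromℚ Bε) + ιᴿ (M k ℕ.+ e k))
        (ιᴿ ℓ) (fromℚ (ι (M k ℕ.+ e k) ℚ.+ Bε))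
        (+₃-mono-≤ (ιᴿ ℓ) (ιᴿ B * lam) (ιᴿ B * lam) (ιᴿ B * σ + fromℚ Bε) (ιᴿ B * σ) (ιᴿ (M k ℕ.+ e k))
          ℓ-lower (scale lam σ (proj₂ ∑f-near)) (M-upper k))
        (λ n → lemma (ι ℓ) (ι B ℚ.* seq lam n) (ι B ℚ.* seq σ n) Bε (ι (M k ℕ.+ e k)))))
      (fromℚ-cancel-≤ (ι (M k)) (ι (suc ℓ) ℚ.+ Bε) (linearᴿ
        (ιᴿ (M k) + ιᴿ B * σ + ιᴿ B * lam) (ιᴿ B * σ + (ιᴿ B * lam + fromℚ Bε) + ιᴿ (suc ℓ))
        (ιᴿ (M k)) (fromℚ (ι (suc ℓ) ℚ.+ Bε))
        (+₃-mono-≤ (ιᴿ (M k)) (ιᴿ B * σ) (ιᴿ B * σ) (ιᴿ B * lam + fromℚ Bε) (ιᴿ B * lam) (ιᴿ (suc ℓ))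
          (M-lower k) (scale σ lam (proj₁ ∑f-near)) ℓ-upper)
        (λ n → lemma (ι (M k)) (ι B ℚ.* seq σ n) (ι B ℚ.* seq lam n) Bε (ι (suc ℓ)))))
      where
      σ = ∑< (suc k) f
      lemma : ∀ a u v d m → a ℚ.+ (u ℚ.+ (v ℚ.+ d) ℚ.+ m) ≡ m ℚ.+ d ℚ.+ (a ℚ.+ u ℚ.+ v)
      lemma = solve 5 (λ a u v d m → a :+ (u :+ (v :+ d) :+ m) := m :+ d :+ (a :+ u :+ v)) refl

    -- One `Bε` comes from `D≤`. What remains adds up to `total-error k`, which `small` bounds by
    -- the other.
    Q≤ : ι Q ℚ.≤ Bε ℚ.+ Bε
    Q≤ = linear (ℚ.+-mono-≤ D≤ small) (begin
      ι Q ℚ.+ (ι (e k ℕ.+ 1) ℚ.+ Bε ℚ.+ Bε)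
        ≡⟨ cong (ℚ._+ (ι (e k ℕ.+ 1) ℚ.+ Bε ℚ.+ Bε)) (ι-+ D E) ⟩
      ι D ℚ.+ ι E ℚ.+ (ι (e k ℕ.+ 1) ℚ.+ Bε ℚ.+ Bε)
        ≡⟨ lemma (ι D) (ι E) (ι (e k ℕ.+ 1)) Bε ⟩
      Bε ℚ.+ Bε ℚ.+ (ι D ℚ.+ (ι E ℚ.+ ι (e k ℕ.+ 1)))
        ≡⟨ cong (λ q → Bε ℚ.+ Bε ℚ.+ (ι D ℚ.+ q)) (trans (sym (ι-+ E (e k ℕ.+ 1))) (cong ι (sym (ℕ.+-assoc E (e k) 1)))) ⟩
      Bε ℚ.+ Bε ℚ.+ (ι D ℚ.+ ι (total-error k)) ∎)
      where
      open ≡-Reasoning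
      E = error k ℕ.+ 3 ℕ.* suc k
      lemma : ∀ d q r x → d ℚ.+ q ℚ.+ (r ℚ.+ x ℚ.+ x) ≡ x ℚ.+ x ℚ.+ (d ℚ.+ (q ℚ.+ r))
      lemma = solve 4 (λ d q r x → d :+ q :+ (r :+ x :+ x) := x :+ x :+ (d :+ (q :+ r))) refl

    ℓ-near : Near D ℓ (M k)
    ℓ-near = ℕ.m≤n+∣m-n∣ ℓ (M k) , ℕ.m≤n+∣n-m∣ (M k) ℓ

    cnt : ℕ → ℕ
    cnt = C.count-limit k D ℓ 1≤k ℓ-near

    CountNear : ℕ → Set
    CountNear i = (ιᴿ (cnt i) ≤ ιᴿ B * p i + fromℚ (ι Q ℚ.+ Bε)) × (ιᴿ B * p i ≤ ιᴿ (cnt i) + fromℚ (ι Q ℚ.+ Bε))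

    D+error≤Q : D ℕ.+ error k ℕ.≤ Q
    D+error≤Q = ℕ.+-monoʳ-≤ D (ℕ.m≤m+n (error k) _)

    count-suc-near : ∀ j → j ℕ.< k → CountNear (suc j)
    count-suc-near j j<k =
      linearᴿ (ιᴿ n + ιᴿ a + fromℚ 0ℚ) (fromℚ (ι a ℚ.+ ι Q) + ιᴿ B * p (suc j) + fromℚ Bε)
        (ιᴿ n) (ιᴿ B * p (suc j) + fromℚ (ι Q ℚ.+ Bε))
        (+₃-mono-≤ (ιᴿ n) (fromℚ (ι a ℚ.+ ι Q)) (ιᴿ a) (ιᴿ B * p (suc j)) (fromℚ 0ℚ) (fromℚ Bε)
          (const-≤ (near⇒ι-≤ n a Q (proj₁ near))) (A-lower k j) (const-≤ 0≤Bε))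
        (λ m → lemma₁ (ι n) (ι a) (ι Q) (ι B ℚ.* seq (p (suc j)) m) Bε) ,
      linearᴿ (ιᴿ B * p (suc j) + ιᴿ (a ℕ.+ 3) + fromℚ 0ℚ) (ιᴿ (a ℕ.+ 3) + fromℚ (ι n ℚ.+ ι Q) + fromℚ Bε)
        (ιᴿ B * p (suc j)) (ιᴿ n + fromℚ (ι Q ℚ.+ Bε))
        (+₃-mono-≤ (ιᴿ B * p (suc j)) (ιᴿ (a ℕ.+ 3)) (ιᴿ (a ℕ.+ 3)) (fromℚ (ι n ℚ.+ ι Q)) (fromℚ 0ℚ) (fromℚ Bε)
          (A-upper k j j<k) (const-≤ (near⇒ι-≤ (a ℕ.+ 3) n Q a+3≤)) (const-≤ 0≤Bε))
        (λ m → lemma₂ (ι n) (ι (a ℕ.+ 3)) (ι Q) (ι B ℚ.* seq (p (suc j)) m) Bε)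
      where
      n = cnt (suc j)
      a = A k j
      near₀ : Near (D ℕ.+ error k) n a
      near₀ = C.count-suc k D ℓ 1≤k ℓ-near j j<k
      near : Near Q n a
      near = near-weaken D+error≤Q near₀
      -- The rounding gap 3 fits into the reserve `3 * suc k` of `Q`.
      a+3≤ : a ℕ.+ 3 ℕ.≤ n ℕ.+ Q
      a+3≤ = begin
        a ℕ.+ 3                                      ≤⟨ ℕ.+-monoˡ-≤ 3 (proj₂ near₀) ⟩
        n ℕ.+ (D ℕ.+ error k) ℕ.+ 3                  ≤⟨ ℕ.+-monoʳ-≤ (n ℕ.+ (D ℕ.+ error k)) (ℕ.*-monoʳ-≤ 3 (ℕ.s≤s (ℕ.z≤n {k}))) ⟩
        n ℕ.+ (D ℕ.+ error k) ℕ.+ 3 ℕ.* suc k        ≡⟨ trans (ℕ.+-assoc n _ _) (cong (n ℕ.+_) (ℕ.+-assoc D (error k) _)) ⟩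
        n ℕ.+ Q                                      ∎
        where open ℕ.≤-Reasoning
      lemma₁ : ∀ n a q t x → n ℚ.+ (a ℚ.+ q ℚ.+ t ℚ.+ x) ≡ t ℚ.+ (q ℚ.+ x) ℚ.+ (n ℚ.+ a ℚ.+ 0ℚ)
      lemma₁ = solve 5 (λ n a q t x → n :+ (a :+ q :+ t :+ x) := t :+ (q :+ x) :+ (n :+ a :+ con 0ℚ)) refl
      lemma₂ : ∀ n a q t x → t ℚ.+ (a ℚ.+ (n ℚ.+ q) ℚ.+ x) ≡ n ℚ.+ (q ℚ.+ x) ℚ.+ (t ℚ.+ a ℚ.+ 0ℚ)
      lemma₂ = solve 5 (λ n a q t x → t :+ (a :+ (n :+ q) :+ x) := n :+ (q :+ x) :+ (t :+ a :+ con 0ℚ)) refl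

    -- Both n + S and B p_0 + S are close to B, the former by counting words and the latter because
    -- the partial sum `σ` is close to 1. Hence n is close to B p_0.
    count-zero-near : CountNear 0
    count-zero-near =
      linearᴿ (fromℚ (ι n ℚ.+ ι s₃) + ιᴿ B * 1ℝ + ιᴿ B * σ) (fromℚ (ι B ℚ.+ ι Q) + (ιᴿ B * σ + fromℚ Bε) + (ιᴿ B * p 0 + ιᴿ s₃))
        (ιᴿ n) (ιᴿ B * p 0 + fromℚ (ι Q ℚ.+ Bε))
        (+₃-mono-≤ (fromℚ (ι n ℚ.+ ι s₃)) (fromℚ (ι B ℚ.+ ι Q)) (ιᴿ B * 1ℝ) (ιᴿ B * σ + fromℚ Bε) (ιᴿ B * σ) (ιᴿ B * p 0 + ιᴿ s₃)
          (const-≤ n+s₃≤) (scale 1ℝ σ (proj₂ ∑p-near)) (S-upper k))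
        (λ m → lemma₁ (ι n) (ι s₃) (ι B) (ι Q) (ι B ℚ.* seq σ m) Bε (ι B ℚ.* seq (p 0) m)) ,
      linearᴿ (ιᴿ B * p 0 + ιᴿ s + ιᴿ B * σ + ιᴿ B) (ιᴿ B * σ + (ιᴿ B * 1ℝ + fromℚ Bε) + fromℚ (ι n ℚ.+ ι s ℚ.+ ι Q))
        (ιᴿ B * p 0) (ιᴿ n + fromℚ (ι Q ℚ.+ Bε))
        (+₃-mono-≤ (ιᴿ B * p 0 + ιᴿ s) (ιᴿ B * σ) (ιᴿ B * σ) (ιᴿ B * 1ℝ + fromℚ Bε) (ιᴿ B) (fromℚ (ι n ℚ.+ ι s ℚ.+ ι Q))
          (S-lower k) (scale σ 1ℝ (proj₁ ∑p-near)) (const-≤ B≤))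
        (λ m → lemma₂ (ι B ℚ.* seq (p 0) m) (ι s) (ι B ℚ.* seq σ m) (ι B) Bε (ι n) (ι Q))
      where
      n = cnt 0
      s = S k
      s₃ = S k ℕ.+ k ℕ.* 3
      σ = ∑< (suc k) p
      near₀ : Near (D ℕ.+ error k) (n ℕ.+ s) B
      near₀ = C.count-zero k D ℓ 1≤k ℓ-near
      n+s₃≤ : ι n ℚ.+ ι s₃ ℚ.≤ ι B ℚ.+ ι Q
      n+s₃≤ = ℚ.≤-trans (ℚ.≤-reflexive (sym (ι-+ n s₃))) (near⇒ι-≤ (n ℕ.+ s₃) B Q (begin
        n ℕ.+ (s ℕ.+ k ℕ.* 3)                       ≡⟨ ℕ.+-assoc n s _ ⟨
        n ℕ.+ s ℕ.+ k ℕ.* 3                         ≤⟨ ℕ.+-mono-≤ (proj₁ near₀) (ℕ.≤-trans (ℕ.≤-reflexive (ℕ.*-comm k 3)) (ℕ.*-monoʳ-≤ 3 (ℕ.n≤1+n k))) ⟩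
        B ℕ.+ (D ℕ.+ error k) ℕ.+ 3 ℕ.* suc k       ≡⟨ trans (ℕ.+-assoc B _ _) (cong (B ℕ.+_) (ℕ.+-assoc D (error k) _)) ⟩
        B ℕ.+ Q                                     ∎))
        where open ℕ.≤-Reasoning
      B≤ : ι B ℚ.≤ ι n ℚ.+ ι s ℚ.+ ι Q
      B≤ = ℚ.≤-trans (near⇒ι-≤ B (n ℕ.+ s) Q (proj₂ (near-weaken D+error≤Q near₀))) (ℚ.≤-reflexive (cong (ℚ._+ ι Q) (ι-+ n s)))
      lemma₁ : ∀ n s c q t x z → n ℚ.+ (c ℚ.+ q ℚ.+ (t ℚ.+ x) ℚ.+ (z ℚ.+ s)) ≡ z ℚ.+ (q ℚ.+ x) ℚ.+ (n ℚ.+ s ℚ.+ c ℚ.* 1ℚ ℚ.+ t)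
      lemma₁ = solve 7 (λ n s c q t x z → n :+ (c :+ q :+ (t :+ x) :+ (z :+ s)) := z :+ (q :+ x) :+ (n :+ s :+ c :* con 1ℚ :+ t)) refl
      lemma₂ : ∀ z s t c x n q → z ℚ.+ (t ℚ.+ (c ℚ.* 1ℚ ℚ.+ x) ℚ.+ (n ℚ.+ s ℚ.+ q)) ≡ n ℚ.+ (q ℚ.+ x) ℚ.+ (z ℚ.+ s ℚ.+ t ℚ.+ c)
      lemma₂ = solve 7 (λ z s t c x n q → z :+ (t :+ (c :* con 1ℚ :+ x) :+ (n :+ s :+ q)) := n :+ (q :+ x) :+ (z :+ s :+ t :+ c)) refl

    count-near-p : ∀ i → i ℕ.≤ k → CountNear i
    count-near-p zero    _   = count-zero-near
    count-near-p (suc j) j<k = count-suc-near j j<k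

    -- The allowance `ι Q + Bε` in `CountNear` is at most three times `Bε`, and everything is
    -- divided by `B`.
    Z-within : ∀ i → i ℕ.≤ k → Within (ε ℚ.+ ε ℚ.+ ε) (Z lam i x k ⌊λbᵏ⌋) (p i)
    Z-within i i≤k =
      *-cancel-≤ B z (p i + fromℚ δ) 1≤B (linearᴿ (ιᴿ (cnt i) + ιᴿ Q) (ιᴿ B * p i + fromℚ (ι Q ℚ.+ Bε) + fromℚ (Bε ℚ.+ Bε))
        (ιᴿ B * z) (ιᴿ B * (p i + fromℚ δ))
        (+-mono-≤ (ιᴿ (cnt i)) (ιᴿ B * p i + fromℚ (ι Q ℚ.+ Bε)) (ιᴿ Q) (fromℚ (Bε ℚ.+ Bε)) (proj₁ (count-near-p i i≤k)) (const-≤ Q≤))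
        (λ m → trans (cong (ℚ._+ (ι B ℚ.* seq (p i) m ℚ.+ (ι Q ℚ.+ Bε) ℚ.+ (Bε ℚ.+ Bε))) Bz≡)
          (lemma₁ (ι (cnt i)) (ι B) (seq (p i) m) (ι Q) ε))) ,
      *-cancel-≤ B (p i) (z + fromℚ δ) 1≤B (linearᴿ (ιᴿ B * p i + ιᴿ Q) (ιᴿ (cnt i) + fromℚ (ι Q ℚ.+ Bε) + fromℚ (Bε ℚ.+ Bε))
        (ιᴿ B * p i) (ιᴿ B * (z + fromℚ δ))
        (+-mono-≤ (ιᴿ B * p i) (ιᴿ (cnt i) + fromℚ (ι Q ℚ.+ Bε)) (ιᴿ Q) (fromℚ (Bε ℚ.+ Bε)) (proj₂ (count-near-p i i≤k)) (const-≤ Q≤))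
        (λ m → trans (lemma₂ (ι (cnt i)) (ι B) (seq (p i) m) (ι Q) ε)
          (cong (ℚ._+ (ι B ℚ.* seq (p i) m ℚ.+ ι Q)) (trans (cong (ℚ._+ ι B ℚ.* δ) (sym Bz≡)) (sym (ℚ.*-distribˡ-+ (ι B) (seq z 0) δ))))))
      where
      δ = ε ℚ.+ ε ℚ.+ ε
      z = Z lam i x k ⌊λbᵏ⌋
      1≤B : 1 ℕ.≤ B
      1≤B = ℕ.m^n>0 b {{ℕ.>-nonZero 1≤b}} k
      Bz≡ : ι B ℚ.* seq z 0 ≡ ι (cnt i)
      Bz≡ = trans (ι*[c/d] _ B {{ℕ.>-nonZero 1≤B}}) (cong ι (wordsOccurring≡count i k (applyUpTo x (ℓ ℕ.+ k ℕ.∸ 1))))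
      lemma₁ : ∀ n B t q x → n ℚ.+ (B ℚ.* t ℚ.+ (q ℚ.+ B ℚ.* x) ℚ.+ (B ℚ.* x ℚ.+ B ℚ.* x)) ≡ B ℚ.* (t ℚ.+ (x ℚ.+ x ℚ.+ x)) ℚ.+ (n ℚ.+ q)
      lemma₁ = solve 5 (λ n B t q x → n :+ (B :* t :+ (q :+ B :* x) :+ (B :* x :+ B :* x)) := B :* (t :+ (x :+ x :+ x)) :+ (n :+ q)) refl
      lemma₂ : ∀ n B t q x → B ℚ.* t ℚ.+ (n ℚ.+ (q ℚ.+ B ℚ.* x) ℚ.+ (B ℚ.* x ℚ.+ B ℚ.* x)) ≡ n ℚ.+ B ℚ.* (x ℚ.+ x ℚ.+ x) ℚ.+ (B ℚ.* t ℚ.+ q)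
      lemma₂ = solve 5 (λ n B t q x → B :* t :+ (n :+ (q :+ B :* x) :+ (B :* x :+ B :* x)) := n :+ B :* (x :+ x :+ x) :+ (B :* t :+ q)) refl

  Z-limit : ∀ i → Z lam i x ⇀ p i
  Z-limit i ε₀ 0<ε₀ = suc i ℕ.+ (N₁ ℕ.+ (N₂ ℕ.+ N₃)) , λ k N≤k ⌊λbᵏ⌋ →
    within⇒∣-∣< (Z lam i x k ⌊λbᵏ⌋) (p i) (ε ℚ.+ ε ℚ.+ ε) ε ε₀ 0<ε (trans (ε+⋯+ε ε) 5ε≡ε₀)
      (At.Z-within k (ℕ.≤-trans (ℕ.s≤s ℕ.z≤n) (i< N≤k)) ε 0<ε
        (∣-∣<⇒within (∑< (suc k) p) 1ℝ ε (proj₂ (∑p ε 0<ε) (suc k) (ℕ.m≤n⇒m≤1+n (N₁≤ N≤k))))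
        (∣-∣<⇒within (∑< (suc k) f) lam ε (proj₂ (∑ip ε 0<ε) (suc k) (ℕ.m≤n⇒m≤1+n (N₂≤ N≤k))))
        (ℚ.≤-trans (proj₂ (error-vanishes ε 0<ε) k (N₃≤ N≤k))
          (ℚ.*-monoʳ-≤-nonNeg ε {{ℚ.nonNegative (ℚ.<⇒≤ 0<ε)}} (ι-mono (ℕ.^-monoˡ-≤ k 2≤b))))
        ⌊λbᵏ⌋ i (ℕ.<⇒≤ (i< N≤k)))
    where
    -- Three `ε` are spent in `Z-within` and two in `within⇒∣-∣<`.
    five : ℚ
    five = + 5 ℚ./ 1
    divided = divide five ε₀ (ℚ.positive⁻¹ five) 0<ε₀
    ε = proj₁ divided
    0<ε = proj₁ (proj₂ divided)
    5ε≡ε₀ = proj₂ (proj₂ divided)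
    N₁ = proj₁ (∑p ε 0<ε)
    N₂ = proj₁ (∑ip ε 0<ε)
    N₃ = proj₁ (error-vanishes ε 0<ε)
    module _ {k : ℕ} (N≤k : suc i ℕ.+ (N₁ ℕ.+ (N₂ ℕ.+ N₃)) ℕ.≤ k) where
      i< : i ℕ.< k
      i< = ℕ.m+n≤o⇒m≤o (suc i) N≤k
      N₁≤ : N₁ ℕ.≤ k
      N₁≤ = ℕ.m+n≤o⇒m≤o N₁ (ℕ.m+n≤o⇒n≤o (suc i) N≤k)
      N₂≤ : N₂ ℕ.≤ k
      N₂≤ = ℕ.m+n≤o⇒m≤o N₂ (ℕ.m+n≤o⇒n≤o N₁ (ℕ.m+n≤o⇒n≤o (suc i) N≤k))
      N₃≤ : N₃ ℕ.≤ k
      N₃≤ = ℕ.m+n≤o⇒n≤o N₂ (ℕ.m+n≤o⇒n≤o N₁ (ℕ.m+n≤o⇒n≤o (suc i) N≤k))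
    ε+⋯+ε : ∀ ε → ε ℚ.+ ε ℚ.+ ε ℚ.+ ε ℚ.+ ε ≡ five ℚ.* ε
    ε+⋯+ε = solve 1 (λ ε → ε :+ ε :+ ε :+ ε :+ ε := con five :* ε) refl


-- Room for the letters in the word `y`

A-bound₁ : ∀ p₀ → 0ℝ ≤ p₀ → ∀ S B → ιᴿ B * p₀ + ιᴿ S ≤ ιᴿ B * 1ℝ → 1 ℕ.* S ℕ.≤ B
A-bound₁ p₀ 0≤p₀ S B h = ℕ.≤-trans (ℕ.≤-reflexive (ℕ.*-identityˡ S)) (ι-cancel-≤ S B (subst₂ ℚ._≤_
  (trans (cong (ℚ._+ ι S) (ℚ.*-zeroʳ (ι B))) (ℚ.+-identityˡ (ι S))) (ℚ.*-identityʳ (ι B))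
  (fromℚ-cancel-≤ (ι B ℚ.* 0ℚ ℚ.+ ι S) (ι B ℚ.* 1ℚ)
    (≤-trans (ιᴿ B * 0ℝ + ιᴿ S) (ιᴿ B * p₀ + ιᴿ S) (ιᴿ B * 1ℝ)
      (+-mono-≤ (ιᴿ B * 0ℝ) (ιᴿ B * p₀) (ιᴿ S) (ιᴿ S) (*-mono-≤ B 0ℝ p₀ 0≤p₀) (const-≤ {ι S} ℚ.≤-refl)) h))))

-- The share of `p₀` takes at least half of `B`, so at most the other half is left for `S`; adding
-- this inequality to itself avoids a division.
A-bound₂ : ∀ p₀ → fromℚ ½ ≤ p₀ → ∀ S B → ιᴿ B * p₀ + ιᴿ S ≤ ιᴿ B * 1ℝ → 2 ℕ.* S ℕ.≤ B
A-bound₂ p₀ ½≤p₀ S B h = ι-cancel-≤ (2 ℕ.* S) B (linear (ℚ.+-mono-≤ half-bound half-bound) (begin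
    ι (2 ℕ.* S) ℚ.+ (ι B ℚ.* 1ℚ ℚ.+ ι B ℚ.* 1ℚ)
      ≡⟨ cong (ℚ._+ (ι B ℚ.* 1ℚ ℚ.+ ι B ℚ.* 1ℚ)) (trans (cong (λ n → ι (S ℕ.+ n)) (ℕ.+-identityʳ S)) (ι-+ S S)) ⟩
    ι S ℚ.+ ι S ℚ.+ (ι B ℚ.* 1ℚ ℚ.+ ι B ℚ.* 1ℚ)
      ≡⟨ lemma (ι S) (ι B) ⟩
    ι B ℚ.+ (ι B ℚ.* ½ ℚ.+ ι S ℚ.+ (ι B ℚ.* ½ ℚ.+ ι S)) ∎))
  where
  open ≡-Reasoning
  open +-*-Solver using (solve; _:=_; _:+_; _:*_; con)
  lemma : ∀ s c → s ℚ.+ s ℚ.+ (c ℚ.* 1ℚ ℚ.+ c ℚ.* 1ℚ) ≡ c ℚ.+ (c ℚ.* ½ ℚ.+ s ℚ.+ (c ℚ.* ½ ℚ.+ s))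
  lemma = solve 2 (λ s c → s :+ s :+ (c :* con 1ℚ :+ c :* con 1ℚ) := c :+ (c :* con ½ :+ s :+ (c :* con ½ :+ s))) refl
  half-bound : ι B ℚ.* ½ ℚ.+ ι S ℚ.≤ ι B ℚ.* 1ℚ
  half-bound = fromℚ-cancel-≤ (ι B ℚ.* ½ ℚ.+ ι S) (ι B ℚ.* 1ℚ)
    (≤-trans (ιᴿ B * fromℚ ½ + ιᴿ S) (ιᴿ B * p₀ + ιᴿ S) (ιᴿ B * 1ℝ)
      (+-mono-≤ (ιᴿ B * fromℚ ½) (ιᴿ B * p₀) (ιᴿ S) (ιᴿ S) (*-mono-≤ B (fromℚ ½) p₀ ½≤p₀) (const-≤ {ι S} ℚ.≤-refl)) h)

-- The prefix of y of length b^k / h repeats no word of length k, and A-bound says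
-- that the S letters required by p_1, p_2, … fit into it.
record Supply (b : ℕ) (p₀ : ℝ) : Set where
  field
    h          : ℕ
    A-bound    : ∀ S B → ιᴿ B * p₀ + ιᴿ S ≤ ιᴿ B * 1ℝ → h ℕ.* S ℕ.≤ B
    pad        : Fin b
    y          : ℕ → Fin b
    unrepeated : Unrepeated {b} h y

supply : ∀ b .{{_ : NonTrivial b}} p₀ → 0ℝ ≤ p₀ → (b ≡ 2 → fromℚ ½ ≤ p₀) → Supply b p₀
supply 0 {{nt}} _ _ _ = contradiction (ℕ.nonTrivial⇒n>1 0 {{nt}}) λ ()
supply 1 {{nt}} _ _ _ = contradiction refl (ℕ.nonTrivial⇒≢1 {{nt}})
supply 2 p₀ _ ½≤p₀ = record
  { h = 2 ; A-bound = A-bound₂ p₀ (½≤p₀ refl) ; pad = zero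
  ; y = proj₁ unrepeated₂ ; unrepeated = proj₂ unrepeated₂ }
supply (suc (suc (suc b))) p₀ 0≤p₀ _ = record
  { h = 1 ; A-bound = A-bound₁ p₀ 0≤p₀ ; pad = zero
  ; y = proj₁ (unrepeated₁ b) ; unrepeated = proj₂ (unrepeated₁ b) }

theorem1 : (b : ℕ) .{{_ : NonTrivial b}} (lam : ℝ) (p : ℕ → ℝ) →
    0ℝ < lam →
    (∀ i → 0ℝ ≤ p i) →
    HasSum p 1ℝ →
    HasSum (λ i → fromℕ i * p i) lam →
    (b ≡ 2 → fromℚ ½ ≤ p 0) →
    Σ[ x ∈ (ℕ → Fin b) ] (∀ i → Z lam i x ⇀ p i)
theorem1 b lam p _ 0≤p ∑p ∑ip ½≤p₀ =
  Main.x b lam p 0≤p ∑p ∑ip h A-bound pad y unrepeated ,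
  Main.Z-limit b lam p 0≤p ∑p ∑ip h A-bound pad y unrepeated
  where open Supply (supply b (p 0) (0≤p 0) ½≤p₀)
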